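{- For every integer $k\geq 3$ and every $\gamma>0$ there exists $n_0$ such that the following holds for all $n\geq n_0$. Let $V$ be a set of $n$ vertices and let $\mathbf{H}=\{H_i\}_{i\in[n]}$ be a family of (not necessarily distinct) $k$-graphs on $V$ such that $\delta_{k-1}(H_i)\geq(1/2+\gamma)n$ for every $i\in[n]$. Then $\mathbf{H}$ admits a rainbow tight Hamilton cycle, i.e. there is a cyclic ordering $v_1v_2\cdots v_n$ of $V$ and an injective map $\phi$ from the set of edges $\{v_j,v_{j+1},\ldots,v_{j+k-1}\}$ ($j\in[n]$, indices modulo $n$) to $[n]$ such that every such edge $e$ belongs to $E(H_{\phi(e)})$.
   Context: A $k$-graph $H$ on $V$ is a set of $k$-element subsets (edges) of $V$. For $S\subseteq V$, $\deg_H(S)$ is the number of edges containing $S$, and $\delta_{k-1}(H)=\min\{\deg_H(S): S\subseteq V, |S|=k-1\}$. The graphs $H_i$ are thought of as colour classes: $i$ is the colour of the edges of $H_i$. A $k$-graph $G$ on $V$ is rainbow (with respect to $\mathbf{H}$) if its edges can be assigned pairwise distinct colours $i$ with each edge lying in the corresponding $H_i$. -}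

module Defs where

open import Data.Nat as ℕ using (ℕ; zero; suc; _∸_)
open import Data.Nat.DivMod using (_mod_)
open import Data.Fin as Fin using (Fin; toℕ)
open import Data.Fin.Subset using (Subset; _⊆_; ⋃; ⁅_⁆; ∣_∣)
open import Data.Fin.Subset.Properties using (_⊆?_)
open import Data.Fin.Permutation using (Permutation′; _⟨$⟩ʳ_)
open import Data.Bool using (Bool; true; false)
open import Data.List as List using (List; []; _∷_; filter; length; allFin)
open import Data.Product using (_×_; Σ)
open import Data.Rational as ℚ using (ℚ; ½)
open import Data.Integer using (+_)
open import Relation.Binary.PropositionalEquality using (_≡_)
open import Relation.Nullary using (¬_; Dec; yes; no)
open import Relation.Nullary.Decidable using (_×-dec_)
import Data.Vec
open import Data.Bool.Properties using () renaming (_≟_ to _≟B_)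

record KGraph (k n : ℕ) : Set where
  field
    edge    : Subset n → Bool
    uniform : ∀ e → edge e ≡ true → ∣ e ∣ ≡ k
open KGraph public

_∈E_ : ∀ {k n} → Subset n → KGraph k n → Set
e ∈E H = edge H e ≡ true

allSubsets : (n : ℕ) → List (Subset n)
allSubsets zero    = Data.Vec.[] ∷ []
allSubsets (suc n) = List.map (true Data.Vec.∷_) (allSubsets n)
                     List.++ List.map (false Data.Vec.∷_) (allSubsets n)

deg : ∀ {k n} → KGraph k n → Subset n → ℕ
deg {n = n} H S = length (filter (λ T → (S ⊆? T) ×-dec (edge H T ≟B true)) (allSubsets n))

MinCodegreeAtLeast : ∀ {k n} → KGraph k n → ℚ → Set
MinCodegreeAtLeast {k} {n} H x =
  ∀ (S : Subset n) → ∣ S ∣ ≡ k ∸ 1 → x ℚ.≤ (+ deg H S ℚ./ 1)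

shift : ∀ {n} → Fin n → ℕ → Fin n
shift {suc m} j t = (toℕ j ℕ.+ t) mod (suc m)

tightEdge : ∀ {n} (k : ℕ) → Permutation′ n → Fin n → Subset n
tightEdge k σ j = ⋃ (List.map (λ (t : Fin k) → ⁅ σ ⟨$⟩ʳ shift j (toℕ t) ⁆) (allFin k))

-- H admits a rainbow tight Hamilton cycle: a cyclic ordering σ and a map φ
-- from the set of edges {e_j : j ∈ [n]} to [n] (given on indices j, required
-- to be well defined on edges) which is injective, with e ∈ E(H_{φ(e)}).
RainbowTightHamCycle : ∀ {k n} → (Fin n → KGraph k n) → Set
RainbowTightHamCycle {k} {n} H =
  Σ (Permutation′ n) λ σ →
  Σ (Fin n → Fin n) λ φ →
    (∀ j j′ → tightEdge k σ j ≡ tightEdge k σ j′ → φ j ≡ φ j′)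
  × (∀ j j′ → φ j ≡ φ j′ → tightEdge k σ j ≡ tightEdge k σ j′)
  × (∀ j → tightEdge k σ j ∈E H (φ j))

{-# OPTIONS --safe #-}
module Submission where

-- The absorption method with all probabilistic arguments replaced by counting.  "Many d P"
-- says that P has density at least 1/d, and a block of such quantifiers over vertices and
-- colours can be reordered, so every coordinate of a dense configuration can be blown up
-- into any bounded number of distinct copies.
--
-- * Two (k-1)-sets have at least 2γn common neighbours, in any two colours.  Hence every
--   pair (v , c) of a vertex and a colour has a positive density of absorbers: paths of
--   2(k-1) vertices into whose middle v can be inserted at the price of the colour c.
--   Likewise any two ordered (k-1)-tuples S and T are joined by many short paths: choose F
--   backwards from T, then X forwards from S so that all mixtures of X and F are edges,
--   and let the path run through copies of X that turn into copies of F.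
-- * Greedily minimising an exponentially weighted count of unserved requests yields linearly
--   many disjoint tuples such that every request is served linearly often.  Applied to
--   absorbers, and then to connecting paths, this gives an absorbing path and a reservoir.
-- * All but few of the remaining vertices are covered by long paths.  If a positive
--   proportion is uncovered, some block P (a path, or a chunk of uncovered vertices) has half
--   of its vertices in the common neighbourhood of a blow-up of uncovered vertices and unused
--   colours; weaving that half with the blow-up gives a path longer than P, since k ≥ 3.
-- * The reservoir joins the paths and the absorbing path into a cycle.  It misses equally
--   many vertices and colours, which are paired up arbitrarily and absorbed.

-- Codegrees just above n/2 give a common neighbour of two (k-1)-sets but not of three, so no vertex
-- of a gadget may face more than two edge conditions when it is first chosen. This is why absorbers
-- extend exactly two paths at once, and why connectors exchange X for F one vertex at a time.
-- Choosing coordinates one after another yields nested densities. Reordering them costs only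
-- constants, so copies of a coordinate are chosen independently and distinctness is imposed
-- afterwards. Vertices and colours both live in `Fin n`: one quantifier block ranges over both, and
-- one freshness condition separates them. There are polynomially many requests, whereas a family of
-- size O(m) can serve 2^m requests m times each; with m linear in n one greedy choice therefore
-- handles all pairs (v , c), or all pairs of ends. The absorbing capacity has to exceed the
-- reservoir plus the uncovered remainder. This orders the constants: all sizes are fixed multiples
-- of one scale n / L, and the path length M is a constant chosen after L.

module RainbowCycles where

  open import Defs
  open import Data.Nat as ℕ using (ℕ; zero; suc; _+_; _*_; _∸_; _^_; _≤_; _<_; z≤n; s≤s; NonZero)
  open import Data.Nat.Properties
  open import Data.Nat.DivMod using (_/_; _%_; m≡m%n+[m/n]*n; m%n<n; m/n*n≤m; /-monoˡ-≤; m*n/n≡m; m<n⇒m%n≡m; [m+n]%n≡m%n)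
  open import Data.Nat.Tactic.RingSolver using (solve-∀)
  open import Data.Fin as Fin using (Fin; zero; suc)
  import Data.Fin.Properties as Finₚ
  open import Data.Fin.Permutation using (Permutation′; permutation; _⟨$⟩ʳ_)
  open import Data.Fin.Subset as Sub using (Subset; ⁅_⁆; _∪_; ⋃; ∣_∣; inside; outside)
  import Data.Fin.Subset.Properties as Subₚ
  open import Data.Bool using (Bool; true; false; _∧_; not)
  open import Data.Bool.Properties using () renaming (_≟_ to _≟ᵇ_)
  open import Data.Maybe using (Maybe; just; nothing)
  open import Data.List as List using (List; []; _∷_; _++_; length; map; take; drop; allFin; concat; filter; reverse; replicate)
  open import Data.List.Properties
  open import Data.List.Relation.Unary.All as All using (All; []; _∷_)
  import Data.List.Relation.Unary.All.Properties as Allₚ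
  open import Data.List.Relation.Unary.Any as Any using (Any; here; there)
  import Data.List.Relation.Unary.Any.Properties as Anyₚ
  open import Data.List.Relation.Unary.AllPairs using ([]; _∷_)
  open import Data.List.Relation.Unary.Unique.Propositional using (Unique)
  import Data.List.Relation.Unary.Unique.Propositional.Properties as Uniqueₚ
  open import Data.List.Relation.Unary.Unique.DecPropositional using (unique?)
  open import Data.List.Membership.Propositional using (_∈_; _∉_)
  open import Data.List.Membership.Propositional.Properties
  open import Data.List.Relation.Binary.Permutation.Propositional using (_↭_; refl; prep; swap; trans; ↭-sym; ↭-refl; ↭-reflexive)
  open import Data.List.Relation.Binary.Permutation.Propositional.Properties as Permₚ using (↭-length; ∈-resp-↭; All-resp-↭; ++-comm)
  open import Data.List.Relation.Binary.Pointwise as Pw using (Pointwise; []; _∷_)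
  open import Data.Vec as Vec using (Vec; []; _∷_; toList; here; there)
  import Data.Vec.Properties as Vecₚ
  import Data.Integer as ℤ
  import Data.Integer.Properties as ℤₚ
  import Data.Rational as ℚ
  import Data.Rational.Properties as ℚₚ
  import Data.Rational.Unnormalised as ℚᵘ
  import Data.Rational.Unnormalised.Properties as ℚᵘₚ
  open import Data.Product using (Σ; ∃; _×_; _,_; proj₁; proj₂)
  open import Data.Sum using (_⊎_; inj₁; inj₂)
  open import Data.Unit using (⊤; tt)
  open import Function using (_∘_; id; case_of_)
  import Algebra.Solver.CommutativeMonoid as CMSolver
  open import Relation.Nullary using (¬_; Dec; yes; no; contradiction; does)
  open import Relation.Nullary.Decidable using (_×-dec_)
  open import Relation.Binary.PropositionalEquality as ≡ using (_≡_; _≢_; cong; cong₂; sym; subst) renaming (refl to ≡refl; trans to ≡trans)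

  private
    variable
      A B Q : Set
      n m d e t : ℕ

  -- Finite sums

  ∑ : List A → (A → ℕ) → ℕ
  ∑ []       f = 0
  ∑ (x ∷ xs) f = f x + ∑ xs f

  ∑-mono-∈ : ∀ (xs : List A) {f g : A → ℕ} → (∀ {x} → x ∈ xs → f x ≤ g x) → ∑ xs f ≤ ∑ xs g
  ∑-mono-∈ []       h = z≤n
  ∑-mono-∈ (x ∷ xs) h = +-mono-≤ (h (here ≡refl)) (∑-mono-∈ xs (h ∘ there))

  ∑-mono : ∀ (xs : List A) {f g : A → ℕ} → (∀ x → f x ≤ g x) → ∑ xs f ≤ ∑ xs g
  ∑-mono xs h = ∑-mono-∈ xs (λ {x} _ → h x)

  ∑-cong : ∀ (xs : List A) {f g : A → ℕ} → (∀ x → f x ≡ g x) → ∑ xs f ≡ ∑ xs g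
  ∑-cong []       h = ≡refl
  ∑-cong (x ∷ xs) h = cong₂ _+_ (h x) (∑-cong xs h)

  ∑-+ : ∀ (xs : List A) (f g : A → ℕ) → ∑ xs (λ x → f x + g x) ≡ ∑ xs f + ∑ xs g
  ∑-+ []       f g = ≡refl
  ∑-+ (x ∷ xs) f g = ≡trans (cong (f x + g x +_) (∑-+ xs f g)) (interchange (f x) (g x) (∑ xs f) (∑ xs g))
    where
    interchange : ∀ a b c d → a + b + (c + d) ≡ a + c + (b + d)
    interchange = solve-∀

  ∑-*ˡ : ∀ (xs : List A) (c : ℕ) (f : A → ℕ) → ∑ xs (λ x → c * f x) ≡ c * ∑ xs f
  ∑-*ˡ []       c f = sym (*-zeroʳ c)
  ∑-*ˡ (x ∷ xs) c f = ≡trans (cong (c * f x +_) (∑-*ˡ xs c f)) (sym (*-distribˡ-+ c (f x) (∑ xs f)))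

  ∑-const : ∀ (xs : List A) c → ∑ xs (λ _ → c) ≡ length xs * c
  ∑-const []       c = ≡refl
  ∑-const (x ∷ xs) c = cong (c +_) (∑-const xs c)

  ∑-swap : ∀ (xs : List A) (ys : List B) (f : A → B → ℕ) →
           ∑ xs (λ x → ∑ ys (f x)) ≡ ∑ ys (λ y → ∑ xs (λ x → f x y))
  ∑-swap []       ys f = sym (≡trans (∑-const ys 0) (*-zeroʳ (length ys)))
  ∑-swap (x ∷ xs) ys f = ≡trans (cong (∑ ys (f x) +_) (∑-swap xs ys f)) (sym (∑-+ ys (f x) _))

  ∑-++ : ∀ (xs ys : List A) (f : A → ℕ) → ∑ (xs ++ ys) f ≡ ∑ xs f + ∑ ys f
  ∑-++ []       ys f = ≡refl
  ∑-++ (x ∷ xs) ys f = ≡trans (cong (f x +_) (∑-++ xs ys f)) (sym (+-assoc (f x) _ _))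

  ∑-concat : ∀ (xss : List (List A)) (f : A → ℕ) → ∑ (concat xss) f ≡ ∑ xss (λ xs → ∑ xs f)
  ∑-concat []         f = ≡refl
  ∑-concat (xs ∷ xss) f = ≡trans (∑-++ xs (concat xss) f) (cong (∑ xs f +_) (∑-concat xss f))

  ∑-↭ : ∀ {xs ys : List A} (f : A → ℕ) → xs ↭ ys → ∑ xs f ≡ ∑ ys f
  ∑-↭ f refl         = ≡refl
  ∑-↭ f (prep x p)   = cong (f x +_) (∑-↭ f p)
  ∑-↭ f (swap x y p) = ≡trans (cong (λ s → f x + (f y + s)) (∑-↭ f p)) (exch (f x) (f y) _)
    where
    exch : ∀ a b c → a + (b + c) ≡ b + (a + c)
    exch = solve-∀
  ∑-↭ f (trans p q)  = ≡trans (∑-↭ f p) (∑-↭ f q)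

  χ : Bool → ℕ
  χ true  = 1
  χ false = 0

  χ≤1 : ∀ b → χ b ≤ 1
  χ≤1 true  = ≤-refl
  χ≤1 false = z≤n

  # : (Fin n → Bool) → ℕ
  # {n} f = ∑ (allFin n) (χ ∘ f)

  length-allFin : ∀ n → length (allFin n) ≡ n
  length-allFin n = length-tabulate {n = n} id

  _∈?_ : (x : Fin n) (xs : List (Fin n)) → Dec (x ∈ xs)
  x ∈? xs = Any.any? (x Fin.≟_) xs

  _∈ᵇ_ : Fin n → List (Fin n) → Bool
  x ∈ᵇ xs = does (x ∈? xs)

  ∈ᵇ-true : ∀ {x : Fin n} {xs} → x ∈ xs → x ∈ᵇ xs ≡ true
  ∈ᵇ-true {x = x} {xs} x∈ with x ∈? xs
  ... | yes _ = ≡refl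
  ... | no x∉ = contradiction x∈ x∉

  ∉ᵇ-sound : ∀ {x : Fin n} {xs} → not (x ∈ᵇ xs) ≡ true → x ∉ xs
  ∉ᵇ-sound p x∈ rewrite ∈ᵇ-true x∈ = case p of λ ()

  ∑-∉ : ∀ {b : Fin n} xs → b ∉ xs → ∑ xs (λ x → χ (does (x Fin.≟ b))) ≡ 0
  ∑-∉ []       _  = ≡refl
  ∑-∉ {b = b} (x ∷ xs) b∉ with x Fin.≟ b
  ... | yes ≡refl = contradiction (here ≡refl) b∉
  ... | no _      = ∑-∉ xs (b∉ ∘ there)

  ∑-unique≤1 : ∀ {xs : List (Fin n)} b → Unique xs → ∑ xs (λ x → χ (does (x Fin.≟ b))) ≤ 1
  ∑-unique≤1 {xs = []}     b [] = z≤n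
  ∑-unique≤1 {xs = x ∷ xs} b u@(_ ∷ us) with x Fin.≟ b
  ... | yes ≡refl rewrite ∑-∉ {b = b} xs (Uniqueₚ.Unique[x∷xs]⇒x∉xs u) = ≤-refl
  ... | no _ = ∑-unique≤1 b us

  #∈≤length : ∀ (B : List (Fin n)) → # (_∈ᵇ B) ≤ length B
  #∈≤length {n} B = begin
    # (_∈ᵇ B)                                                   ≤⟨ ∑-mono (allFin n) step ⟩
    ∑ (allFin n) (λ x → ∑ B (λ b → χ (does (x Fin.≟ b))))        ≡⟨ ∑-swap (allFin n) B _ ⟩
    ∑ B (λ b → ∑ (allFin n) (λ x → χ (does (x Fin.≟ b))))        ≤⟨ ∑-mono B (λ b → ∑-unique≤1 b (Uniqueₚ.allFin⁺ n)) ⟩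
    ∑ B (λ _ → 1)                                               ≡⟨ ∑-const B 1 ⟩
    length B * 1                                                ≡⟨ *-identityʳ _ ⟩
    length B                                                    ∎
    where
    open ≤-Reasoning
    pos : ∀ {x : Fin n} {C} → x ∈ C → 1 ≤ ∑ C (λ b → χ (does (x Fin.≟ b)))
    pos {x} {b ∷ C} (here ≡refl) with x Fin.≟ b
    ... | yes _ = s≤s z≤n
    ... | no ≢  = contradiction ≡refl ≢
    pos {x} {b ∷ C} (there x∈) = ≤-trans (pos x∈) (m≤n+m _ _)
    step : ∀ x → χ (x ∈ᵇ B) ≤ ∑ B (λ b → χ (does (x Fin.≟ b)))
    step x with x ∈? B
    ... | yes x∈ = pos x∈
    ... | no _   = z≤n

  ∑-average : ∀ (xs : List A) {f : A → ℕ} {a} → length xs * a ≤ ∑ xs f → 1 ≤ length xs → ∃ λ x → a ≤ f x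
  ∑-average (x ∷ xs) {f} {a} h _ = go x xs h
    where
    go : ∀ x xs → length (x ∷ xs) * a ≤ ∑ (x ∷ xs) f → ∃ λ x → a ≤ f x
    next : ∀ x xs → length (x ∷ xs) * a ≤ ∑ (x ∷ xs) f → ¬ (a ≤ f x) → ∃ λ x → a ≤ f x
    next x []       h ¬p = contradiction (≤-trans (m≤m+n a 0) (≤-trans h (≤-reflexive (+-identityʳ (f x))))) ¬p
    next x (y ∷ xs) h ¬p = go y xs (+-cancelˡ-≤ a _ _ (≤-trans h (+-monoˡ-≤ (∑ (y ∷ xs) f) (<⇒≤ (≰⇒> ¬p)))))
    go x xs h with a ≤? f x
    ... | yes p = x , p
    ... | no ¬p = next x xs h ¬p

  does-sound : {P : Set} (q : Dec P) → does q ≡ true → P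
  does-sound (yes p) _ = p

  does-true : {P : Set} (q : Dec P) → P → does q ≡ true
  does-true (yes _) _ = ≡refl
  does-true (no ¬p) p = contradiction p ¬p

  #-exists : (g : Fin n → Bool) → 1 ≤ # g → ∃ λ x → g x ≡ true
  #-exists {n} g h = go (allFin n) h
    where
    go : ∀ xs → 1 ≤ ∑ xs (χ ∘ g) → ∃ λ x → g x ≡ true
    go (x ∷ xs) h with g x in eq
    ... | true  = x , eq
    ... | false = go xs h

  ∧-true : ∀ {a b} → a ∧ b ≡ true → a ≡ true × b ≡ true
  ∧-true {true} {true} _ = ≡refl , ≡refl

  -- Density quantifiers

  -- Many d P: at least n / d of the n elements satisfy P.
  record Many {n : ℕ} (d : ℕ) (P : Fin n → Set) : Set where
    constructor many
    field
      ind   : Fin n → Bool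
      sound : ∀ x → ind x ≡ true → P x
      size  : n ≤ d * # ind
  open Many public

  Many-map : {P Q : Fin n → Set} → (∀ x → P x → Q x) → Many d P → Many d Q
  Many-map h (many f s c) = many f (λ x → h x ∘ s x) c

  Many-weaken : {P : Fin n → Set} → d ≤ e → Many d P → Many e P
  Many-weaken d≤e (many f s c) = many f s (≤-trans c (*-monoˡ-≤ (# f) d≤e))

  Many-all : {P : Fin n → Set} → (∀ x → P x) → Many 1 P
  Many-all {n} h = many (λ _ → true) (λ x _ → h x)
    (≤-reflexive (sym (≡trans (+-identityʳ _) (≡trans (∑-const (allFin n) 1) (≡trans (*-identityʳ _) (length-allFin n))))))

  Many-exists : {P : Fin n → Set} → 1 ≤ n → Many d P → ∃ P
  Many-exists {suc n} {d} _ (many f s c) with # f in eq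
  ... | zero  = contradiction (≤-trans c (≤-reflexive (*-zeroʳ d))) λ ()
  ... | suc _ = let x , p = #-exists f (≤-trans (s≤s z≤n) (≤-reflexive (sym eq))) in x , s x p

  -- The hypothesis bounds B by n/(2d), half of the guaranteed n/d, so the other half survives.
  Many-avoid : {P : Fin n → Set} (B : List (Fin n)) → 2 * d * length B ≤ n → Many d P → Many (2 * d) (λ x → P x × x ∉ B)
  Many-avoid {n} {d} {P} B hB (many f s c) = many g (λ x p → s x (proj₁ (∧-true p)) , ∉ᵇ-sound (proj₂ (∧-true p))) bound
    where
    open ≤-Reasoning
    g : Fin n → Bool
    g x = f x ∧ not (x ∈ᵇ B)
    pt : ∀ a b → χ a ≤ χ (a ∧ not b) + χ b
    pt true true   = ≤-refl
    pt true false  = ≤-refl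
    pt false b     = z≤n
    f≤ : # f ≤ # g + length B
    f≤ = begin
      # f                                               ≤⟨ ∑-mono (allFin n) (λ x → pt (f x) (x ∈ᵇ B)) ⟩
      ∑ (allFin n) (λ x → χ (g x) + χ (x ∈ᵇ B))           ≡⟨ ∑-+ (allFin n) _ _ ⟩
      # g + # (_∈ᵇ B)                                   ≤⟨ +-monoʳ-≤ (# g) (#∈≤length B) ⟩
      # g + length B                                    ∎
    dist : ∀ a b c → 2 * (a * (b + c)) ≡ 2 * a * b + 2 * a * c
    dist = solve-∀
    bound : n ≤ 2 * d * # g
    bound = +-cancelʳ-≤ n n _ (begin
      n + n                                ≡⟨ cong (n +_) (sym (+-identityʳ n)) ⟩
      2 * n                                ≤⟨ *-monoʳ-≤ 2 c ⟩
      2 * (d * # f)                        ≤⟨ *-monoʳ-≤ 2 (*-monoʳ-≤ d f≤) ⟩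
      2 * (d * (# g + length B))           ≡⟨ dist d (# g) (length B) ⟩
      2 * d * # g + 2 * d * length B       ≤⟨ +-monoʳ-≤ (2 * d * # g) hB ⟩
      2 * d * # g + n                      ∎)

  module _ {n : ℕ} {P Q : Fin n → Set} where

    private
      side : (b : Bool) → ∀ x → (b ≡ true → P x ⊎ Q x) → Bool × Bool
      side true  x h with h ≡refl
      ... | inj₁ _ = true , false
      ... | inj₂ _ = false , true
      side false x h = false , false

      side-χ : ∀ b x h → χ b ≤ χ (proj₁ (side b x h)) + χ (proj₂ (side b x h))
      side-χ true  x h with h ≡refl
      ... | inj₁ _ = ≤-refl
      ... | inj₂ _ = ≤-refl
      side-χ false x h = z≤n

      sideˡ : ∀ b x h → proj₁ (side b x h) ≡ true → P x
      sideˡ true x h p with h ≡refl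
      ... | inj₁ px = px
      sideˡ true x h () | inj₂ _

      sideʳ : ∀ b x h → proj₂ (side b x h) ≡ true → Q x
      sideʳ true x h p with h ≡refl
      ... | inj₂ qx = qx
      sideʳ true x h () | inj₁ _

    -- Pigeonhole: the disjunction charges each element of the dense set to one side, and one side
    -- receives at least half.
    Many-split : Many d (λ x → P x ⊎ Q x) → Many (2 * d) P ⊎ Many (2 * d) Q
    Many-split {d} (many f s c) with n ≤? 2 * d * # (λ x → proj₁ (side (f x) x (s x)))
    ... | yes p = inj₁ (many _ (λ x → sideˡ (f x) x (s x)) p)
    ... | no ¬p = inj₂ (many r (λ x → sideʳ (f x) x (s x)) bound)
      where
      open ≤-Reasoning
      l r : Fin n → Bool
      l x = proj₁ (side (f x) x (s x))
      r x = proj₂ (side (f x) x (s x))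
      f≤ : # f ≤ # l + # r
      f≤ = ≤-trans (∑-mono (allFin n) (λ x → side-χ (f x) x (s x))) (≤-reflexive (∑-+ (allFin n) _ _))
      dist : ∀ a b c → 2 * (a * (b + c)) ≡ 2 * a * b + 2 * a * c
      dist = solve-∀
      bound : n ≤ 2 * d * # r
      bound = +-cancelˡ-≤ n n _ (begin
        n + n                         ≡⟨ cong (n +_) (sym (+-identityʳ n)) ⟩
        2 * n                         ≤⟨ *-monoʳ-≤ 2 c ⟩
        2 * (d * # f)                 ≤⟨ *-monoʳ-≤ 2 (*-monoʳ-≤ d f≤) ⟩
        2 * (d * (# l + # r))         ≡⟨ dist d (# l) (# r) ⟩
        2 * d * # l + 2 * d * # r     ≤⟨ +-monoˡ-≤ (2 * d * # r) (<⇒≤ (≰⇒> ¬p)) ⟩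
        n + 2 * d * # r               ∎)

  -- Gives an indicator even when no density is known, namely the empty one. Sums over all indices
  -- then need no case distinction.
  gate : {P : Fin n → Set} (b : Bool) → (b ≡ true → Many d P) →
         Σ (Fin n → Bool) λ h → (∀ x → h x ≡ true → P x) × (n * χ b ≤ d * # h)
  gate {n} true  m = let many f s c = m ≡refl in f , s , ≤-trans (≤-reflexive (*-identityʳ n)) c
  gate {n} false m = (λ _ → false) , (λ _ ()) , ≤-trans (≤-reflexive (*-zeroʳ n)) z≤n

  -- Double counting: there are at least n²/(de) related pairs, and those y with fewer than n/(2de)
  -- partners account for at most half of them.
  Many-swap : {R : Fin n → Fin n → Set} → Many d (λ x → Many e (R x)) →
              Many (2 * (d * e)) (λ y → Many (2 * (d * e)) (λ x → R x y))
  Many-swap {zero}  _ = many (λ ()) (λ ()) z≤n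
  Many-swap {suc n-1} = swap′ (suc n-1)
    where
    swap′ : ∀ n .{{_ : NonZero n}} {d e} {R : Fin n → Fin n → Set} → Many d (λ x → Many e (R x)) →
            Many (2 * (d * e)) (λ y → Many (2 * (d * e)) (λ x → R x y))
    swap′ n {d} {e} {R} (many f s c) = many g g-sound g-size
     where
     open ≤-Reasoning
     D = 2 * (d * e)
     h : Fin n → Fin n → Bool
     h x = proj₁ (gate (f x) (s x))
     col : Fin n → ℕ
     col y = # (λ x → h x y)
     g : Fin n → Bool
     g y = does (n ≤? D * col y)
     g-sound : ∀ y → g y ≡ true → Many D (λ x → R x y)
     g-sound y p = many (λ x → h x y) (λ x → proj₁ (proj₂ (gate (f x) (s x))) y) (does-sound (n ≤? D * col y) p)
     col≤n : ∀ y → col y ≤ n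
     col≤n y = begin
       col y                    ≤⟨ ∑-mono (allFin n) (λ x → χ≤1 (h x y)) ⟩
       ∑ (allFin n) (λ _ → 1)   ≡⟨ ∑-const (allFin n) 1 ⟩
       length (allFin n) * 1    ≡⟨ *-identityʳ _ ⟩
       length (allFin n)        ≡⟨ length-allFin n ⟩
       n                        ∎
     pt : ∀ y → D * col y ≤ n * (D * χ (g y)) + n
     pt y = go (col y) (col≤n y) (n ≤? D * col y)
       where
       cm : ∀ a b → a * b ≡ b * (a * 1)
       cm = solve-∀
       go : ∀ c → c ≤ n → (q : Dec (n ≤ D * c)) → D * c ≤ n * (D * χ (does q)) + n
       go c c≤n (yes _) = ≤-trans (*-monoʳ-≤ D c≤n) (≤-trans (≤-reflexive (cm D n)) (m≤m+n _ n))
       go c c≤n (no ¬p) = ≤-trans (<⇒≤ (≰⇒> ¬p)) (m≤n+m n _)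
     total : n * n ≤ d * e * ∑ (allFin n) col
     total = begin
       n * n                                                ≤⟨ *-monoʳ-≤ n c ⟩
       n * (d * # f)                                        ≡⟨ lem1 n d (# f) ⟩
       d * (n * # f)                                        ≡⟨ cong (d *_) (sym (∑-*ˡ (allFin n) n (χ ∘ f))) ⟩
       d * ∑ (allFin n) (λ x → n * χ (f x))                 ≤⟨ *-monoʳ-≤ d (∑-mono (allFin n) (λ x → proj₂ (proj₂ (gate (f x) (s x))))) ⟩
       d * ∑ (allFin n) (λ x → e * # (h x))                 ≡⟨ cong (d *_) (∑-*ˡ (allFin n) e (λ x → # (h x))) ⟩
       d * (e * ∑ (allFin n) (λ x → # (h x)))               ≡⟨ sym (*-assoc d e _) ⟩
       d * e * ∑ (allFin n) (λ x → # (h x))                 ≡⟨ cong (d * e *_) (∑-swap (allFin n) (allFin n) (λ x y → χ (h x y))) ⟩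
       d * e * ∑ (allFin n) col                             ∎
       where
       lem1 : ∀ a b c → a * (b * c) ≡ b * (a * c)
       lem1 = solve-∀
     g-size : n ≤ D * # g
     g-size = *-cancelˡ-≤ n (+-cancelʳ-≤ (n * n) (n * n) _ (begin
       n * n + n * n                                        ≡⟨ cong (n * n +_) (sym (+-identityʳ (n * n))) ⟩
       2 * (n * n)                                          ≤⟨ *-monoʳ-≤ 2 total ⟩
       2 * (d * e * ∑ (allFin n) col)                       ≡⟨ sym (*-assoc 2 (d * e) _) ⟩
       D * ∑ (allFin n) col                                 ≡⟨ sym (∑-*ˡ (allFin n) D col) ⟩
       ∑ (allFin n) (λ y → D * col y)                       ≤⟨ ∑-mono (allFin n) pt ⟩
       ∑ (allFin n) (λ y → n * (D * χ (g y)) + n)           ≡⟨ ∑-+ (allFin n) _ _ ⟩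
       ∑ (allFin n) (λ y → n * (D * χ (g y))) + ∑ (allFin n) (λ _ → n)
         ≡⟨ cong₂ _+_ (≡trans (∑-*ˡ (allFin n) n _) (cong (n *_) (∑-*ˡ (allFin n) D (χ ∘ g)))) (≡trans (∑-const (allFin n) n) (cong (_* n) (length-allFin n))) ⟩
       n * (D * # g) + n * n                                ∎))

  -- Blocks of density quantifiers over tuples.

  NM′ : ℕ → (m : ℕ) → (Vec (Fin n) m → Set) → Set

  -- The record makes the recursively computed `NM′` injective, so that `d`, `m` and `R` can be
  -- inferred from a type.
  record NM {n : ℕ} (d m : ℕ) (R : Vec (Fin n) m → Set) : Set where
    inductive; pattern
    constructor nm
    field un : NM′ d m R
  open NM public

  NM′ d zero    R = R []
  NM′ d (suc m) R = Many d (λ x → NM d m (λ xs → R (x ∷ xs)))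

  NM-map : {R Q : Vec (Fin n) m → Set} → (∀ xs → R xs → Q xs) → NM d m R → NM d m Q
  NM-map {m = zero}  h (nm r) = nm (h [] r)
  NM-map {m = suc m} h (nm r) = nm (Many-map (λ x → NM-map (λ xs → h (x ∷ xs))) r)

  NM-weaken : {R : Vec (Fin n) m → Set} → d ≤ e → NM d m R → NM e m R
  NM-weaken {m = zero}  le (nm r) = nm r
  NM-weaken {m = suc m} le (nm r) = nm (Many-weaken le (Many-map (λ x → NM-weaken le) r))

  NM-all : {R : Vec (Fin n) m → Set} → (∀ xs → R xs) → NM 1 m R
  NM-all {m = zero}  h = nm (h [])
  NM-all {m = suc m} h = nm (Many-all (λ x → NM-all (λ xs → h (x ∷ xs))))

  NM-exists : {R : Vec (Fin n) m → Set} → 1 ≤ n → NM d m R → ∃ R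
  NM-exists {m = zero}  1≤n (nm r) = [] , r
  NM-exists {m = suc m} 1≤n (nm r) =
    let x , rx   = Many-exists 1≤n r
        xs , rxs = NM-exists 1≤n rx
    in x ∷ xs , rxs

  NM-++ : ∀ a {b} {R : Vec (Fin n) (a + b) → Set} → NM d a (λ xs → NM d b (λ ys → R (xs Vec.++ ys))) → NM d (a + b) R
  NM-++ zero    (nm r) = r
  NM-++ (suc a) (nm r) = nm (Many-map (λ x → NM-++ a) r)

  NM-split : {P Q : Vec (Fin n) m → Set} → NM d m (λ xs → P xs ⊎ Q xs) → NM (2 * d) m P ⊎ NM (2 * d) m Q
  NM-split {m = zero}  (nm (inj₁ p)) = inj₁ (nm p)
  NM-split {m = zero}  (nm (inj₂ q)) = inj₂ (nm q)
  NM-split {m = suc m} (nm r) with Many-split (Many-map (λ x → NM-split) r)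
  ... | inj₁ p = inj₁ (nm p)
  ... | inj₂ q = inj₂ (nm q)

  Fresh : List (Fin n) → Vec (Fin n) m → Set
  Fresh B []       = ⊤
  Fresh B (x ∷ xs) = x ∉ B × Fresh (x ∷ B) xs

  -- Each coordinate avoids B and the coordinates before it, at most `length B + m` values in all,
  -- so `Many-avoid` applies at every level with the same bound.
  NM-fresh : {R : Vec (Fin n) m → Set} (B : List (Fin n)) → 2 * d * (length B + m) ≤ n →
             NM d m R → NM (2 * d) m (λ xs → R xs × Fresh B xs)
  NM-fresh {m = zero}  B h (nm r) = nm (r , tt)
  NM-fresh {n} {suc m} {d} B h (nm r) = nm
    (Many-map (λ x → λ { (rx , x∉) → NM-map (λ xs (p , q) → p , x∉ , q) (NM-fresh (x ∷ B) (subst (λ z → 2 * d * z ≤ n) (+-suc (length B) m) h) rx) })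
              (Many-avoid B (≤-trans (*-monoʳ-≤ (2 * d) (m≤m+n (length B) (suc m))) h) r))

  NMC′ : ℕ → (t m : ℕ) → (Vec (Vec (Fin n) t) m → Set) → Set

  record NMC {n : ℕ} (d t m : ℕ) (R : Vec (Vec (Fin n) t) m → Set) : Set where
    inductive; pattern
    constructor nmc
    field unc : NMC′ d t m R
  open NMC public

  NMC′ d t zero    Q = Q []
  NMC′ d t (suc m) Q = NM d t (λ C → NMC d t m (λ Cs → Q (C ∷ Cs)))

  NMC-map : {R Q : Vec (Vec (Fin n) t) m → Set} → (∀ xs → R xs → Q xs) → NMC d t m R → NMC d t m Q
  NMC-map {m = zero}  h (nmc r) = nmc (h [] r)
  NMC-map {m = suc m} h (nmc r) = nmc (NM-map (λ C → NMC-map (λ Cs → h (C ∷ Cs))) r)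

  NMC-flat : ∀ m {Q : Vec (Vec (Fin n) t) m → Set} → NMC d t m Q →
             NM d (m * t) (λ zs → Σ _ λ Cs → zs ≡ Vec.concat Cs × Q Cs)
  NMC-flat zero    (nmc r) = nm ([] , ≡refl , r)
  NMC-flat {t = t} (suc m) (nmc r) =
    NM-++ t (NM-map (λ C r′ → NM-map (λ zs (Cs , eq , q) → C ∷ Cs , cong (C Vec.++_) eq , q) (NMC-flat m r′)) r)

  Selection : List (Fin n) → List (Vec (Fin n) t) → Set
  Selection = Pointwise (λ x C → x ∈ toList C)

  -- Exchanging density quantifiers

  abstract
    pullC : ℕ → ℕ → ℕ
    pullC zero    d = d
    pullC (suc m) d = pullC m (2 * (d * d))

    d≤2dd : ∀ d → d ≤ 2 * (d * d)
    d≤2dd zero    = z≤n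
    d≤2dd (suc d) = ≤-trans (m≤m*n (suc d) (suc d)) (m≤m+n _ _)

    d≤pullC : ∀ m d → d ≤ pullC m d
    d≤pullC zero    d = ≤-refl
    d≤pullC (suc m) d = ≤-trans (d≤2dd d) (d≤pullC m _)

    NM-pull : ∀ m {R : Fin n → Vec (Fin n) m → Set} → Many d (λ x → NM d m (R x)) →
              NM (pullC m d) m (λ ys → Many (pullC m d) (λ x → R x ys))
    NM-pull zero    r = nm (Many-map (λ x → un) r)
    NM-pull {d = d} (suc m) r = nm
      (Many-weaken (d≤pullC m _)
        (Many-map (λ y r′ → NM-pull m (Many-map (λ x → NM-weaken (d≤2dd d)) r′)) (Many-swap (Many-map (λ x → un) r))))

    pushC : ℕ → ℕ → ℕ
    pushC zero    d = d
    pushC (suc m) d = 2 * (pushC m d * pushC m d)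

    d≤pushC : ∀ m d → d ≤ pushC m d
    d≤pushC zero    d = ≤-refl
    d≤pushC (suc m) d = ≤-trans (d≤pushC m d) (d≤2dd _)

    NM-push : ∀ m {R : Fin n → Vec (Fin n) m → Set} → NM d m (λ ys → Many d (λ x → R x ys)) →
              Many (pushC m d) (λ x → NM (pushC m d) m (R x))
    NM-push zero    (nm r) = Many-map (λ x → nm) r
    NM-push {d = d} (suc m) (nm r) =
      Many-map (λ x r′ → nm (Many-map (λ y → NM-weaken (d≤2dd _)) r′))
        (Many-swap (Many-weaken (d≤pushC m d) (Many-map (λ y → NM-push m) r)))

    NM-dup : ∀ t {P : Fin n → Set} → Many d P → NM d t (λ xs → All P (toList xs))
    NM-dup zero    r = nm []
    NM-dup (suc t) r = nm (Many-map (λ x px → NM-map (λ xs pxs → px ∷ pxs) (NM-dup t r)) r)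

    pushVC : ℕ → ℕ → ℕ → ℕ
    pushVC m zero    d = d
    pushVC m (suc t) d = pushVC m t (pushC m d)

    d≤pushVC : ∀ m t d → d ≤ pushVC m t d
    d≤pushVC m zero    d = ≤-refl
    d≤pushVC m (suc t) d = ≤-trans (d≤pushC m d) (d≤pushVC m t _)

    NM-pushV : ∀ m t {R : Vec (Fin n) t → Vec (Fin n) m → Set} → NM d m (λ ys → NM d t (λ xs → R xs ys)) →
               NM (pushVC m t d) t (λ xs → NM (pushVC m t d) m (R xs))
    NM-pushV m zero    r = nm (NM-map (λ ys → un) r)
    NM-pushV {d = d} m (suc t) r = nm
      (Many-weaken (d≤pushVC m t _)
        (Many-map (λ x r′ → NM-pushV m t (NM-map (λ ys → NM-weaken (d≤pushC m d)) r′)) (NM-push m (NM-map (λ ys → un) r))))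

    blowC : ℕ → ℕ → ℕ → ℕ
    blowC t zero    d = d
    blowC t (suc m) d = blowC t m (pushVC m t (pullC m d))

    d≤blowC : ∀ t m d → d ≤ blowC t m d
    d≤blowC t zero    d = ≤-refl
    d≤blowC t (suc m) d = ≤-trans (d≤pullC m d) (≤-trans (d≤pushVC m t _) (d≤blowC t m _))

    -- One coordinate at a time: its quantifier is pulled innermost, where t copies can be chosen
    -- independently for the same remaining coordinates, and the copies are pushed back to the
    -- front. The rest is then blown up for all t copies simultaneously.
    NM-blowup : ∀ t m {R : Vec (Fin n) m → Set} → NM d m R →
                NMC (blowC t m d) t m (λ Cs → ∀ xs → Selection (toList xs) (toList Cs) → R xs)
    NM-blowup t zero    (nm r) = nmc (λ { [] [] → r })
    NM-blowup {d = d} t (suc m) {R} (nm r) = nmc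
      (NM-weaken (d≤blowC t m _)
        (NM-map (λ C r′ → NMC-map (λ { Cs h (x ∷ xs) (x∈ ∷ sel) → All.lookup (h xs sel) x∈ }) (NM-blowup t m r′))
          (NM-pushV m t (NM-map (λ ys → NM-dup t) (NM-pull m r)))))

  -- A derandomised choice: coordinates are fixed one by one, each by averaging, so that the
  -- requests with a dense set of continuations keep at least 1/d of their weight.
  NM-average : ∀ {Q : Set} m {d} (qs : List Q) (w : Q → ℕ) {R : Q → Vec (Fin n) m → Set} → 1 ≤ n →
               (act : Q → Bool) → (∀ q → act q ≡ true → NM d m (R q)) →
               Σ (Vec (Fin n) m) λ τ → Σ (Q → Bool) λ hit → (∀ q → hit q ≡ true → R q τ) ×
                 (∑ qs (λ q → χ (act q) * w q) ≤ d ^ m * ∑ qs (λ q → χ (hit q) * w q))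
  NM-average zero    qs w 1≤n act h = [] , act , (λ q p → un (h q p)) , ≤-reflexive (sym (+-identityʳ _))
  NM-average {n} {Q} (suc m) {d} qs w {R} 1≤n act h = x ∷ τ , hit , sat , (begin
      ∑ qs (λ q → χ (act q) * w q)           ≤⟨ avg ⟩
      d * ∑ qs (λ q → χ (act′ q) * w q)      ≤⟨ *-monoʳ-≤ d le ⟩
      d * (d ^ m * ∑ qs (λ q → χ (hit q) * w q)) ≡⟨ sym (*-assoc d _ _) ⟩
      d * d ^ m * ∑ qs (λ q → χ (hit q) * w q)   ∎)
    where
    open ≤-Reasoning
    G : ∀ q → Σ (Fin n → Bool) λ h → (∀ x → h x ≡ true → NM d m (λ xs → R q (x ∷ xs))) × (n * χ (act q) ≤ d * # h)
    G q = gate (act q) (λ p → un (h q p))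
    ex : ∃ λ x → ∑ qs (λ q → χ (act q) * w q) ≤ d * ∑ qs (λ q → χ (proj₁ (G q) x) * w q)
    ex = ∑-average (allFin n) (begin
      length (allFin n) * ∑ qs (λ q → χ (act q) * w q)                 ≡⟨ cong (_* ∑ qs _) (length-allFin n) ⟩
      n * ∑ qs (λ q → χ (act q) * w q)                                 ≡⟨ sym (∑-*ˡ qs n _) ⟩
      ∑ qs (λ q → n * (χ (act q) * w q))                               ≤⟨ ∑-mono qs row ⟩
      ∑ qs (λ q → ∑ (allFin n) (λ x → d * (χ (proj₁ (G q) x) * w q)))  ≡⟨ ∑-swap qs (allFin n) _ ⟩
      ∑ (allFin n) (λ x → ∑ qs (λ q → d * (χ (proj₁ (G q) x) * w q)))  ≡⟨ ∑-cong (allFin n) (λ x → ∑-*ˡ qs d _) ⟩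
      ∑ (allFin n) (λ x → d * ∑ qs (λ q → χ (proj₁ (G q) x) * w q))    ∎)
      (≤-trans 1≤n (≤-reflexive (sym (length-allFin n))))
      where
      comm : ∀ a b c → a * (b * c) ≡ c * (a * b)
      comm = solve-∀
      row : ∀ q → n * (χ (act q) * w q) ≤ ∑ (allFin n) (λ x → d * (χ (proj₁ (G q) x) * w q))
      row q = begin
        n * (χ (act q) * w q)                                 ≡⟨ sym (*-assoc n _ _) ⟩
        n * χ (act q) * w q                                   ≤⟨ *-monoˡ-≤ (w q) (proj₂ (proj₂ (G q))) ⟩
        d * # (proj₁ (G q)) * w q                             ≡⟨ *-comm _ (w q) ⟩
        w q * (d * # (proj₁ (G q)))                           ≡⟨ sym (*-assoc (w q) d _) ⟩
        w q * d * # (proj₁ (G q))                             ≡⟨ sym (∑-*ˡ (allFin n) (w q * d) _) ⟩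
        ∑ (allFin n) (λ x → w q * d * χ (proj₁ (G q) x))      ≡⟨ ∑-cong (allFin n) (λ x → ≡trans (*-assoc (w q) d _) (sym (comm d _ (w q)))) ⟩
        ∑ (allFin n) (λ x → d * (χ (proj₁ (G q) x) * w q))    ∎
    x = proj₁ ex
    avg = proj₂ ex
    act′ : Q → Bool
    act′ q = proj₁ (G q) x
    rec = NM-average m {d} qs w {λ q xs → R q (x ∷ xs)} 1≤n act′ (λ q p → proj₁ (proj₂ (G q)) x p)
    τ = proj₁ rec
    hit = proj₁ (proj₂ rec)
    sat = proj₁ (proj₂ (proj₂ rec))
    le = proj₂ (proj₂ (proj₂ rec))

  -- Disjoint families of tuples serving all requests many times

  data AtLeast {A : Set} (P : A → Set) : ℕ → List A → Set where
    done : ∀ {xs} → AtLeast P 0 xs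
    hit  : ∀ {m x xs} → P x → AtLeast P m xs → AtLeast P (suc m) (x ∷ xs)
    skip : ∀ {m x xs} → AtLeast P m xs → AtLeast P m (x ∷ xs)

  AtLeast-≤ : ∀ {P : A → Set} {xs : List A} {i j} → i ≤ j → AtLeast P j xs → AtLeast P i xs
  AtLeast-≤ z≤n      a         = done
  AtLeast-≤ (s≤s le) (hit p a) = hit p (AtLeast-≤ le a)
  AtLeast-≤ (s≤s le) (skip a)  = skip (AtLeast-≤ (s≤s le) a)

  -- Polymorphic in `P′` because removing x affects all requests at once: each of them loses at most
  -- one server.
  AtLeast-extract : {P : A → Set} {xs : List A} → AtLeast P (suc m) xs →
    Σ A λ x → Σ (List A) λ ys → P x × xs ↭ x ∷ ys ×
      (∀ {P′ : A → Set} {j} → AtLeast P′ (suc j) xs → AtLeast P′ j ys)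
  AtLeast-extract {A = A} (hit {x = x} {xs} p _) = x , xs , p , ↭-refl , tl
    where
    tl : ∀ {P′ : A → Set} {j} → AtLeast P′ (suc j) (x ∷ xs) → AtLeast P′ j xs
    tl (hit _ r) = r
    tl (skip r)  = AtLeast-≤ (n≤1+n _) r
  AtLeast-extract {A = A} (skip {x = y} {xs} r) =
    let x , ys , p , perm , f = AtLeast-extract r in
    x , y ∷ ys , p , trans (prep y perm) (swap y x refl) , tl ys f
    where
    tl : ∀ ys → (∀ {P′ : A → Set} {j} → AtLeast P′ (suc j) xs → AtLeast P′ j ys) →
         ∀ {P′ : A → Set} {j} → AtLeast P′ (suc j) (y ∷ xs) → AtLeast P′ j (y ∷ ys)
    tl ys f {j = zero}  _         = done
    tl ys f {j = suc j} (hit p r) = hit p (f r)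
    tl ys f {j = suc j} (skip r)  = skip (f r)

  Serves : (Q → A → Set) → A → Maybe Q → Set
  Serves P x nothing  = ⊤
  Serves P x (just q) = P q x

  -- At least m elements can serve q and fewer than m are taken, so the scan meets a free one.
  assign-one : {P : Q → A → Set} (q : Q) {xs : List A} {asg : List (Maybe Q)} →
    AtLeast (P q) m xs → Pointwise (Serves P) xs asg → length (List.catMaybes asg) < m →
    Σ (List (Maybe Q)) λ asg′ → Pointwise (Serves P) xs asg′ × List.catMaybes asg′ ↭ q ∷ List.catMaybes asg
  assign-one q {asg = nothing ∷ asg} (hit p r) (s ∷ ss) lt       = just q ∷ asg , p ∷ ss , refl
  assign-one q {asg = just q′ ∷ asg} (hit p r) (s ∷ ss) (s≤s lt) =
    let asg′ , ss′ , perm = assign-one q r ss lt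
    in just q′ ∷ asg′ , s ∷ ss′ , trans (prep q′ perm) (swap q′ q refl)
  assign-one q {asg = nothing ∷ asg} (skip r) (s ∷ ss) lt =
    let asg′ , ss′ , perm = assign-one q r ss lt
    in nothing ∷ asg′ , s ∷ ss′ , perm
  assign-one q {asg = just q′ ∷ asg} (skip r) (s ∷ ss) lt =
    let asg′ , ss′ , perm = assign-one q r ss (<-trans (n<1+n _) lt)
    in just q′ ∷ asg′ , s ∷ ss′ , trans (prep q′ perm) (swap q′ q refl)

  assign : {P : Q → A → Set} {xs : List A} (qs : List Q) → length qs ≤ m →
    (∀ {q} → q ∈ qs → AtLeast (P q) m xs) →
    Σ (List (Maybe Q)) λ asg → Pointwise (Serves P) xs asg × List.catMaybes asg ↭ qs
  assign {xs = xs} [] le h = map (λ _ → nothing) xs , none xs , ↭-reflexive (none′ xs)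
    where
    none : ∀ {P} xs → Pointwise (Serves P) xs (map (λ _ → nothing) xs)
    none []       = []
    none (x ∷ xs) = tt ∷ none xs
    none′ : ∀ {Q : Set} (xs : List _) → List.catMaybes {A = Q} (map (λ _ → nothing) xs) ≡ []
    none′ []       = ≡refl
    none′ (x ∷ xs) = none′ xs
  assign (q ∷ qs) le h =
    let asg , ss , perm    = assign qs (<⇒≤ le) (h ∘ there)
        asg′ , ss′ , perm′ = assign-one q (h (here ≡refl)) ss (≤-trans (s≤s (≤-reflexive (↭-length perm))) le)
    in asg′ , ss′ , trans perm′ (prep q perm)

  length-toList : ∀ {m} (v : Vec A m) → length (toList v) ≡ m
  length-toList []      = ≡refl
  length-toList (x ∷ v) = cong suc (length-toList v)

  FreshFam : List (Fin n) → List (Vec (Fin n) m) → Set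
  FreshFam B []      = ⊤
  FreshFam B (τ ∷ F) = Fresh B τ × FreshFam (toList τ ++ B) F

  -- Every service at least halves the weight, and the last one removes it; a total weight below one
  -- thus means that nothing is left to serve.
  weight : ℕ → ℕ
  weight zero    = 0
  weight (suc a) = 2 ^ a

  weight≤ : ∀ a → weight a ≤ 2 ^ a
  weight≤ zero    = z≤n
  weight≤ (suc a) = m≤m+n (2 ^ a) _

  weight-pred : ∀ a → 2 * weight (ℕ.pred a) + weight a ≤ 2 * weight a
  weight-pred zero          = z≤n
  weight-pred (suc zero)    = s≤s z≤n
  weight-pred (suc (suc a)) = ≤-reflexive (dbl (2 ^ a))
    where
    dbl : ∀ x → 2 * x + 2 * x ≡ 2 * (2 * x)
    dbl = solve-∀

  ∑-zero : ∀ (xs : List A) {f : A → ℕ} {x} → ∑ xs f ≡ 0 → x ∈ xs → f x ≡ 0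
  ∑-zero (x ∷ xs) {f} eq (here ≡refl) = m+n≡0⇒m≡0 (f x) eq
  ∑-zero (x ∷ xs) {f} eq (there x∈)   = ∑-zero xs (m+n≡0⇒n≡0 (f x) eq) x∈

  ∑-positive : ∀ (xs : List A) (f : A → ℕ) → 1 ≤ ∑ xs f → ∃ λ x → 1 ≤ f x
  ∑-positive (x ∷ xs) f h with f x in eq
  ... | zero  = ∑-positive xs f h
  ... | suc _ = x , ≤-trans (s≤s z≤n) (≤-reflexive (sym eq))

  -- The potential is the total weight of the requests, where a request still to be
  -- served a times has weight about 2 ^ a; a well chosen tuple multiplies it by at
  -- most 1 - 1/2D.
  module _ {n N d : ℕ} {Q : Set} (qs : List Q) {R : Q → Vec (Fin n) N → Set}
           (1≤n : 1 ≤ n) (dense : ∀ q → NM d N (R q)) (D′ : ℕ) (D′-eq : 2 * (2 * d) ^ N ≡ suc D′) where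

    private
      D : ℕ
      D = (2 * d) ^ N

    family-step : ∀ T (need : Q → ℕ) (B : List (Fin n)) → 2 * d * (length B + T * N) ≤ n →
      ∑ qs (weight ∘ need) * D′ ^ T < suc D′ ^ T →
      Σ (List (Vec (Fin n) N)) λ F → length F ≤ T × FreshFam B F × All (λ τ → ∃ λ q → R q τ) F ×
        (∀ {q} → q ∈ qs → AtLeast (R q) (need q) F)
    family-step zero need B hB pot = [] , z≤n , tt , [] , λ q∈ → subst (λ a → AtLeast _ a []) (sym (zeroes q∈)) done
      where
      w0 : ∀ a → weight a ≡ 0 → a ≡ 0
      w0 zero    _  = ≡refl
      w0 (suc a) eq = contradiction (m^n>0 2 a) (λ lt → <-irrefl (sym eq) lt)
      zeroes : ∀ {q} → q ∈ qs → need q ≡ 0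
      zeroes {q} q∈ = w0 (need q) (∑-zero qs (n<1⇒n≡0 (≤-trans (s≤s (≤-reflexive (sym (*-identityʳ _)))) pot)) q∈)
    family-step (suc T) need B hB pot with ∑ qs (weight ∘ need) ℕ.≟ 0
    ... | yes eq = let F , l , r = family-step 0 need B (≤-trans (*-monoʳ-≤ (2 * d) (+-monoʳ-≤ (length B) z≤n)) hB) (s≤s (≤-reflexive (≡trans (*-identityʳ _) eq)))
                   in F , ≤-trans l z≤n , r
    ... | no ≢0 = τ ∷ F , s≤s lenF , (freshτ , freshF) , (((proj₁ someHit) , proj₁ (sat _ (proj₂ someHit))) ∷ servF) , served
      where
      open ≤-Reasoning
      Ψ = ∑ qs (weight ∘ need)
      hB′ : 2 * d * (length B + N) ≤ n
      hB′ = ≤-trans (*-monoʳ-≤ (2 * d) (+-monoʳ-≤ (length B) (m≤m+n N _))) hB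
      res = NM-average N qs (weight ∘ need) 1≤n (λ _ → true) (λ q _ → NM-fresh B hB′ (dense q))
      τ = proj₁ res
      hits : Q → Bool
      hits = proj₁ (proj₂ res)
      sat = proj₁ (proj₂ (proj₂ res))
      h = ∑ qs (λ q → χ (hits q) * weight (need q))
      Ψ≤ : Ψ ≤ D * h
      Ψ≤ = ≤-trans (≤-reflexive (∑-cong qs (λ q → sym (+-identityʳ _)))) (proj₂ (proj₂ (proj₂ res)))
      someHit : ∃ λ q → hits q ≡ true
      someHit with ∑-positive qs _ (n≢0⇒n>0 h≢0)
        where
        h≢0 : h ≢ 0
        h≢0 eq = ≢0 (n≤0⇒n≡0 (≤-trans Ψ≤ (≤-reflexive (≡trans (cong (D *_) eq) (*-zeroʳ D)))))
      ... | q , p = q , pos (hits q) p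
        where
        pos : ∀ b {a} → 1 ≤ χ b * a → b ≡ true
        pos true _ = ≡refl
      freshτ : Fresh B τ
      freshτ = proj₂ (sat _ (proj₂ someHit))
      next : Bool → ℕ → ℕ
      next true  a = ℕ.pred a
      next false a = a
      need′ : Q → ℕ
      need′ q = next (hits q) (need q)
      Ψ′ = ∑ qs (weight ∘ need′)
      drop1 : 2 * Ψ′ + h ≤ 2 * Ψ
      drop1 = begin
        2 * Ψ′ + h                                                          ≡⟨ cong (_+ h) (sym (∑-*ˡ qs 2 _)) ⟩
        ∑ qs (λ q → 2 * weight (need′ q)) + h                               ≡⟨ sym (∑-+ qs _ _) ⟩
        ∑ qs (λ q → 2 * weight (need′ q) + χ (hits q) * weight (need q))     ≤⟨ ∑-mono qs (λ q → pt (hits q) (need q)) ⟩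
        ∑ qs (λ q → 2 * weight (need q))                                    ≡⟨ ∑-*ˡ qs 2 _ ⟩
        2 * Ψ                                                               ∎
        where
        pt : ∀ b a → 2 * weight (next b a) + χ b * weight a ≤ 2 * weight a
        pt true  a = ≤-trans (≤-reflexive (cong (2 * weight (ℕ.pred a) +_) (+-identityʳ _))) (weight-pred a)
        pt false a = ≤-reflexive (+-identityʳ _)
      -- At least 1/D of the weight is hit, and at least half of what is hit disappears.
      drop2 : suc D′ * Ψ′ ≤ D′ * Ψ
      drop2 = +-cancelʳ-≤ Ψ _ _ (begin
        suc D′ * Ψ′ + Ψ            ≤⟨ +-monoʳ-≤ (suc D′ * Ψ′) Ψ≤ ⟩
        suc D′ * Ψ′ + D * h        ≡⟨ cong (λ z → z * Ψ′ + D * h) (sym D′-eq) ⟩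
        2 * D * Ψ′ + D * h         ≡⟨ fac D Ψ′ h ⟩
        D * (2 * Ψ′ + h)           ≤⟨ *-monoʳ-≤ D drop1 ⟩
        D * (2 * Ψ)                ≡⟨ fac2 D Ψ ⟩
        2 * D * Ψ                  ≡⟨ cong (_* Ψ) D′-eq ⟩
        suc D′ * Ψ                 ≡⟨ +-comm Ψ _ ⟩
        D′ * Ψ + Ψ                 ∎)
        where
        fac : ∀ a b c → 2 * a * b + a * c ≡ a * (2 * b + c)
        fac = solve-∀
        fac2 : ∀ a b → a * (2 * b) ≡ 2 * a * b
        fac2 = solve-∀
      pot′ : Ψ′ * D′ ^ T < suc D′ ^ T
      pot′ = *-cancelˡ-< (suc D′) _ _ (begin-strict
        suc D′ * (Ψ′ * D′ ^ T)     ≡⟨ sym (*-assoc (suc D′) Ψ′ _) ⟩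
        suc D′ * Ψ′ * D′ ^ T       ≤⟨ *-monoˡ-≤ (D′ ^ T) drop2 ⟩
        D′ * Ψ * D′ ^ T            ≡⟨ fac3 D′ Ψ (D′ ^ T) ⟩
        Ψ * (D′ * D′ ^ T)          <⟨ pot ⟩
        suc D′ * suc D′ ^ T        ∎)
        where
        fac3 : ∀ a b c → a * b * c ≡ b * (a * c)
        fac3 = solve-∀
      len≡ : length (toList τ ++ B) + T * N ≡ length B + (N + T * N)
      len≡ = ≡trans (cong (_+ T * N) (≡trans (length-++ (toList τ)) (cong (_+ length B) (length-toList τ)))) (shuffle N (length B) (T * N))
        where
        shuffle : ∀ a b c → a + b + c ≡ b + (a + c)
        shuffle = solve-∀
      rec = family-step T need′ (toList τ ++ B) (≤-trans (≤-reflexive (cong (2 * d *_) len≡)) hB) pot′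
      F = proj₁ rec
      lenF = proj₁ (proj₂ rec)
      freshF = proj₁ (proj₂ (proj₂ rec))
      servF = proj₁ (proj₂ (proj₂ (proj₂ rec)))
      served : ∀ {q} → q ∈ qs → AtLeast (R q) (need q) (τ ∷ F)
      served {q} q∈ = go (hits q) (need q) (λ p → proj₁ (sat q p)) (proj₂ (proj₂ (proj₂ (proj₂ rec))) q∈)
        where
        go : ∀ b a → (b ≡ true → R q τ) → AtLeast (R q) (next b a) F → AtLeast (R q) a (τ ∷ F)
        go true  zero    s r = done
        go true  (suc a) s r = hit (s ≡refl) r
        go false a       s r = skip r

  bernoulli : ∀ x j → x ^ j + j * x ^ ℕ.pred j ≤ suc x ^ j
  bernoulli x zero          = ≤-refl
  bernoulli x (suc zero)    = ≤-reflexive (b1 x)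
    where
    b1 : ∀ x → x * 1 + (1 + 0) ≡ suc x * 1
    b1 = solve-∀
  bernoulli x (suc (suc j)) = begin
    x * (x * y) + (2 + j) * (x * y)                    ≤⟨ m≤m+n _ _ ⟩
    x * (x * y) + (2 + j) * (x * y) + (1 + j) * y      ≡⟨ b2 x y j ⟩
    suc x * (x * y + (1 + j) * y)                      ≤⟨ *-monoʳ-≤ (suc x) (bernoulli x (suc j)) ⟩
    suc x * suc x ^ suc j                              ∎
    where
    open ≤-Reasoning
    y = x ^ j
    b2 : ∀ x y j → x * (x * y) + (2 + j) * (x * y) + (1 + j) * y ≡ suc x * (x * y + (1 + j) * y)
    b2 = solve-∀

  -- The first two binomial terms of (x+1)^(x+1) are x^(x+1) and (x+1) x^x, each at least x^(x+1).
  -- With x + 1 = 2D this says that 2D rounds halve the potential.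
  double : ∀ x → 2 * x ^ suc x ≤ suc x ^ suc x
  double x = ≤-trans (≤-reflexive (b x (x ^ x))) (≤-trans (+-monoʳ-≤ (x * x ^ x) (*-monoˡ-≤ (x ^ x) (n≤1+n x))) (bernoulli x (suc x)))
    where
    b : ∀ x y → 2 * (x * y) ≡ x * y + x * y
    b = solve-∀

  ^-distribʳ-* : ∀ s x y → (x * y) ^ s ≡ x ^ s * y ^ s
  ^-distribʳ-* zero    x y = ≡refl
  ^-distribʳ-* (suc s) x y = ≡trans (cong (x * y *_) (^-distribʳ-* s x y)) (interchange x y (x ^ s) (y ^ s))
    where
    interchange : ∀ a b c d → a * b * (c * d) ≡ a * c * (b * d)
    interchange = solve-∀

  double-^ : ∀ x s → 2 ^ s * x ^ (suc x * s) ≤ suc x ^ (suc x * s)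
  double-^ x s = begin
    2 ^ s * x ^ (suc x * s)     ≡⟨ cong (2 ^ s *_) (sym (^-*-assoc x (suc x) s)) ⟩
    2 ^ s * (x ^ suc x) ^ s     ≡⟨ sym (^-distribʳ-* s 2 (x ^ suc x)) ⟩
    (2 * x ^ suc x) ^ s         ≤⟨ ^-monoˡ-≤ s (double x) ⟩
    (suc x ^ suc x) ^ s         ≡⟨ ^-*-assoc (suc x) (suc x) s ⟩
    suc x ^ (suc x * s)         ∎
    where open ≤-Reasoning

  ServingFamily : ∀ {N} {Q : Set} → List Q → (Q → Vec (Fin n) N → Set) → ℕ → ℕ → List (Fin n) → Set
  ServingFamily {n} {N} qs R m T B =
    Σ (List (Vec (Fin n) N)) λ F → length F ≤ T × FreshFam B F × All (λ τ → ∃ λ q → R q τ) F ×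
      (∀ {q} → q ∈ qs → AtLeast (R q) m F)

  abstract
    -- The first factor is 2D, the number of rounds per halving. The initial potential is less than
    -- 2^(2m+1), so 2m + 1 halvings bring it below one.
    famT : ℕ → ℕ → ℕ → ℕ
    famT d N m = 2 * (2 * d) ^ N * (2 * m + 1)

    famK : ℕ → ℕ → ℕ
    famK d N = 2 * (2 * d) ^ N * 3

    famT≤ : ∀ d N m → 1 ≤ m → famT d N m ≤ famK d N * m
    famT≤ d N m 1≤m = ≤-trans (*-monoʳ-≤ (2 * (2 * d) ^ N) (≤-trans (+-monoʳ-≤ (2 * m) 1≤m) (≤-reflexive (eq m)))) (≤-reflexive (sym (*-assoc (2 * (2 * d) ^ N) 3 m)))
      where
      eq : ∀ m → 2 * m + m ≡ 3 * m
      eq = solve-∀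

    family : ∀ {N d : ℕ} {Q : Set} (qs : List Q) {R : Q → Vec (Fin n) N → Set} m →
      1 ≤ n → 1 ≤ d → (∀ q → NM d N (R q)) → length qs ≤ 2 ^ m →
      ∀ (B : List (Fin n)) → 2 * d * (length B + famT d N m * N) ≤ n →
      ServingFamily qs R m (famT d N m) B
    family {n} {N} {d@(suc _)} qs {R} m 1≤n (s≤s _) dense few B hB = go (2 * (2 * d) ^ N) ≡refl
      where
      open ≤-Reasoning
      go : ∀ z → 2 * (2 * d) ^ N ≡ z → ServingFamily qs R m (famT d N m) B
      -- 2D is positive and even, hence at least 2. So `D′` is positive, and multiplying by a power
      -- of it preserves strict inequality.
      go zero eq = contradiction (m+n≡0⇒m≡0 _ eq) (λ e → <-irrefl (sym e) (m^n>0 (2 * d) N))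
      go (suc zero) eq = contradiction eq (odd ((2 * d) ^ N))
        where
        odd : ∀ z → 2 * z ≢ 1
        odd (suc z) p = contradiction (suc-injective p) (λ q → contradiction (≡trans (sym (+-suc z (z + 0))) q) λ ())
      go (suc D′@(suc _)) eq = family-step qs 1≤n dense D′ eq (famT d N m) (λ _ → m) B hB (begin-strict
        ∑ qs (λ _ → weight m) * D′ ^ famT d N m            ≡⟨ cong (_* D′ ^ famT d N m) (∑-const qs _) ⟩
        length qs * weight m * D′ ^ famT d N m             ≤⟨ *-monoˡ-≤ (D′ ^ famT d N m) (*-mono-≤ few (weight≤ m)) ⟩
        2 ^ m * 2 ^ m * D′ ^ famT d N m                    <⟨ *-monoˡ-< (D′ ^ famT d N m) {{m^n≢0 D′ (famT d N m)}} lt ⟩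
        2 ^ (2 * m + 1) * D′ ^ famT d N m                  ≡⟨ cong (λ z → 2 ^ (2 * m + 1) * D′ ^ (z * (2 * m + 1))) eq ⟩
        2 ^ (2 * m + 1) * D′ ^ (suc D′ * (2 * m + 1))      ≤⟨ double-^ D′ (2 * m + 1) ⟩
        suc D′ ^ (suc D′ * (2 * m + 1))                    ≡⟨ cong (λ z → suc D′ ^ (z * (2 * m + 1))) (sym eq) ⟩
        suc D′ ^ famT d N m                                ∎)
        where
        lt : 2 ^ m * 2 ^ m < 2 ^ (2 * m + 1)
        lt = ≤-trans (s≤s (≤-reflexive (sym (^-distribˡ-+-* 2 m m)))) (^-monoʳ-< 2 (s≤s (s≤s z≤n)) (≤-reflexive (b m)))
          where
          b : ∀ m → 1 + (m + m) ≡ 2 * m + 1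
          b = solve-∀

  -- Pieces of lists and lists without repetition.

  take-length-+ : ∀ (xs {ys} : List A) j → take (length xs + j) (xs ++ ys) ≡ xs ++ take j ys
  take-length-+ []       j = ≡refl
  take-length-+ (x ∷ xs) j = cong (x ∷_) (take-length-+ xs j)

  take-++-≤ : ∀ j (xs {ys} : List A) → j ≤ length xs → take j (xs ++ ys) ≡ take j xs
  take-++-≤ zero    xs       le       = ≡refl
  take-++-≤ (suc j) (x ∷ xs) (s≤s le) = cong (x ∷_) (take-++-≤ j xs le)

  take-≥ : ∀ j (xs : List A) → length xs ≤ j → take j xs ≡ xs
  take-≥ j       []       le       = take-[] j
  take-≥ (suc j) (x ∷ xs) (s≤s le) = cong (x ∷_) (take-≥ j xs le)

  take-∈ : ∀ j (xs : List A) {y} → y ∈ take j xs → y ∈ xs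
  take-∈ (suc j) (x ∷ xs) (here p)  = here p
  take-∈ (suc j) (x ∷ xs) (there p) = there (take-∈ j xs p)

  drop-∈ : ∀ j (xs : List A) {y} → y ∈ drop j xs → y ∈ xs
  drop-∈ zero    xs       p = p
  drop-∈ (suc j) (x ∷ xs) p = there (drop-∈ j xs p)

  drop-length-++ : ∀ (xs ys : List A) → drop (length xs) (xs ++ ys) ≡ ys
  drop-length-++ []       ys = ≡refl
  drop-length-++ (_ ∷ xs) ys = drop-length-++ xs ys

  fromList-length : ∀ {m} (xs : List A) → length xs ≡ m → Σ (Vec A m) λ v → toList v ≡ xs
  fromList-length []       ≡refl = [] , ≡refl
  fromList-length (x ∷ xs) ≡refl = let v , eq = fromList-length xs ≡refl in x ∷ v , cong (x ∷_) eq

  length-∷ʳ : ∀ (xs : List A) x → length (xs ++ x ∷ []) ≡ suc (length xs)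
  length-∷ʳ xs x = ≡trans (length-++ xs) (+-comm (length xs) 1)

  ∷ʳ-++-assoc : ∀ (xs : List A) x ys → (xs ++ x ∷ []) ++ ys ≡ xs ++ x ∷ ys
  ∷ʳ-++-assoc xs x ys = ++-assoc xs (x ∷ []) ys

  Unique-tail : ∀ {x : A} {xs} → Unique (x ∷ xs) → Unique xs
  Unique-tail (_ ∷ u) = u

  ∉⇒Unique : ∀ {x : A} {xs} → x ∉ xs → Unique xs → Unique (x ∷ xs)
  ∉⇒Unique x∉ u = Allₚ.¬Any⇒All¬ _ x∉ ∷ u

  Unique-↭ : {xs ys : List A} → xs ↭ ys → Unique xs → Unique ys
  Unique-↭ refl         u = u
  Unique-↭ (prep x p)   (a ∷ u) = All-resp-↭ p a ∷ Unique-↭ p u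
  Unique-↭ (swap x y p) ((x≢y ∷ a) ∷ b ∷ u) = ((λ e → x≢y (sym e)) ∷ All-resp-↭ p b) ∷ All-resp-↭ p a ∷ Unique-↭ p u
  Unique-↭ (trans p q)  u = Unique-↭ q (Unique-↭ p u)

  Unique-++ˡ : ∀ (xs {ys} : List A) → Unique (xs ++ ys) → Unique xs
  Unique-++ˡ []       u       = []
  Unique-++ˡ (x ∷ xs) (a ∷ u) = Allₚ.++⁻ˡ xs a ∷ Unique-++ˡ xs u

  Unique-++ʳ : ∀ (xs {ys} : List A) → Unique (xs ++ ys) → Unique ys
  Unique-++ʳ []       u       = u
  Unique-++ʳ (x ∷ xs) (a ∷ u) = Unique-++ʳ xs u

  Unique-disjoint : ∀ (xs {ys} : List A) {x} → Unique (xs ++ ys) → x ∈ xs → x ∉ ys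
  Unique-disjoint (x ∷ xs) (a ∷ u) (here ≡refl) x∈ = All.lookup (Allₚ.++⁻ʳ xs a) x∈ ≡refl
  Unique-disjoint (x ∷ xs) (a ∷ u) (there p)    x∈ = Unique-disjoint xs u p x∈

  Unique-++ : ∀ {xs ys : List A} → Unique xs → Unique ys → (∀ {x} → x ∈ xs → x ∉ ys) → Unique (xs ++ ys)
  Unique-++ []      v h = v
  Unique-++ {xs = x ∷ xs} (a ∷ u) v h = Allₚ.++⁺ a (Allₚ.¬Any⇒All¬ _ (h (here ≡refl))) ∷ Unique-++ u v (h ∘ there)

  -- Systems of k-graphs with k = κ + 1 = κ₁ + 2: E c xs says that the list xs
  -- enumerates an edge of colour c.

  record System (n κ₁ g : ℕ) : Set₁ where
    field
      E        : Fin n → List (Fin n) → Set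
      E?       : ∀ c xs → Dec (E c xs)
      E-length : ∀ {c xs} → E c xs → length xs ≡ suc (suc κ₁)
      E-unique : ∀ {c xs} → E c xs → Unique xs
      E-perm   : ∀ {c xs ys} → xs ↭ ys → E c xs → E c ys
      -- The integer form of: codegree at least (1/2 + 1/g) n.
      codegree : ∀ c S → Unique S → length S ≡ suc κ₁ → (g + 2) * n ≤ 2 * g * # (λ x → does (E? c (x ∷ S)))

  -- Coloured tight paths.

  module Paths {n κ₁ g : ℕ} (𝓗 : System n κ₁ g) where
    open System 𝓗 public

    V : Set
    V = Fin n

    κ k : ℕ
    κ = suc κ₁
    k = suc κ

    common-nbrs : ∀ c c′ {S S′} → Unique S → length S ≡ κ → Unique S′ → length S′ ≡ κ →
                  Many g (λ x → E c (x ∷ S) × E c′ (x ∷ S′))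
    common-nbrs c c′ {S} {S′} uS lS uS′ lS′ = many h (λ x p → does-sound (E? c (x ∷ S)) (proj₁ (∧-true p)) , does-sound (E? c′ (x ∷ S′)) (proj₂ (∧-true p))) bound
      where
      open ≤-Reasoning
      f f′ h : V → Bool
      f x  = does (E? c (x ∷ S))
      f′ x = does (E? c′ (x ∷ S′))
      h x  = f x ∧ f′ x
      pt : ∀ a b → χ a + χ b ≤ χ (a ∧ b) + 1
      pt true  true  = ≤-refl
      pt true  false = ≤-refl
      pt false true  = ≤-refl
      pt false false = z≤n
      incl : # f + # f′ ≤ # h + n
      incl = begin
        # f + # f′                                     ≡⟨ sym (∑-+ (allFin n) _ _) ⟩
        ∑ (allFin n) (λ x → χ (f x) + χ (f′ x))          ≤⟨ ∑-mono (allFin n) (λ x → pt (f x) (f′ x)) ⟩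
        ∑ (allFin n) (λ x → χ (h x) + 1)                ≡⟨ ∑-+ (allFin n) _ _ ⟩
        # h + ∑ (allFin n) (λ _ → 1)                    ≡⟨ cong (# h +_) (≡trans (∑-const (allFin n) 1) (≡trans (*-identityʳ _) (length-allFin n))) ⟩
        # h + n                                        ∎
      r1 : ∀ g n → 2 * (n + n) + 2 * g * n ≡ (g + 2) * n + (g + 2) * n
      r1 = solve-∀
      r2 : ∀ g a b → 2 * g * (a + b) ≡ 2 * (g * a) + 2 * g * b
      r2 = solve-∀
      bound : n ≤ g * # h
      -- Inclusion-exclusion gives 2n/g common neighbours; a factor of 2 is given away.
      bound = ≤-trans (m≤m+n n n) (*-cancelˡ-≤ 2 (+-cancelʳ-≤ (2 * g * n) _ _ (begin
        2 * (n + n) + 2 * g * n                ≡⟨ r1 g n ⟩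
        (g + 2) * n + (g + 2) * n              ≤⟨ +-mono-≤ (codegree c S uS lS) (codegree c′ S′ uS′ lS′) ⟩
        2 * g * # f + 2 * g * # f′             ≡⟨ sym (*-distribˡ-+ (2 * g) _ _) ⟩
        2 * g * (# f + # f′)                   ≤⟨ *-monoʳ-≤ (2 * g) incl ⟩
        2 * g * (# h + n)                      ≡⟨ r2 g (# h) n ⟩
        2 * (g * # h) + 2 * g * n              ∎)))

    nbrs : ∀ c {S} → Unique S → length S ≡ κ → Many g (λ x → E c (x ∷ S))
    nbrs c u l = Many-map (λ x → proj₁) (common-nbrs c c u l u l)

    E-snoc : ∀ {c x xs} → E c (x ∷ xs) → E c (xs ++ x ∷ [])
    E-snoc {x = x} {xs} = E-perm (++-comm (x ∷ []) xs)

    -- Colour i of cs is carried by the i-th window of vs; later windows are not constrained.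
    RP : List V → List V → Set
    RP vs []       = ⊤
    RP vs (c ∷ cs) = E c (take k vs) × RP (drop 1 vs) cs

    -- Gluing along T creates no new edge: a window starting in A ends inside `A ++ T`, because T
    -- has at least κ vertices.
    RP-glue : ∀ A {T Z c₁ c₂} → κ ≤ length T → length c₁ ≡ length A →
              RP (A ++ T) c₁ → RP (T ++ Z) c₂ → RP (A ++ T ++ Z) (c₁ ++ c₂)
    RP-glue []      {c₁ = []}     κ≤ eq r s = s
    RP-glue (a ∷ A) {T} {Z} {c ∷ c₁} κ≤ eq (e , r) s =
      subst (E c) (cong (a ∷_) (sym (≡trans (cong (take κ) (sym (++-assoc A T Z)))
        (take-++-≤ κ (A ++ T) (≤-trans κ≤ (≤-trans (m≤n+m _ _) (≤-reflexive (sym (length-++ A))))))))) e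
      , RP-glue A κ≤ (suc-injective eq) r s

    -- There is one colour per window starting in `S ++ W`, and none is counted for the end T. Along
    -- shared ends the counts add up exactly, and a closed chain has as many colours as vertices.
    record Path (S T W ds : List V) : Set where
      constructor path
      field
        len-S  : length S ≡ κ
        len-T  : length T ≡ κ
        len-ds : length ds ≡ length (S ++ W)
        rp     : RP (S ++ W ++ T) ds

    Path-compose : ∀ {S T U W₁ W₂ d₁ d₂} → Path S T W₁ d₁ → Path T U W₂ d₂ → Path S U (W₁ ++ T ++ W₂) (d₁ ++ d₂)
    Path-compose {S} {T} {U} {W₁} {W₂} {d₁} {d₂} (path lS lT ld r) (path _ lU ld′ r′) = path lS lU
      (≡trans (length-++ d₁) (≡trans (cong₂ _+_ ld ld′) (≡trans (sym (length-++ (S ++ W₁))) (cong length (++-assoc S W₁ (T ++ W₂))))))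
      (subst (λ z → RP z (d₁ ++ d₂)) eq
        (RP-glue (S ++ W₁) (≤-reflexive (sym lT)) ld (subst (λ z → RP z d₁) (sym (++-assoc S W₁ T)) r) r′))
      where
      eq : (S ++ W₁) ++ T ++ W₂ ++ U ≡ S ++ (W₁ ++ T ++ W₂) ++ U
      eq = ≡trans (++-assoc S W₁ _) (cong (S ++_) (≡trans (cong (W₁ ++_) (sym (++-assoc T W₂ U))) (sym (++-assoc W₁ (T ++ W₂) U))))

    -- Both paths receive the same vertices in the same colours, so each new vertex is a common
    -- neighbour of the two current ends. This lets one right half serve an absorber both with and
    -- without its vertex.
    extend₂ : ∀ (ds : Vec V m) {L L′} → Unique L → length L ≡ κ → Unique L′ → length L′ ≡ κ →
              NM g m (λ A → RP (L ++ toList A) (toList ds) × RP (L′ ++ toList A) (toList ds))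
    extend₂ [] uL lL uL′ lL′ = nm (tt , tt)
    extend₂ (d ∷ ds) {l ∷ L} {l′ ∷ L′} uL lL uL′ lL′ = nm (Many-map step (common-nbrs d d uL lL uL′ lL′))
      where
      shifted : ∀ {L l x} → length (l ∷ L) ≡ κ → E d (x ∷ l ∷ L) → Unique (L ++ x ∷ []) × length (L ++ x ∷ []) ≡ κ
      shifted {L} {l} {x} lL e = Unique-tail (E-unique (E-snoc e)) , ≡trans (length-∷ʳ L x) lL
      window : ∀ {L l x xs} → length (l ∷ L) ≡ κ → E d (x ∷ l ∷ L) → E d (take k (l ∷ L ++ x ∷ xs))
      window {L} {l} {x} {xs} lL e = subst (E d) (cong (l ∷_) (sym eq)) (E-snoc e)
        where
        eq : take κ (L ++ x ∷ xs) ≡ L ++ x ∷ []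
        eq = ≡trans (cong (λ z → take z (L ++ x ∷ xs)) (≡trans (sym lL) (+-comm 1 (length L)))) (take-length-+ L 1)
      step : ∀ x → E d (x ∷ l ∷ L) × E d (x ∷ l′ ∷ L′) → NM g _ _
      step x (e , e′) =
        let u , len = shifted lL e ; u′ , len′ = shifted lL′ e′ in
        NM-map (λ A (r , r′) → (window lL e , subst (λ z → RP z (toList ds)) (∷ʳ-++-assoc L x _) r)
                             , (window lL′ e′ , subst (λ z → RP z (toList ds)) (∷ʳ-++-assoc L′ x _) r′))
          (extend₂ ds u len u′ len′)

    -- Uncoloured tight paths

    TP : (List V → Set) → List V → Set
    TP G []       = ⊤
    TP G (v ∷ vs) = (k ≤ length (v ∷ vs) → G (take k (v ∷ vs))) × TP G vs

    TP⇒RP : ∀ {G} vs cs → TP G vs → All (λ c → ∀ {w} → G w → E c w) cs → length cs + κ ≤ length vs → RP vs cs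
    TP⇒RP vs       []       tp h le = tt
    TP⇒RP (v ∷ vs) (c ∷ cs) (w , tp) (p ∷ h) le@(s≤s le′) =
      p (w (≤-trans (s≤s (m≤n+m κ (length cs))) le)) , TP⇒RP vs cs tp h le′

    TP-take : ∀ {G} j vs → TP G vs → TP G (take j vs)
    TP-take zero    vs       tp = tt
    TP-take (suc j) []       tp = tt
    TP-take {G} (suc j) (v ∷ vs) (w , tp) = (λ le → subst G (sym (eq le)) (w (≤-trans le (s≤s (≤-trans (≤-reflexive (length-take j vs)) (m⊓n≤n j _)))))) , TP-take j vs tp
      where
      eq : k ≤ suc (length (take j vs)) → take k (v ∷ take j vs) ≡ take k (v ∷ vs)
      eq (s≤s le) = cong (v ∷_) (≡trans (take-take κ j vs) (cong (λ z → take z vs) (m≤n⇒m⊓n≡m (≤-trans le (≤-trans (≤-reflexive (length-take j vs)) (m⊓n≤m j _))))))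

    TP-drop : ∀ {G} j vs → TP G vs → TP G (drop j vs)
    TP-drop zero    vs       tp = tp
    TP-drop (suc j) []       tp = tp
    TP-drop (suc j) (v ∷ vs) (_ , tp) = TP-drop j vs tp

    -- A path all of whose windows are edges in every colour of `cs` can be coloured from `cs` in
    -- any order, so the choice of colours is postponed until lengths are known.
    AllE : List V → List V → Set
    AllE cs w = ∀ {c} → c ∈ cs → E c w

    RP⇒TP : ∀ {cs} vs j → (∀ {c} → c ∈ cs → RP vs (replicate j c)) → length vs ≤ j + κ → TP (AllE cs) vs
    RP⇒TP []       j h le = tt
    RP⇒TP (v ∷ vs) zero    h le = (λ k≤ → contradiction (≤-trans k≤ le) 1+n≰n) , RP⇒TP vs zero (λ _ → tt) (<⇒≤ le)
    RP⇒TP (v ∷ vs) (suc j) h le = (λ _ c∈ → proj₁ (h c∈)) , RP⇒TP vs j (λ c∈ → proj₂ (h c∈)) (ℕ.s≤s⁻¹ le)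

    TP-prepend : ∀ {cs} A {Y Z} → κ ≤ length Y → (∀ {c} → c ∈ cs → RP (A ++ Y) (replicate (length A) c)) →
                 TP (AllE cs) (Y ++ Z) → TP (AllE cs) (A ++ Y ++ Z)
    TP-prepend []      κ≤ h tp = tp
    TP-prepend (a ∷ A) {Y} {Z} κ≤ h tp = (λ _ {c} c∈ → subst (E c) (cong (a ∷_) eq) (proj₁ (h c∈))) , TP-prepend A κ≤ (λ c∈ → proj₂ (h c∈)) tp
      where
      eq : take κ (A ++ Y) ≡ take κ (A ++ Y ++ Z)
      eq = sym (≡trans (cong (take κ) (sym (++-assoc A Y Z)))
        (take-++-≤ κ (A ++ Y) (≤-trans κ≤ (≤-trans (m≤n+m _ _) (≤-reflexive (sym (length-++ A)))))))

    -- A window of Y ++ Y′ is a rotation of an initial piece of Y′ followed by a final piece of Y.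
    TP-round : ∀ {G} → (∀ {xs ys} → xs ↭ ys → G xs → G ys) → ∀ {Y Y′ Z} → length Y ≡ k → length Y′ ≡ k →
               (∀ A B → Y ≡ A ++ B → G (take (length A) Y′ ++ B)) →
               TP G (Y′ ++ Z) → TP G (Y ++ Y′ ++ Z)
    TP-round {G} G-perm {Y} {Y′} {Z} lY lY′ h tp = go [] Y ≡refl
      where
      go : ∀ A B → Y ≡ A ++ B → TP G (B ++ Y′ ++ Z)
      go A []      eq = tp
      go A (b ∷ B) eq = (λ _ → subst G (sym win) (G-perm (++-comm (take (length A) Y′) (b ∷ B)) (h A (b ∷ B) eq)))
                      , go (A ++ b ∷ []) B (≡trans eq (sym (∷ʳ-++-assoc A b B)))
        where
        lens : length A + length (b ∷ B) ≡ k
        lens = ≡trans (sym (length-++ A)) (≡trans (cong length (sym eq)) lY)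
        win : take k (b ∷ B ++ Y′ ++ Z) ≡ (b ∷ B) ++ take (length A) Y′
        win = ≡trans (cong (λ z → take z (b ∷ B ++ Y′ ++ Z)) (≡trans (sym lens) (+-comm (length A) _)))
             (≡trans (take-length-+ (b ∷ B) (length A))
               (cong ((b ∷ B) ++_) (take-++-≤ (length A) Y′ (≤-trans (m≤m+n _ _) (≤-reflexive (≡trans lens (sym lY′)))))))

  Fresh-∉ : ∀ {B : List (Fin n)} (xs : Vec (Fin n) m) {y} → Fresh B xs → y ∈ toList xs → y ∉ B
  Fresh-∉ (x ∷ xs) (x∉ , f) (here ≡refl) = x∉
  Fresh-∉ (x ∷ xs) (x∉ , f) (there y∈)   = Fresh-∉ xs f y∈ ∘ there

  Fresh-unique : ∀ {B : List (Fin n)} (xs : Vec (Fin n) m) → Fresh B xs → Unique (toList xs)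
  Fresh-unique []       f        = []
  Fresh-unique (x ∷ xs) (x∉ , f) = ∉⇒Unique (λ x∈ → Fresh-∉ xs f x∈ (here ≡refl)) (Fresh-unique xs f)

  NM-snoc : ∀ m {R : Vec (Fin n) (suc m) → Set} → NM d m (λ xs → Many d (λ x → R (xs Vec.∷ʳ x))) → NM d (suc m) R
  NM-snoc zero    (nm r) = nm (Many-map (λ x → nm) r)
  NM-snoc (suc m) (nm r) = nm (Many-map (λ x → NM-snoc m) r)

  take-++ᵥ : ∀ a {b} (xs : Vec A a) (ys : Vec A b) → Vec.take a (xs Vec.++ ys) ≡ xs
  take-++ᵥ a xs ys = Vecₚ.++-injectiveˡ (Vec.take a (xs Vec.++ ys)) xs (Vecₚ.take++drop≡id a (xs Vec.++ ys))

  drop-++ᵥ : ∀ a {b} (xs : Vec A a) (ys : Vec A b) → Vec.drop a (xs Vec.++ ys) ≡ ys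
  drop-++ᵥ a xs ys = Vecₚ.++-injectiveʳ (Vec.take a (xs Vec.++ ys)) xs (Vecₚ.take++drop≡id a (xs Vec.++ ys))

  -- Mixtures of two sequences and of their classes.

  mix : ℕ → List A → List A → List A
  mix zero    X       Y       = Y
  mix (suc j) (x ∷ X) (y ∷ Y) = x ∷ mix j X Y
  mix (suc j) _       _       = []

  -- `mix j X Y` and `mix (suc j) X Y` differ only in position j. Hence an initial piece of the
  -- former followed by a final piece of the latter is one of the two; this lemma treats cuts up to
  -- position j, `mix-drop` the later ones.
  mix-take : ∀ {i j} (X Y : List A) → length X ≡ length Y → i ≤ j → j < length X → take i (mix j X Y) ≡ take i (mix (suc j) X Y)
  mix-take X       Y       eq z≤n      lt       = ≡refl
  mix-take (x ∷ X) (y ∷ Y) eq (s≤s le) (s≤s lt) = cong (x ∷_) (mix-take X Y (suc-injective eq) le lt)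

  mix-drop : ∀ {i j} (X Y : List A) → length X ≡ length Y → j < i → drop i (mix (suc j) X Y) ≡ drop i (mix j X Y)
  mix-drop {i = i} {j} []      []      eq lt               = cong (drop i) (≡trans (mix-[] (suc j)) (sym (mix-[] j)))
    where
    mix-[] : ∀ j → mix {A = A} j [] [] ≡ []
    mix-[] zero    = ≡refl
    mix-[] (suc j) = ≡refl
  mix-drop {j = zero}  (x ∷ X) (y ∷ Y) eq (s≤s le)         = ≡refl
  mix-drop {j = suc j} (x ∷ X) (y ∷ Y) eq (s≤s le)         = mix-drop X Y (suc-injective eq) le

  mix-map : ∀ (f : A → B) j (X Y : List A) → map f (mix j X Y) ≡ mix j (map f X) (map f Y)
  mix-map f zero    X       Y       = ≡refl
  mix-map f (suc j) []      Y       = ≡refl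
  mix-map f (suc j) (x ∷ X) []      = ≡refl
  mix-map f (suc j) (x ∷ X) (y ∷ Y) = cong (f x ∷_) (mix-map f j X Y)

  mix-∈ : ∀ j (X Y : List A) {z} → z ∈ mix j X Y → z ∈ X ++ Y
  mix-∈ zero    X       Y       z∈           = ∈-++⁺ʳ X z∈
  mix-∈ (suc j) (x ∷ X) (y ∷ Y) (here ≡refl) = here ≡refl
  mix-∈ (suc j) (x ∷ X) (y ∷ Y) (there z∈) with ∈-++⁻ X (mix-∈ j X Y z∈)
  ... | inj₁ p = ∈-++⁺ˡ (there p)
  ... | inj₂ p = ∈-++⁺ʳ (x ∷ X) (there p)

  mix-unique : ∀ j (X Y : List A) → Unique (X ++ Y) → Unique (mix j X Y)
  mix-unique zero    X       Y       u       = Unique-++ʳ X u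
  mix-unique (suc j) []      Y       u       = []
  mix-unique (suc j) (x ∷ X) []      u       = []
  mix-unique (suc j) (x ∷ X) (y ∷ Y) (a ∷ u) = ∉⇒Unique (λ x∈ → x∉ (mix-∈ j X Y x∈)) (mix-unique j X Y (Unique-tail (Unique-↭ (Permₚ.shift y X Y) u)))
    where
    x∉ : x ∉ X ++ Y
    x∉ x∈ with ∈-++⁻ X x∈
    ... | inj₁ p = All.lookup a (∈-++⁺ˡ p) ≡refl
    ... | inj₂ p = All.lookup a (∈-++⁺ʳ X (there p)) ≡refl

  mix-length : ∀ j (X Y : List A) → length X ≡ length Y → length (mix j X Y) ≡ length X
  mix-length zero    X       Y       eq = sym eq
  mix-length (suc j) []      Y       eq = ≡refl
  mix-length (suc j) (x ∷ X) (y ∷ Y) eq = cong suc (mix-length j X Y (suc-injective eq))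

  module _ {R : A → B → Set} where
    Pw-take : ∀ i {xs ys} → Pointwise R xs ys → Pointwise R (take i xs) (take i ys)
    Pw-take zero    p       = []
    Pw-take (suc i) []      = []
    Pw-take (suc i) (r ∷ p) = r ∷ Pw-take i p

    Pw-drop : ∀ i {xs ys} → Pointwise R xs ys → Pointwise R (drop i xs) (drop i ys)
    Pw-drop zero    p       = p
    Pw-drop (suc i) []      = []
    Pw-drop (suc i) (r ∷ p) = Pw-drop i p

    Pw-mix : ∀ j {xs ys xs′ ys′} → Pointwise R xs ys → Pointwise R xs′ ys′ → Pointwise R (mix j xs xs′) (mix j ys ys′)
    Pw-mix zero    p       q       = q
    Pw-mix (suc j) []      q       = []
    Pw-mix (suc j) (r ∷ p) []      = []
    Pw-mix (suc j) (r ∷ p) (s ∷ q) = r ∷ Pw-mix j p q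

    -- Z determines only the positions of X and F that enter the mixture; the others are filled from
    -- X₀ and F₀.
    Pw-unmix : ∀ j {X₀ F₀ Xs Fs Z} → Pointwise R X₀ Xs → Pointwise R F₀ Fs → length Xs ≡ length Fs →
               Pointwise R Z (mix j Xs Fs) →
               Σ (List A) λ X → Σ (List A) λ F → Pointwise R X Xs × Pointwise R F Fs × Z ≡ mix j X F
    Pw-unmix zero {X₀} {Z = Z} p q eq r = X₀ , Z , p , r , ≡refl
    Pw-unmix (suc j) []      []      eq [] = [] , [] , [] , [] , ≡refl
    Pw-unmix (suc j) (a ∷ p) (b ∷ q) eq (_∷_ {x = z} c r) =
      let X , F , p′ , q′ , e = Pw-unmix j p q (suc-injective eq) r
      in z ∷ X , _ ∷ F , c ∷ p′ , b ∷ q′ , cong (z ∷_) e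

  flat : List (Vec A t) → List A
  flat Cs = concat (map toList Cs)

  heads : List (Vec A (suc t)) → List A
  heads = map Vec.head

  tails : List (Vec A (suc t)) → List (Vec A t)
  tails = map Vec.tail

  heads-tails : (Cs : List (Vec A (suc t))) → flat Cs ↭ heads Cs ++ flat (tails Cs)
  heads-tails []              = refl
  heads-tails ((x ∷ v) ∷ Cs) = prep x
    (trans (Permₚ.++⁺ˡ (toList v) (heads-tails Cs))
           (Permₚ.shifts (toList v) (heads Cs)))

  flat-++ : (Cs Ds : List (Vec A t)) → flat (Cs ++ Ds) ≡ flat Cs ++ flat Ds
  flat-++ []       Ds = ≡refl
  flat-++ (C ∷ Cs) Ds = ≡trans (cong (toList C ++_) (flat-++ Cs Ds)) (sym (++-assoc (toList C) _ _))

  flat-↭ : {Cs Ds : List (Vec A t)} → Cs ↭ Ds → flat Cs ↭ flat Ds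
  flat-↭ refl         = refl
  flat-↭ (prep x p)   = Permₚ.++⁺ˡ (toList x) (flat-↭ p)
  flat-↭ (swap x y p) = trans (Permₚ.shifts (toList x) (toList y)) (Permₚ.++⁺ˡ (toList y) (Permₚ.++⁺ˡ (toList x) (flat-↭ p)))
  flat-↭ (trans p q)  = trans (flat-↭ p) (flat-↭ q)

  toList-concat : ∀ {m} (Cs : Vec (Vec A t) m) → toList (Vec.concat Cs) ≡ flat (toList Cs)
  toList-concat []       = ≡refl
  toList-concat (C ∷ Cs) = ≡trans (Vecₚ.toList-++ C (Vec.concat Cs)) (cong (toList C ++_) (toList-concat Cs))

  Within : List (Vec A m) → List (Vec A t) → Set
  Within = Pointwise (λ C D → ∀ {x} → x ∈ toList C → x ∈ toList D)

  heads-selection : ∀ {Cs : List (Vec (Fin n) (suc m))} {Ds : List (Vec (Fin n) t)} → Within Cs Ds → Selection (heads Cs) Ds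
  heads-selection []                     = []
  heads-selection (_∷_ {x = x ∷ _} h w) = h (here ≡refl) ∷ heads-selection w

  tails-within : ∀ {Cs : List (Vec A (suc m))} {Ds : List (Vec A t)} → Within Cs Ds → Within (tails Cs) Ds
  tails-within []                     = []
  tails-within (_∷_ {x = x ∷ _} h w) = (h ∘ there) ∷ tails-within w

  Within-refl : ∀ {Cs : List (Vec A t)} → Within Cs Cs
  Within-refl {Cs = []}     = []
  Within-refl {Cs = C ∷ Cs} = id ∷ Within-refl

  -- κ colours, followed by the κ vertices on either side of the gap.
  absLen : ℕ → ℕ
  absLen κ₁ = suc κ₁ + (suc κ₁ + suc κ₁)

  module Gadgets {n κ₁ g : ℕ} (𝓗 : System n κ₁ g) where
    open Paths 𝓗 public

    -- Absorbers

    Nₐ : ℕ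
    Nₐ = absLen κ₁

    cols left right : Vec V Nₐ → List V
    cols  τ = toList (Vec.take κ τ)
    left  τ = toList (Vec.take κ (Vec.drop κ τ))
    right τ = toList (Vec.drop κ (Vec.drop κ τ))

    -- Without v there are κ windows, carrying the colours of τ. Inserting v creates one more; the
    -- new first window takes c, and the colours of τ are reused on the others.
    Absorbs : V × V → Vec V Nₐ → Set
    Absorbs (v , c) τ = Path (left τ) (right τ) [] (cols τ) × Path (left τ) (right τ) (v ∷ []) (c ∷ cols τ)

    -- The colours of τ are arbitrary. The left half only has to form an edge of colour c with v,
    -- which a single codegree condition on its last vertex a provides. The right half then
    -- continues both the left half and the left half shifted by v.
    absorbers-dense : 2 * (1 + κ₁) ≤ n → ∀ q → NM (2 + g) Nₐ (Absorbs q)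
    absorbers-dense big (v , c) =
      NM-++ κ (NM-map (λ ds _ → NM-++ κ (NM-snoc κ₁ (NM-map (λ b (_ , fr) → Many-map (λ a e → second ds b a e) (first b fr))
        (NM-weaken (m≤m+n 2 g) (NM-fresh {d = 1} (v ∷ []) big (NM-all {R = λ _ → ⊤} (λ _ → tt)))))))
        (NM-weaken (s≤s z≤n) (NM-all {R = λ _ → ⊤} (λ _ → tt))))
      where
      first : (b : Vec V κ₁) → Fresh (v ∷ []) b → Many (2 + g) (λ a → E c (a ∷ v ∷ toList b))
      first b fr = Many-weaken (m≤n+m g 2)
        (nbrs c (∉⇒Unique (λ v∈ → Fresh-∉ b fr v∈ (here ≡refl)) (Fresh-unique b fr)) (cong suc (length-toList b)))
      build : ∀ (ds : Vec V κ) (A : List V) → length A ≡ κ → E c (A ++ v ∷ []) → NM (2 + g) κ λ A′ →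
              Path A (toList A′) [] (toList ds) × Path A (toList A′) (v ∷ []) (c ∷ toList ds)
      build ds (x ∷ A) lA e = NM-weaken (m≤n+m g 2) (NM-map (λ A′ (r , r′) →
          path lA (length-toList A′) (≡trans (length-toList ds) (≡trans (sym lA) (cong length (sym (++-identityʳ (x ∷ A)))))) r
        , path lA (length-toList A′) (≡trans (cong suc (length-toList ds)) (sym (≡trans (length-∷ʳ (x ∷ A) v) (cong suc lA))))
            (subst (E c) (cong (x ∷_) (sym (win A′))) e , subst (λ z → RP z (toList ds)) (∷ʳ-++-assoc A v _) r′))
        (extend₂ ds (Unique-++ˡ (x ∷ A) (E-unique e)) lA (Unique-tail (E-unique e)) (≡trans (length-∷ʳ A v) lA)))
        where
        win : ∀ {m} (A′ : Vec V m) → take κ (A ++ v ∷ toList A′) ≡ A ++ v ∷ []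
        win A′ = ≡trans (cong (λ z → take z (A ++ v ∷ toList A′)) (≡trans (sym lA) (+-comm 1 (length A)))) (take-length-+ A 1)
      second : ∀ (ds : Vec V κ) (b : Vec V κ₁) a → E c (a ∷ v ∷ toList b) →
               NM (2 + g) κ λ A′ → Absorbs (v , c) (ds Vec.++ ((b Vec.∷ʳ a) Vec.++ A′))
      second ds b a e = NM-map (λ A′ p → subst₃ A′ p) (build ds (toList (b Vec.∷ʳ a)) (length-toList (b Vec.∷ʳ a)) window)
        where
        window : E c (toList (b Vec.∷ʳ a) ++ v ∷ [])
        window = subst (λ z → E c (z ++ v ∷ [])) (sym (Vecₚ.toList-∷ʳ a b))
          (E-perm (trans (++-comm (a ∷ v ∷ []) (toList b)) (↭-reflexive (sym (∷ʳ-++-assoc (toList b) a _)))) e)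
        subst₃ : ∀ A′ → Path (toList (b Vec.∷ʳ a)) (toList A′) [] (toList ds) × Path (toList (b Vec.∷ʳ a)) (toList A′) (v ∷ []) (c ∷ toList ds) →
                 Absorbs (v , c) (ds Vec.++ ((b Vec.∷ʳ a) Vec.++ A′))
        subst₃ A′ p rewrite take-++ᵥ κ ds ((b Vec.∷ʳ a) Vec.++ A′) | drop-++ᵥ κ ds ((b Vec.∷ʳ a) Vec.++ A′)
                          | take-++ᵥ κ (b Vec.∷ʳ a) A′ | drop-++ᵥ κ (b Vec.∷ʳ a) A′ = p

  -- Connecting paths between ordered (k-1)-tuples.

  connCopies connLen : ℕ → ℕ
  -- This equals κ + (k + 1) k, the number of windows starting in S or in the k + 1 rounds of k
  -- inner vertices, so the class of the colour supplies exactly the colours required. A vertex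
  -- class gives up k + 1 members; the number is written in the form k + suc s that `rounds k`
  -- expects.
  connCopies κ₁ = suc (suc κ₁) + suc (κ₁ + suc (suc κ₁) * suc (suc κ₁))
  connLen κ₁ = suc (suc (suc κ₁) + suc (suc κ₁)) * connCopies κ₁

  connDens : ℕ → ℕ → ℕ
  connDens κ₁ g = blowC (connCopies κ₁) (suc (suc (suc κ₁) + suc (suc κ₁))) (suc g)

  module Connectors {n κ₁ g : ℕ} (𝓗 : System n κ₁ g) where
    open Gadgets 𝓗 public

    extend-back : ∀ m {j K} Z c → m + j ≡ K → κ ≤ length Z → Unique (take κ Z) → RP Z (replicate j c) →
                  NM g m (λ G → RP (toList G List.ʳ++ Z) (replicate K c))
    extend-back zero    Z c ≡refl κ≤ u r = nm r
    extend-back (suc m) {j} Z c eq κ≤ u r = nm (Many-map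
      (λ x e → extend-back m (x ∷ Z) c (≡trans (+-suc m j) eq) (m≤n⇒m≤1+n κ≤)
        (subst Unique (cong (x ∷_) (shorter x)) (Uniqueₚ.take⁺ κ (E-unique e))) (e , r))
      (nbrs c u (≡trans (length-take κ Z) (m≤n⇒m⊓n≡m κ≤))))
      where
      shorter : ∀ x → take κ₁ (take κ Z) ≡ take κ₁ Z
      shorter x = ≡trans (take-take κ₁ κ Z) (cong (λ z → take z Z) (m≤n⇒m⊓n≡m (n≤1+n κ₁)))

    -- P holds the vertices already exchanged and F those still to be replaced. The new x extends
    -- the path ending in L and takes the place of f in the edge `P ++ F`, which turns each mixture
    -- into the next.
    extend-mix : ∀ c {L} P F → length F ≡ m → Unique L → length L ≡ κ → E c (P ++ F) →
                 NM g m (λ X → RP (L ++ toList X) (replicate m c) × (∀ j → j ≤ m → E c (P ++ mix j (toList X) F)))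
    extend-mix {zero}  c P []      eq u l e = nm (tt , λ { zero _ → e })
    extend-mix {suc m} c {l ∷ L} P (f ∷ F) eq u lL e = nm (Many-map step (common-nbrs c c u lL uPF lPF))
      where
      e′ : E c (f ∷ P ++ F)
      e′ = E-perm (Permₚ.shift f P F) e
      uPF : Unique (P ++ F)
      uPF = Unique-tail (E-unique e′)
      lPF : length (P ++ F) ≡ κ
      lPF = suc-injective (E-length e′)
      step : ∀ x → E c (x ∷ l ∷ L) × E c (x ∷ P ++ F) → NM g m _
      step x (e₁ , e₂) = NM-map (λ X (r , h) →
          (subst (E c) (cong (l ∷_) (sym (win X))) (E-snoc e₁) , subst (λ z → RP z (replicate m c)) (∷ʳ-++-assoc L x _) r)
          , λ { zero _ → e ; (suc j) (s≤s le) → subst (E c) (∷ʳ-++-assoc P x _) (h j le) })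
        (extend-mix c (P ++ x ∷ []) F (suc-injective eq) (Unique-tail (E-unique (E-snoc e₁))) (≡trans (length-∷ʳ L x) lL)
          (subst (E c) (sym (∷ʳ-++-assoc P x F)) (E-perm (↭-sym (Permₚ.shift x P F)) e₂)))
        where
        win : (X : Vec V m) → take κ (L ++ x ∷ toList X) ≡ L ++ x ∷ []
        win X = ≡trans (cong (λ z → take z (L ++ x ∷ toList X)) (≡trans (sym lL) (+-comm 1 (length L)))) (take-length-+ L 1)

    module _ (S T : List V) (uS : Unique S) (lS : length S ≡ κ) (uT : Unique T) (lT : length T ≡ κ) where

      -- S X and F T are tight paths, and X turns into F by replacing one vertex at a time:
      -- each vertex of X has to satisfy only two codegree conditions.
      Linked : V → List V → List V → Set
      Linked c F X = RP (S ++ X) (replicate k c) × RP (F ++ T) (replicate k c) × (∀ j → j ≤ k → E c (mix j X F))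

      LinkedVec : Vec V (suc (k + k)) → Set
      LinkedVec (c ∷ zs) = Linked c (reverse (toList (Vec.take k zs))) (toList (Vec.drop k zs))

      linked-dense : NM (suc g) (suc (k + k)) LinkedVec
      linked-dense = nm (Many-weaken (s≤s z≤n) (Many-all λ c → NM-weaken (n≤1+n g)
        (NM-++ k (NM-map (chooseX c) (extend-back k T c (+-identityʳ k) (≤-reflexive (sym lT)) (subst Unique (sym (take-≥ κ T (≤-reflexive lT))) uT) tt)))))
        where
        len-rev : (G : Vec V k) → length (reverse (toList G)) ≡ k
        len-rev G = ≡trans (length-reverse (toList G)) (length-toList G)
        chooseX : ∀ c G → RP (toList G List.ʳ++ T) (replicate k c) → NM g k (λ X → LinkedVec (c ∷ (G Vec.++ X)))
        chooseX c G r = NM-map (λ X p → fin X p) (extend-mix c [] F (len-rev G) uS lS window)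
          where
          F = reverse (toList G)
          r′ : RP (F ++ T) (replicate k c)
          r′ = subst (λ z → RP z (replicate k c)) (ʳ++-defn (toList G)) r
          window : E c F
          window = subst (E c) (≡trans (take-++-≤ k F (≤-reflexive (sym (len-rev G)))) (take-≥ k F (≤-reflexive (len-rev G)))) (proj₁ r′)
          fin : ∀ X → RP (S ++ toList X) (replicate k c) × (∀ j → j ≤ k → E c (mix j (toList X) F)) → LinkedVec (c ∷ (G Vec.++ X))
          fin X (p , q) rewrite take-++ᵥ k G X | drop-++ᵥ k G X = p , r′ , q

    copies : ℕ
    copies = connCopies κ₁

    N_c d_c : ℕ
    N_c = connLen κ₁
    d_c = connDens κ₁ g

    -- Successive rounds follow the mixtures j, j - 1, ..., 0, so that X fades into F. Each round
    -- takes the heads of all classes and leaves the tails, so no vertex recurs.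
    rounds : ∀ j {s} → List (Vec V (j + suc s)) → List (Vec V (j + suc s)) → List V
    rounds zero    X F = heads F
    rounds (suc j) X F = heads (mix (suc j) X F) ++ rounds j (tails X) (tails F)

    rounds-length : ∀ j {s} (X F : List (Vec V (j + suc s))) → length X ≡ k → length F ≡ k → length (rounds j X F) ≡ suc j * k
    rounds-length zero    X F lX lF = ≡trans (length-map Vec.head F) (≡trans lF (sym (+-identityʳ k)))
    rounds-length (suc j) X F lX lF = ≡trans (length-++ (heads (mix (suc j) X F)))
      (cong₂ _+_ (≡trans (length-map Vec.head (mix (suc j) X F)) (≡trans (mix-length (suc j) X F (≡trans lX (sym lF))) lX))
                 (rounds-length j (tails X) (tails F) (≡trans (length-map Vec.tail X) lX) (≡trans (length-map Vec.tail F) lF)))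

    rounds-∈ : ∀ j {s} (X F : List (Vec V (j + suc s))) {v} → v ∈ rounds j X F → v ∈ flat X ++ flat F
    rounds-unique : ∀ j {s} (X F : List (Vec V (j + suc s))) → Unique (flat X ++ flat F) → Unique (rounds j X F)

    heads-tails₂ : (X F : List (Vec V (suc t))) → flat X ++ flat F ↭ (heads X ++ heads F) ++ (flat (tails X) ++ flat (tails F))
    heads-tails₂ X F = trans (↭-reflexive (sym (flat-++ X F))) (trans (heads-tails (X ++ F)) (↭-reflexive
      (cong₂ _++_ (map-++ Vec.head X F) (≡trans (cong flat (map-++ Vec.tail X F)) (flat-++ (tails X) (tails F))))))

    rounds-∈ zero    X F v∈ = ∈-++⁺ʳ (flat X) (∈-resp-↭ (↭-sym (heads-tails F)) (∈-++⁺ˡ v∈))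
    rounds-∈ (suc j) X F v∈ with ∈-++⁻ (heads (mix (suc j) X F)) v∈
    ... | inj₁ p = ∈-resp-↭ (↭-sym (heads-tails₂ X F)) (∈-++⁺ˡ (mix-∈ (suc j) (heads X) (heads F) (subst (_ ∈_) (mix-map Vec.head (suc j) X F) p)))
    ... | inj₂ p = ∈-resp-↭ (↭-sym (heads-tails₂ X F)) (∈-++⁺ʳ (heads X ++ heads F) (rounds-∈ j (tails X) (tails F) p))

    rounds-unique zero    X F u = Unique-++ˡ (heads F) (Unique-↭ (heads-tails F) (Unique-++ʳ (flat X) u))
    rounds-unique (suc j) X F u = Unique-++
      (subst Unique (sym (mix-map Vec.head (suc j) X F)) (mix-unique (suc j) (heads X) (heads F) (Unique-++ˡ _ u′)))
      (rounds-unique j (tails X) (tails F) (Unique-++ʳ (heads X ++ heads F) u′))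
      (λ p q → Unique-disjoint (heads X ++ heads F) u′ (mix-∈ (suc j) (heads X) (heads F) (subst (_ ∈_) (mix-map Vec.head (suc j) X F) p))
                 (rounds-∈ j (tails X) (tails F) q))
      where
      u′ = Unique-↭ (heads-tails₂ X F) u

    module _ (S T : List V) (lS : length S ≡ κ) (lT : length T ≡ κ)
             (Cc : List V) (Xs Fs : List (Vec V t)) (lX : length Xs ≡ k) (lF : length Fs ≡ k)
             (X₀ F₀ : List V) (selX₀ : Selection X₀ Xs) (selF₀ : Selection F₀ Fs)
             (linked : ∀ {c F X} → c ∈ Cc → Selection F Fs → Selection X Xs →
                RP (S ++ X) (replicate k c) × RP (F ++ T) (replicate k c) × (∀ j → j ≤ k → E c (mix j X F))) where

      private
        lXF : length Xs ≡ length Fs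
        lXF = ≡trans lX (sym lF)

        G-perm : ∀ {xs ys} → xs ↭ ys → AllE Cc xs → AllE Cc ys
        G-perm p h c∈ = E-perm p (h c∈)

        G-mix : ∀ j {Z} → j ≤ k → Selection Z (mix j Xs Fs) → AllE Cc Z
        G-mix j j≤k sel c∈ with Pw-unmix j selX₀ selF₀ lXF sel
        ... | X , F , sX , sF , ≡refl = proj₂ (proj₂ (linked c∈ sF sX)) j j≤k

        first : ∀ j {s} → List (Vec V (j + suc s)) → List (Vec V (j + suc s)) → List V
        first zero    X F = heads F
        first (suc j) X F = heads (mix (suc j) X F)

        later : ∀ j {s} → List (Vec V (j + suc s)) → List (Vec V (j + suc s)) → List V
        later zero    X F = []
        later (suc j) X F = rounds j (tails X) (tails F)

        split : ∀ j {s} (X F : List (Vec V (j + suc s))) → rounds j X F ≡ first j X F ++ later j X F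
        split zero    X F = sym (++-identityʳ _)
        split (suc j) X F = ≡refl

        first-sel : ∀ j {s} {X F : List (Vec V (j + suc s))} → Within X Xs → Within F Fs → Selection (first j X F) (mix j Xs Fs)
        first-sel zero    wX wF = heads-selection wF
        first-sel (suc j) wX wF = heads-selection (Pw-mix (suc j) wX wF)

      rounds-TP : ∀ j {s} {X F : List (Vec V (j + suc s))} → j ≤ k → Within X Xs → Within F Fs →
                  TP (AllE Cc) (rounds j X F ++ T)
      rounds-TP zero    {X = X} {F} j≤k wX wF = RP⇒TP (heads F ++ T) k (λ c∈ → proj₁ (proj₂ (linked c∈ (heads-selection wF) selX₀)))
        (≤-reflexive (≡trans (length-++ (heads F)) (cong₂ _+_ (≡trans (Pw.Pointwise-length (heads-selection wF)) lF) lT)))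
      rounds-TP (suc j) {X = X} {F} j<k wX wF = subst (TP (AllE Cc)) eq
        (TP-round G-perm lY lY′ mixed (subst (TP (AllE Cc)) eq′ (rounds-TP j (<⇒≤ j<k) (tails-within wX) (tails-within wF))))
        where
        Y  = heads (mix (suc j) X F)
        Y′ = first j (tails X) (tails F)
        Z  = later j (tails X) (tails F)
        eq′ : rounds j (tails X) (tails F) ++ T ≡ Y′ ++ Z ++ T
        eq′ = ≡trans (cong (_++ T) (split j (tails X) (tails F))) (++-assoc Y′ Z T)
        eq : Y ++ Y′ ++ Z ++ T ≡ (Y ++ rounds j (tails X) (tails F)) ++ T
        eq = sym (≡trans (++-assoc Y _ T) (cong (Y ++_) eq′))
        selY : Selection Y (mix (suc j) Xs Fs)
        selY = first-sel (suc j) wX wF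
        selY′ : Selection Y′ (mix j Xs Fs)
        selY′ = first-sel j (tails-within wX) (tails-within wF)
        lY : length Y ≡ k
        lY = ≡trans (Pw.Pointwise-length selY) (≡trans (mix-length (suc j) Xs Fs lXF) lX)
        lY′ : length Y′ ≡ k
        lY′ = ≡trans (Pw.Pointwise-length selY′) (≡trans (mix-length j Xs Fs lXF) lX)
        -- Consecutive rounds follow mixtures that differ in position j only. A cut i ≤ j yields a
        -- selection from mixture j + 1, a later cut one from mixture j, and both are edges.
        mixed : ∀ A B → Y ≡ A ++ B → AllE Cc (take (length A) Y′ ++ B)
        mixed A B YAB = subst (λ z → AllE Cc (take i Y′ ++ z)) (≡trans (cong (drop i) YAB) (drop-length-++ A B)) (go (i ≤? j))
          where
          i = length A
          go : Dec (i ≤ j) → AllE Cc (take i Y′ ++ drop i Y)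
          go (yes i≤j) = G-mix (suc j) j<k (subst (Selection _) (≡trans (cong (_++ drop i (mix (suc j) Xs Fs)) (mix-take Xs Fs lXF i≤j (≤-trans j<k (≤-reflexive (sym lX))))) (take++drop≡id i _))
            (Pw.++⁺ (Pw-take i selY′) (Pw-drop i selY)))
          go (no i≰j) = G-mix j (<⇒≤ j<k) (subst (Selection _) (≡trans (cong (take i (mix j Xs Fs) ++_) (mix-drop Xs Fs lXF (≰⇒> i≰j))) (take++drop≡id i _))
            (Pw.++⁺ (Pw-take i selY′) (Pw-drop i selY)))

    -- The inner vertices and colours are recorded only as entries of τ: freshness and disjointness
    -- are imposed on whole tuples and pass to whatever path is extracted from them.
    Connects : List V × List V → Vec V N_c → Set
    Connects (S , T) τ = Σ (List V) λ W → Σ (List V) λ ds → Path S T W ds ×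
      (∀ {x} → x ∈ W → x ∈ toList τ) × (∀ {x} → x ∈ ds → x ∈ toList τ) ×
      (Unique (toList τ) → Unique W × Unique ds)

    connectors-dense : ∀ S T → Unique S → length S ≡ κ → Unique T → length T ≡ κ → NM d_c N_c (Connects (S , T))
    connectors-dense S T uS lS uT lT = NM-map connect
      (NMC-flat (suc (k + k)) (NM-blowup copies (suc (k + k)) (linked-dense S T uS lS uT lT)))
      where
      connect : ∀ τ → Σ (Vec (Vec V copies) (suc (k + k))) (λ Cs → τ ≡ Vec.concat Cs ×
                  (∀ xs → Selection (toList xs) (toList Cs) → LinkedVec S T uS lS uT lT xs)) → Connects (S , T) τ
      connect τ (Cc ∷ Zs , ≡refl , h) with Vec.splitAt k Zs
      ... | Gs , Xv , ≡refl = W , toList Cc , path lS lT lds rp , W⊆ , ds⊆ , uniq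
        where
        Xs Fs : List (Vec V copies)
        Xs = toList Xv
        Fs = reverse (toList Gs)
        lX : length Xs ≡ k
        lX = length-toList Xv
        lF : length Fs ≡ k
        lF = ≡trans (length-reverse (toList Gs)) (length-toList Gs)
        W : List V
        W = rounds k Xs Fs
        linked : ∀ {c F X} → c ∈ toList Cc → Selection F Fs → Selection X Xs → Linked S T uS lS uT lT c F X
        linked {c} {F} {X} c∈ sF sX
          with fromList-length (reverse F) (≡trans (length-reverse F) (≡trans (Pw.Pointwise-length sF) lF)) | fromList-length X (≡trans (Pw.Pointwise-length sX) lX)
        ... | G , eqG | X′ , ≡refl = subst (λ z → Linked S T uS lS uT lT c z (toList X′)) (≡trans (cong reverse eqG) (reverse-involutive F)) res
          where
          sG : Selection (toList G) (toList Gs)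
          sG = ≡.subst₂ Selection (sym eqG) (reverse-involutive (toList Gs)) (Pw.reverse⁺ sF)
          res : Linked S T uS lS uT lT c (reverse (toList G)) (toList X′)
          res with h (c ∷ (G Vec.++ X′)) (c∈ ∷ ≡.subst₂ Selection (sym (Vecₚ.toList-++ G X′)) (sym (Vecₚ.toList-++ Gs Xv)) (Pw.++⁺ sG sX))
          ... | p rewrite take-++ᵥ k G X′ | drop-++ᵥ k G X′ = p
        selX₀ : Selection (heads Xs) Xs
        selX₀ = heads-selection Within-refl
        selF₀ : Selection (heads Fs) Fs
        selF₀ = heads-selection Within-refl
        tpW : TP (AllE (toList Cc)) (W ++ T)
        tpW = rounds-TP S T lS lT (toList Cc) Xs Fs lX lF (heads Xs) (heads Fs) selX₀ selF₀ linked k ≤-refl Within-refl Within-refl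
        Y = heads (mix k Xs Fs)
        selY : Selection Y (mix k Xs Fs)
        selY = heads-selection Within-refl
        mix-k : ∀ {A : Set} (X F : List A) j → length X ≡ j → length F ≡ j → mix j X F ≡ X
        mix-k []      []      _ ≡refl eF = ≡refl
        mix-k (x ∷ X) (f ∷ F) _ ≡refl eF = cong (x ∷_) (mix-k X F _ ≡refl (suc-injective eF))
        rest = rounds κ (tails Xs) (tails Fs)
        tpS : TP (AllE (toList Cc)) (S ++ W ++ T)
        tpS = subst (λ z → TP (AllE (toList Cc)) (S ++ z)) (sym (++-assoc Y rest T))
          (TP-prepend S (≤-trans (n≤1+n κ) (≤-reflexive (sym (≡trans (Pw.Pointwise-length selY) (≡trans (mix-length k Xs Fs (≡trans lX (sym lF))) lX)))))
            -- Of the k windows of `S ++ Y` only the κ that start in S are needed; the last one is Y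
            -- itself and belongs to `tpW`.
            (λ {c} c∈ → subst (λ z → RP (S ++ Y) (replicate z c)) (sym lS) (shorten (S ++ Y) κ c (proj₁ (linked c∈ selF₀ (subst (Selection Y) (mix-k Xs Fs k lX lF) selY)))))
            (subst (TP (AllE (toList Cc))) (++-assoc Y rest T) tpW))
          where
          shorten : ∀ vs j c → RP vs (replicate (suc j) c) → RP vs (replicate j c)
          shorten vs zero    c r       = tt
          shorten vs (suc j) c (e , r) = e , shorten (drop 1 vs) j c r
        lds : length (toList Cc) ≡ length (S ++ W)
        lds = ≡trans (length-toList Cc) (sym (≡trans (length-++ S) (≡trans (cong₂ _+_ lS (rounds-length k Xs Fs lX lF)) (count κ₁))))
          where
          count : ∀ κ₁ → suc κ₁ + suc (suc (suc κ₁)) * suc (suc κ₁) ≡ suc (suc κ₁) + suc (κ₁ + suc (suc κ₁) * suc (suc κ₁))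
          count = solve-∀
        rp : RP (S ++ W ++ T) (toList Cc)
        rp = TP⇒RP (S ++ W ++ T) (toList Cc) tpS (All.tabulate (λ c∈ w → w c∈))
          (≤-reflexive (≡trans (cong (_+ κ) lds) (≡trans (cong (length (S ++ W) +_) (sym lT)) (≡trans (sym (length-++ (S ++ W))) (cong length (++-assoc S W T))))))
        τ-eq : toList (Vec.concat (Cc ∷ (Gs Vec.++ Xv))) ↭ toList Cc ++ (flat Xs ++ flat Fs)
        τ-eq = trans (↭-reflexive (≡trans (toList-concat (Cc ∷ (Gs Vec.++ Xv))) (cong (toList Cc ++_) (≡trans (cong flat (Vecₚ.toList-++ Gs Xv)) (flat-++ (toList Gs) Xs)))))
          (Permₚ.++⁺ˡ (toList Cc) (trans (++-comm (flat (toList Gs)) (flat Xs)) (Permₚ.++⁺ˡ (flat Xs) (flat-↭ (↭-sym (Permₚ.↭-reverse (toList Gs)))))))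
        W⊆ : ∀ {x} → x ∈ W → x ∈ toList (Vec.concat (Cc ∷ (Gs Vec.++ Xv)))
        W⊆ x∈ = ∈-resp-↭ (↭-sym τ-eq) (∈-++⁺ʳ (toList Cc) (rounds-∈ k Xs Fs x∈))
        ds⊆ : ∀ {x} → x ∈ toList Cc → x ∈ toList (Vec.concat (Cc ∷ (Gs Vec.++ Xv)))
        ds⊆ x∈ = ∈-resp-↭ (↭-sym τ-eq) (∈-++⁺ˡ x∈)
        uniq : Unique (toList (Vec.concat (Cc ∷ (Gs Vec.++ Xv)))) → Unique W × Unique (toList Cc)
        uniq u = let u′ = Unique-↭ τ-eq u in rounds-unique k Xs Fs (Unique-++ʳ (toList Cc) u′) , Unique-++ˡ (toList Cc) u′

  ∈-extract : ∀ {x : A} {xs} → x ∈ xs → Σ (List A) λ ys → xs ↭ x ∷ ys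
  ∈-extract {x = x} x∈ with ∈-∃++ x∈
  ... | as , bs , ≡refl = as ++ bs , Permₚ.shift x as bs

  Unique-⊆-↭ : ∀ {xs ys : List A} → Unique xs → (∀ {x} → x ∈ xs → x ∈ ys) → Σ (List A) λ zs → ys ↭ xs ++ zs
  Unique-⊆-↭ {xs = []}     {ys} u h = ys , refl
  Unique-⊆-↭ {xs = x ∷ xs} {ys} u h =
    let ys′ , p = ∈-extract (h (here ≡refl))
        zs , q  = Unique-⊆-↭ (Unique-tail u) (λ {z} z∈ → strip z∈ (∈-resp-↭ p (h (there z∈))))
    in zs , trans p (prep x q)
    where
    strip : ∀ {z ys′} → z ∈ xs → z ∈ x ∷ ys′ → z ∈ ys′
    strip z∈ (here ≡refl) = contradiction z∈ (Uniqueₚ.Unique[x∷xs]⇒x∉xs u)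
    strip z∈ (there q)    = q

  complement : ∀ {n} {xs : List (Fin n)} → Unique xs → Σ (List (Fin n)) λ zs → allFin n ↭ xs ++ zs
  complement u = Unique-⊆-↭ u (λ {x} _ → ∈-allFin x)

  ∈-concat : ∀ {x : A} {xs xss} → x ∈ xs → xs ∈ xss → x ∈ concat xss
  ∈-concat x∈ (here ≡refl)                = ∈-++⁺ˡ x∈
  ∈-concat {xss = ys ∷ xss} x∈ (there p) = ∈-++⁺ʳ ys (∈-concat x∈ p)

  block-unique : ∀ {x : A} {xss P P′} → Unique (concat xss) → P ∈ xss → P′ ∈ xss → x ∈ P → x ∈ P′ → P ≡ P′
  block-unique u (here ≡refl) (here ≡refl) x∈ x∈′ = ≡refl
  block-unique {xss = P ∷ xss} u (here ≡refl) (there q) x∈ x∈′ = contradiction (∈-concat x∈′ q) (Unique-disjoint P u x∈)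
  block-unique {xss = P ∷ xss} u (there p) (here ≡refl) x∈ x∈′ = contradiction (∈-concat x∈ p) (Unique-disjoint P u x∈′)
  block-unique {xss = P ∷ xss} u (there p) (there q) x∈ x∈′ = block-unique (Unique-++ʳ P u) p q x∈ x∈′

  chunks : ∀ M → 1 ≤ M → (xs : List A) → Σ (List (List A)) λ cks → Σ (List A) λ rest →
           xs ≡ concat cks ++ rest × All (λ P → length P ≡ M) cks × length rest < M
  chunks {A} M 1≤M xs = go (length xs) xs ≤-refl
    where
    go : ∀ fuel xs → length xs ≤ fuel → Σ (List (List A)) λ cks → Σ (List A) λ rest →
         xs ≡ concat cks ++ rest × All (λ P → length P ≡ M) cks × length rest < M
    go fuel xs le with length xs <? M
    ... | yes lt = [] , xs , ≡refl , [] , lt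
    go zero    xs le | no ¬lt = contradiction (≤-trans (s≤s le) 1≤M) ¬lt
    go (suc f) xs le | no ¬lt =
      let cks , rest , eq , all , lt = go f (drop M xs) smaller
      in take M xs ∷ cks , rest
         , ≡trans (sym (take++drop≡id M xs)) (≡trans (cong (take M xs ++_) eq) (sym (++-assoc (take M xs) _ rest)))
         , (≡trans (length-take M xs) (m≤n⇒m⊓n≡m (≮⇒≥ ¬lt))) ∷ all , lt
      where
      smaller : length (drop M xs) ≤ f
      smaller = ≤-trans (≤-reflexive (length-drop M xs)) (≤-trans (∸-monoʳ-≤ (length xs) 1≤M) (≤-trans (∸-monoˡ-≤ 1 le) ≤-refl))

  length-filter-∑ : {P : A → Set} (P? : ∀ x → Dec (P x)) (xs : List A) → length (filter P? xs) ≡ ∑ xs (λ x → χ (does (P? x)))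
  length-filter-∑ P? []       = ≡refl
  length-filter-∑ P? (x ∷ xs) with P? x
  ... | yes _ = cong suc (length-filter-∑ P? xs)
  ... | no _  = length-filter-∑ P? xs

  -- Pigeonhole over the at most 2^|P| traces on P: deciding one p after another doubles the density
  -- constant each time.
  NM-decide : ∀ {n m d} {R : Vec (Fin n) m → Set} {Q : A → Vec (Fin n) m → Set} (Q? : ∀ a xs → Dec (Q a xs)) (P : List A) →
    NM d m R → Σ (List A) λ P′ → NM (2 ^ length P * d) m (λ xs → R xs × filter (λ p → Q? p xs) P ≡ P′)
  NM-decide {d = d} Q? []      r = [] , NM-weaken (≤-reflexive (sym (+-identityʳ d))) (NM-map (λ xs p → p , ≡refl) r)
  NM-decide {n = n} {m} {d} {R} Q? (p ∷ P) r = go (NM-split (NM-map (λ xs (rx , eq) → side xs rx eq (Q? p xs)) ih))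
    where
    P′ = proj₁ (NM-decide Q? P r)
    ih = proj₂ (NM-decide Q? P r)
    Res : List _ → Vec (Fin n) m → Set
    Res P″ xs = R xs × filter (λ p → Q? p xs) (p ∷ P) ≡ P″
    side : ∀ xs → R xs → filter (λ p → Q? p xs) P ≡ P′ → Dec _ → Res (p ∷ P′) xs ⊎ Res P′ xs
    side xs rx eq (yes q) = inj₁ (rx , ≡trans (filter-accept (λ p → Q? p xs) q) (cong (p ∷_) eq))
    side xs rx eq (no ¬q) = inj₂ (rx , ≡trans (filter-reject (λ p → Q? p xs) ¬q) eq)
    fix : ∀ {P″} → NM (2 * (2 ^ length P * d)) m (Res P″) → NM (2 ^ length (p ∷ P) * d) m (Res P″)
    fix = NM-weaken (≤-reflexive (sym (*-assoc 2 (2 ^ length P) d)))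
    go : NM (2 * (2 ^ length P * d)) m (Res (p ∷ P′)) ⊎ NM (2 * (2 ^ length P * d)) m (Res P′) →
         Σ (List _) λ P″ → NM (2 ^ length (p ∷ P) * d) m (Res P″)
    go (inj₁ r) = p ∷ P′ , fix r
    go (inj₂ r) = P′ , fix r

  -- Weaving a list of vertices with a blow-up.

  module Weave {n κ₁ g : ℕ} (𝓗 : System n κ₁ g) where
    open Connectors 𝓗 public

    weave : (P : List V) {s : ℕ} → List (Vec V (length P + s)) → List V
    weave []      Us = []
    weave (p ∷ P) Us = (heads Us ++ p ∷ []) ++ weave P (tails Us)

    weave-∈ : ∀ P {s} (Us : List (Vec V (length P + s))) {x} → x ∈ weave P Us → x ∈ P ++ flat Us
    weave-∈ (p ∷ P) Us x∈ with ∈-++⁻ (heads Us ++ p ∷ []) x∈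
    ... | inj₂ q with ∈-++⁻ P (weave-∈ P (tails Us) q)
    ...   | inj₁ a = there (∈-++⁺ˡ a)
    ...   | inj₂ a = there (∈-++⁺ʳ P (∈-resp-↭ (↭-sym (heads-tails Us)) (∈-++⁺ʳ (heads Us) a)))
    weave-∈ (p ∷ P) Us x∈ | inj₁ q with ∈-++⁻ (heads Us) q
    ...   | inj₁ a = there (∈-++⁺ʳ P (∈-resp-↭ (↭-sym (heads-tails Us)) (∈-++⁺ˡ a)))
    ...   | inj₂ (here ≡refl) = here ≡refl

    weave-unique : ∀ P {s} (Us : List (Vec V (length P + s))) → Unique (P ++ flat Us) → Unique (weave P Us)
    weave-unique []      Us u = []
    weave-unique (p ∷ P) Us u = Unique-++ (Unique-++ˡ (heads Us ++ p ∷ []) u′)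
      (weave-unique P (tails Us) (Unique-++ʳ (heads Us ++ p ∷ []) u′))
      (λ a b → Unique-disjoint (heads Us ++ p ∷ []) u′ a (weave-∈ P (tails Us) b))
      where
      u′ : Unique ((heads Us ++ p ∷ []) ++ (P ++ flat (tails Us)))
      u′ = Unique-↭ (trans (prep p (Permₚ.++⁺ˡ P (heads-tails Us)))
             (trans (prep p (Permₚ.shifts P (heads Us)))
             (trans (↭-sym (Permₚ.shift p (heads Us) _)) (↭-reflexive (sym (∷ʳ-++-assoc (heads Us) p _)))))) u

    weave-length : ∀ P {s} (Us : List (Vec V (length P + s))) → length Us ≡ κ → length (weave P Us) ≡ length P * k
    weave-length []      Us l = ≡refl
    weave-length (p ∷ P) Us l = ≡trans (length-++ (heads Us ++ p ∷ []))
      (cong₂ _+_ (≡trans (length-∷ʳ (heads Us) p) (cong suc (≡trans (length-map Vec.head Us) l)))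
                 (weave-length P (tails Us) (≡trans (length-map Vec.tail Us) l)))

    module _ (Cc : List V) (P₀ : List V) (Ks : List (Vec V t)) (lK : length Ks ≡ κ)
             (edges : ∀ {c us p} → c ∈ Cc → Selection us Ks → p ∈ P₀ → E c (us ++ p ∷ [])) where

      private
        classes : List (List V)
        classes = map toList Ks ++ P₀ ∷ []

        lCl : length classes ≡ k
        lCl = ≡trans (length-∷ʳ (map toList Ks) P₀) (cong suc (≡trans (length-map toList Ks) lK))

        G-sel : ∀ {Z} → Pointwise _∈_ Z classes → AllE Cc Z
        G-sel {Z} = split Ks {G = AllE Cc} (λ sel p∈ {c} c∈ → edges c∈ sel p∈)
          where
          split : ∀ Ks {Z} {G : List V → Set} → (∀ {us p} → Selection us Ks → p ∈ P₀ → G (us ++ p ∷ [])) →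
                  Pointwise _∈_ Z (map toList Ks ++ P₀ ∷ []) → G Z
          split []       h (p∈ ∷ []) = h [] p∈
          split (K ∷ Ks) {G = G} h (_∷_ {x = z} z∈ r) = split Ks {G = λ w → G (z ∷ w)} (λ sel p∈ → h (z∈ ∷ sel) p∈) r

        round-sel : ∀ {m} {Us : List (Vec V (suc m))} {p} → Within Us Ks → p ∈ P₀ → Pointwise _∈_ (heads Us ++ p ∷ []) classes
        round-sel w p∈ = Pw.++⁺ (pw (heads-selection w)) (p∈ ∷ [])
          where
          pw : ∀ {us Ks} → Selection {t = t} us Ks → Pointwise _∈_ us (map toList Ks)
          pw []      = []
          pw (x ∷ s) = x ∷ pw s

      -- The classes are visited in cyclic order, so any k consecutive vertices contain one member
      -- of each class of `Ks` and one of `P₀`, and every such choice is an edge.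
      weave-TP : ∀ P {s} (Us : List (Vec V (length P + s))) → (∀ {p} → p ∈ P → p ∈ P₀) → Within Us Ks → TP (AllE Cc) (weave P Us)
      weave-TP []          Us h w = tt
      weave-TP (p ∷ [])    Us h w = subst (TP (AllE Cc)) (sym (++-identityʳ Y))
        (RP⇒TP Y 1 (λ {c} c∈ → subst (E c) (sym (take-≥ k Y (≤-reflexive lY))) (G-sel sel c∈) , tt) (≤-reflexive lY))
        where
        Y = heads Us ++ p ∷ []
        sel = round-sel w (h (here ≡refl))
        lY : length Y ≡ k
        lY = ≡trans (Pw.Pointwise-length sel) lCl
      weave-TP (p ∷ p′ ∷ P) Us h w =
        TP-round {AllE Cc} (λ q a {c} c∈ → E-perm q (a c∈)) lY lY′ mixed (weave-TP (p′ ∷ P) (tails Us) (h ∘ there) (tails-within w))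
        where
        Y  = heads Us ++ p ∷ []
        Y′ = heads (tails Us) ++ p′ ∷ []
        sel  = round-sel w (h (here ≡refl))
        sel′ = round-sel (tails-within w) (h (there (here ≡refl)))
        lY : length Y ≡ k
        lY = ≡trans (Pw.Pointwise-length sel) lCl
        lY′ : length Y′ ≡ k
        lY′ = ≡trans (Pw.Pointwise-length sel′) lCl
        mixed : ∀ A B → Y ≡ A ++ B → AllE Cc (take (length A) Y′ ++ B)
        mixed A B eq = subst (λ z → AllE Cc (take (length A) Y′ ++ z)) (≡trans (cong (drop (length A)) eq) (drop-length-++ A B))
          (G-sel (subst (Pointwise _∈_ _) (take++drop≡id (length A) classes)
            (Pw.++⁺ (Pw-take (length A) sel′) (Pw-drop (length A) sel))))

  Many-outside : ∀ {n D u} (B : List (Fin n)) → length B + u ≤ n → n ≤ D * u → Many D (_∉ B)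
  Many-outside {n} {D} {u} B le big = many (λ x → not (x ∈ᵇ B)) (λ x → ∉ᵇ-sound) (≤-trans big (*-monoʳ-≤ D (+-cancelˡ-≤ (length B) _ _ (begin
    length B + u                                                ≤⟨ le ⟩
    n                                                           ≡⟨ sym (≡trans (∑-const (allFin n) 1) (≡trans (*-identityʳ _) (length-allFin n))) ⟩
    ∑ (allFin n) (λ _ → 1)                                      ≡⟨ ∑-cong (allFin n) (λ x → sym (pt (x ∈ᵇ B))) ⟩
    ∑ (allFin n) (λ x → χ (x ∈ᵇ B) + χ (not (x ∈ᵇ B)))          ≡⟨ ∑-+ (allFin n) _ _ ⟩
    # (_∈ᵇ B) + # (λ x → not (x ∈ᵇ B))                          ≤⟨ +-monoˡ-≤ _ (#∈≤length B) ⟩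
    length B + # (λ x → not (x ∈ᵇ B))                           ∎))))
    where
    open ≤-Reasoning
    pt : ∀ b → χ b + χ (not b) ≡ 1
    pt true  = ≡refl
    pt false = ≡refl

  selection-through : ∀ {n} {Us : List (Vec (Fin n) t)} {us₀ x} → Selection us₀ Us → x ∈ flat Us → ∃ λ us → Selection us Us × x ∈ us
  selection-through {Us = C ∷ Us} {u ∷ us₀} {x} (u∈ ∷ sel) x∈ with ∈-++⁻ (toList C) x∈
  ... | inj₁ p = x ∷ us₀ , p ∷ sel , here ≡refl
  ... | inj₂ p = let us , s , q = selection-through sel p in u ∷ us , u∈ ∷ s , there q

  Unique-block : ∀ {P : List A} {xss} → P ∈ xss → Unique (concat xss) → Unique P
  Unique-block {xss = P ∷ xss} (here ≡refl) u = Unique-++ˡ P u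
  Unique-block {xss = Q ∷ xss} (there p)    u = Unique-block p (Unique-++ʳ Q u)

  concat-map-↭ : ∀ (f : A → List B) {xs ys} → xs ↭ ys → concat (map f xs) ↭ concat (map f ys)
  concat-map-↭ f refl         = refl
  concat-map-↭ f (prep x p)   = Permₚ.++⁺ˡ (f x) (concat-map-↭ f p)
  concat-map-↭ f (swap x y p) = trans (Permₚ.shifts (f x) (f y)) (Permₚ.++⁺ˡ (f y) (Permₚ.++⁺ˡ (f x) (concat-map-↭ f p)))
  concat-map-↭ f (trans p q)  = trans (concat-map-↭ f p) (concat-map-↭ f q)

  -- Growing a longer path out of a block.

  growDens : ℕ → ℕ → ℕ → ℕ → ℕ
  growDens κ₁ g D M = blowC (suc (2 * M)) (suc (suc κ₁)) (2 ^ (2 * M) * pushC (suc (suc κ₁)) (2 * D + 2 * g))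

  module Covering {n κ₁ g : ℕ} (𝓗 : System n κ₁ g) where
    open Weave 𝓗 public

    degreeIn : V → List V → List V → ℕ
    degreeIn c us P = ∑ P (λ x → χ (does (E? c (x ∷ us))))

    -- Of the (1/2 + 1/g) n neighbours of `us`, at most n/2 lie in blocks that are less than half
    -- full of neighbours and at most n/(2g) in `rest`; the other n/(2g) lie in rich blocks. The
    -- density is over vertices rather than blocks so that quantifiers can be exchanged.
    many-in-rich-blocks : ∀ {blocks rest} → allFin n ↭ concat blocks ++ rest → 2 * g * length rest ≤ n →
      ∀ c {us} → Unique us → length us ≡ κ →
      Many (2 * g) (λ x → Σ (List V) λ P → P ∈ blocks × x ∈ P × length P ≤ 2 * degreeIn c us P)
    many-in-rich-blocks {blocks} {rest} perm few c {us} u l = many f f-sound bound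
      where
      open ≤-Reasoning
      rich? : ∀ x P → Dec (x ∈ P × length P ≤ 2 * degreeIn c us P)
      rich? x P = (x ∈? P) ×-dec (length P ≤? 2 * degreeIn c us P)
      f N : V → Bool
      f x = does (Any.any? (rich? x) blocks)
      N x = does (E? c (x ∷ us))
      unpack : ∀ {x bs} → Any (λ P → x ∈ P × length P ≤ 2 * degreeIn c us P) bs → Σ (List V) λ P → P ∈ bs × x ∈ P × length P ≤ 2 * degreeIn c us P
      unpack (here (a , b)) = _ , here ≡refl , a , b
      unpack (there p)      = let P , a , b = unpack p in P , there a , b
      f-sound : ∀ x → f x ≡ true → _
      f-sound x p = unpack (does-sound (Any.any? (rich? x) blocks) p)
      block : ∀ {P} → P ∈ blocks → 2 * degreeIn c us P ≤ length P + 2 * ∑ P (χ ∘ f)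
      block {P} P∈ with length P ≤? 2 * degreeIn c us P
      ... | no ¬p = ≤-trans (<⇒≤ (≰⇒> ¬p)) (m≤m+n _ _)
      ... | yes p = ≤-trans (*-monoʳ-≤ 2 (∑-mono-∈ P (λ {x} x∈ → ≤-trans (χ≤1 (N x)) (≤-reflexive (cong χ (sym (fx x∈))))))) (m≤n+m _ (length P))
        where
        pack : ∀ {x bs} → P ∈ bs → x ∈ P → Any (λ P → x ∈ P × length P ≤ 2 * degreeIn c us P) bs
        pack (here ≡refl) x∈ = here (x∈ , p)
        pack (there q)    x∈ = there (pack q x∈)
        fx : ∀ {x} → x ∈ P → f x ≡ true
        fx {x} x∈ = does-true (Any.any? (rich? x) blocks) (pack P∈ x∈)
      C = concat blocks
      lenC : length C + length rest ≡ n
      lenC = ≡trans (sym (length-++ C)) (≡trans (sym (↭-length perm)) (length-allFin n))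
      inC : 2 * ∑ C (χ ∘ N) ≤ n + 2 * # f
      inC = begin
        2 * ∑ C (χ ∘ N)                                         ≡⟨ cong (2 *_) (∑-concat blocks (χ ∘ N)) ⟩
        2 * ∑ blocks (λ P → ∑ P (χ ∘ N))                        ≡⟨ sym (∑-*ˡ blocks 2 _) ⟩
        ∑ blocks (λ P → 2 * ∑ P (χ ∘ N))                        ≤⟨ ∑-mono-∈ blocks block ⟩
        ∑ blocks (λ P → length P + 2 * ∑ P (χ ∘ f))             ≡⟨ ∑-+ blocks _ _ ⟩
        ∑ blocks length + ∑ blocks (λ P → 2 * ∑ P (χ ∘ f))      ≡⟨ cong₂ _+_ lens (≡trans (∑-*ˡ blocks 2 _) (cong (2 *_) (sym (∑-concat blocks (χ ∘ f))))) ⟩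
        length C + 2 * ∑ C (χ ∘ f)                              ≤⟨ +-mono-≤ {length C} {n} {2 * ∑ C (χ ∘ f)} (≤-trans (m≤m+n (length C) (length rest)) (≤-reflexive lenC)) (*-monoʳ-≤ 2 (≤-trans (m≤m+n (∑ C (χ ∘ f)) (∑ rest (χ ∘ f))) (≤-reflexive (sym (≡trans (∑-↭ (χ ∘ f) perm) (∑-++ C rest _)))))) ⟩
        n + 2 * # f                                             ∎
        where
        lens : ∑ blocks length ≡ length C
        lens = ≡trans (∑-cong blocks (λ P → sym (≡trans (∑-const P 1) (*-identityʳ _)))) (≡trans (sym (∑-concat blocks (λ _ → 1))) (≡trans (∑-const C 1) (*-identityʳ _)))
      #N≤ : # N ≤ ∑ C (χ ∘ N) + length rest
      #N≤ = begin
        # N                               ≡⟨ ≡trans (∑-↭ (χ ∘ N) perm) (∑-++ C rest _) ⟩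
        ∑ C (χ ∘ N) + ∑ rest (χ ∘ N)      ≤⟨ +-monoʳ-≤ (∑ C (χ ∘ N)) (≤-trans (∑-mono rest (λ x → χ≤1 (N x))) (≤-reflexive (≡trans (∑-const rest 1) (*-identityʳ _)))) ⟩
        ∑ C (χ ∘ N) + length rest         ∎
      r1 : ∀ g n → n + (n + g * n) ≡ (g + 2) * n
      r1 = solve-∀
      r2 : ∀ g a b → 2 * g * (a + b) ≡ g * (2 * a) + 2 * g * b
      r2 = solve-∀
      r3 : ∀ g n f → g * (n + 2 * f) + n ≡ 2 * g * f + (n + g * n)
      r3 = solve-∀
      bound : n ≤ 2 * g * # f
      bound = +-cancelʳ-≤ (n + g * n) _ _ (begin
        n + (n + g * n)                                   ≡⟨ r1 g n ⟩
        (g + 2) * n                                       ≤⟨ codegree c us u l ⟩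
        2 * g * # N                                       ≤⟨ *-monoʳ-≤ (2 * g) #N≤ ⟩
        2 * g * (∑ C (χ ∘ N) + length rest)               ≡⟨ r2 g (∑ C (χ ∘ N)) (length rest) ⟩
        g * (2 * ∑ C (χ ∘ N)) + 2 * g * length rest       ≤⟨ +-mono-≤ (*-monoʳ-≤ g inC) few ⟩
        g * (n + 2 * # f) + n                             ≡⟨ r3 g n (# f) ⟩
        2 * g * # f + (n + g * n)                         ∎)

    growC : ℕ → ℕ → ℕ
    growC D M = growDens κ₁ g D M

    -- When |P| < 2M, the 2M + 1 colours outnumber the vertices, so they also suffice when the path
    -- is cut in two.
    record NewPath (Bv Bc P : List V) (M : ℕ) : Set where
      field
        cs xs     : List V
        tight     : TP (AllE cs) xs
        length-xs : length xs ≡ suc (length P)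
        length-cs : length cs ≡ suc (2 * M)
        unique-xs : Unique xs
        unique-cs : Unique cs
        xs-new    : ∀ {x} → x ∈ xs → x ∈ P ⊎ x ∉ Bv
        cs-new    : ∀ {c} → c ∈ cs → c ∉ Bc

    module _ (Bv Bc : List V) where

      Unused : Vec V k → Set
      Unused (c ∷ us) = c ∉ Bc × All (_∉ Bv) (toList us) × Fresh [] us

      Rich : List V → Vec V k → Set
      Rich P (c ∷ us) = length P ≤ 2 * degreeIn c (toList us) P

      EV : V → Vec V k → Set
      EV p (c ∷ us) = E c (p ∷ toList us)

      EV? : ∀ p τ → Dec (EV p τ)
      EV? p (c ∷ us) = E? c (p ∷ toList us)

      Attached : (P P′ : List V) → Vec V k → Set
      Attached P P′ τ = (Unused τ × Rich P τ) × filter (λ p → EV? p τ) P ≡ P′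

      -- Exchanging the quantifiers fixes a block that is rich for many unused tuples.
      rich-block : ∀ {blocks rest D u} → 1 ≤ n →
        allFin n ↭ concat blocks ++ rest → 2 * g * length rest ≤ n →
        length Bv + u ≤ n → length Bc + u ≤ n → n ≤ D * u → 2 * D * κ ≤ n →
        Σ (List V) λ P → P ∈ blocks × Unique P × NM (pushC k (2 * D + 2 * g)) k (λ τ → Unused τ × Rich P τ)
      rich-block {blocks} {rest} {D} {u} 1≤n perm few leV leC big₁ big₂ = fix (Many-exists 1≤n (NM-push k (NM-map withX base)))
        where
        d₁ = 2 * D + 2 * g
        base : NM d₁ k Unused
        base = nm (Many-map (λ c c∉ → NM-map (λ us p → c∉ , p) (NM-weaken (m≤m+n (2 * D) (2 * g)) (NM-fresh {d = D} [] big₂ (NM-dup κ (Many-outside Bv leV big₁)))))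
          (Many-weaken (≤-trans (m≤m+n D _) (m≤m+n (2 * D) (2 * g))) (Many-outside Bc leC big₁)))
        RichAt : V → Vec V k → Set
        RichAt x τ = Unused τ × Σ (List V) λ P → P ∈ blocks × x ∈ P × Rich P τ
        withX : ∀ τ → Unused τ → Many d₁ (λ x → RichAt x τ)
        withX (c ∷ us) b@(_ , _ , fr) = Many-map (λ x p → b , p) (Many-weaken (m≤n+m (2 * g) (2 * D))
          (many-in-rich-blocks perm few c (Fresh-unique us fr) (length-toList us)))
        uC : Unique (concat blocks)
        uC = Unique-++ˡ _ (Unique-↭ perm (Uniqueₚ.allFin⁺ n))
        -- One tuple names a block containing x. The blocks are disjoint, so the rich block of every
        -- other tuple at x is the same.
        fix₂ : ∀ {x d} → NM d k (RichAt x) → ∃ (RichAt x) → Σ (List V) λ P → P ∈ blocks × Unique P × NM d k (λ τ → Unused τ × Rich P τ)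
        fix₂ r (_ , _ , P , P∈ , x∈P , _) = P , P∈ , Unique-block P∈ uC ,
          NM-map (λ τ (b , P′ , P′∈ , x∈ , r) → b , subst (λ z → Rich z τ) (block-unique uC P′∈ P∈ x∈ x∈P) r) r
        fix : ∀ {d} → (∃ λ x → NM d k (RichAt x)) → Σ (List V) λ P → P ∈ blocks × Unique P × NM d k (λ τ → Unused τ × Rich P τ)
        fix (x , r) = fix₂ r (NM-exists 1≤n r)

      Blown : ∀ t → (P P′ : List V) → Vec V (k * t) → Set
      Blown t P P′ zs = Σ (Vec (Vec V t) k) λ Cs → zs ≡ Vec.concat Cs × (∀ τ → Selection (toList τ) (toList Cs) → Attached P P′ τ)

      -- Since k ≥ 3, a path using at least half of P and one vertex in k from it beats P.
      weave-block : ∀ {M P P′} → 1 ≤ κ₁ → 2 ≤ length P → length P < 2 * M → Unique P → ∃ (Attached P P′) →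
        (∃ λ (zs : Vec V (k * suc (2 * M))) → Blown (suc (2 * M)) P P′ zs × Fresh P zs) → NewPath Bv Bc P M
      weave-block {M} {P} {P′} 1≤κ₁ 2≤P P<2M uP (c₀ ∷ us₀ , (_ , rich₀) , eq₀) (_ , (Cc ∷ Uv , ≡refl , sel) , fr) = record
        { cs = toList Cc ; xs = take (suc (length P)) W
        ; tight = TP-take (suc (length P)) W tpW
        ; length-xs = ≡trans (length-take (suc (length P)) W) (m≤n⇒m⊓n≡m long)
        ; length-cs = length-toList Cc
        ; unique-xs = Uniqueₚ.take⁺ (suc (length P)) uW
        ; unique-cs = Unique-++ˡ (toList Cc) uAll
        ; xs-new = λ {y} y∈ → newx (W⊆ (take-∈ (suc (length P)) W y∈))
        ; cs-new = λ c∈ → proj₁ (proj₁ (proj₁ (final c∈ sel₀)))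
        }
        where
        P₀? : ∀ p → Dec (E c₀ (p ∷ toList us₀))
        P₀? p = E? c₀ (p ∷ toList us₀)
        half : length P ≤ 2 * length P′
        half = ≤-trans rich₀ (≤-reflexive (cong (2 *_) (≡trans (sym (length-filter-∑ P₀? P)) (cong length eq₀))))
        P′⊆P : ∀ {p} → p ∈ P′ → p ∈ P
        P′⊆P p∈ = proj₁ (∈-filter⁻ P₀? {xs = P} (subst (_ ∈_) (sym eq₀) p∈))
        uP′ : Unique P′
        uP′ = subst Unique eq₀ (Uniqueₚ.filter⁺ P₀? uP)
        P′≤P : length P′ ≤ length P
        P′≤P = ≤-trans (≤-reflexive (cong length (sym eq₀))) (length-filter P₀? P)
        t₀ = suc (2 * M)
        Us : List (Vec V t₀)
        Us = toList Uv
        lU : length Us ≡ κ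
        lU = length-toList Uv
        sel₀ : Selection (heads Us) Us
        sel₀ = heads-selection Within-refl
        FinalL : V → List V → Set
        FinalL c us = ((c ∉ Bc × All (_∉ Bv) us) × length P ≤ 2 * degreeIn c us P) × filter (λ p → E? c (p ∷ us)) P ≡ P′
        final : ∀ {c us} → c ∈ toList Cc → Selection us Us → FinalL c us
        final {c} {us} c∈ s with fromList-length us (≡trans (Pw.Pointwise-length s) lU)
        ... | v , ≡refl = let ((a , b , _) , r) , eq = sel (c ∷ v) (c∈ ∷ s) in ((a , b) , r) , eq
        edges : ∀ {c us p} → c ∈ toList Cc → Selection us Us → p ∈ P′ → E c (us ++ p ∷ [])
        edges {c} {us} {p} c∈ s p∈ = E-snoc (proj₂ (∈-filter⁻ (λ p → E? c (p ∷ us)) {xs = P} (subst (p ∈_) (sym (proj₂ (final c∈ s))) p∈)))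
        uAll : Unique (toList Cc ++ flat Us)
        uAll = subst Unique (toList-concat (Cc ∷ Uv)) (Fresh-unique (Vec.concat (Cc ∷ Uv)) fr)
        uPU : Unique (P′ ++ flat Us)
        uPU = Unique-++ uP′ (Unique-++ʳ (toList Cc) uAll)
          (λ p∈ q∈ → Fresh-∉ (Vec.concat (Cc ∷ Uv)) fr (subst (_ ∈_) (sym (toList-concat (Cc ∷ Uv))) (∈-++⁺ʳ (toList Cc) q∈)) (P′⊆P p∈))
        woven : ∀ {t s} → t ≡ length P′ + s → (Us : List (Vec V t)) → length Us ≡ κ →
          (∀ {c us p} → c ∈ toList Cc → Selection us Us → p ∈ P′ → E c (us ++ p ∷ [])) → Unique (P′ ++ flat Us) →
          Σ (List V) λ W → TP (AllE (toList Cc)) W × Unique W × length W ≡ length P′ * k × (∀ {x} → x ∈ W → x ∈ P′ ++ flat Us)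
        woven {s = s} ≡refl Us l e u = weave P′ {s} Us , weave-TP (toList Cc) P′ Us l e P′ {s} Us id Within-refl , weave-unique P′ {s} Us u , weave-length P′ {s} Us l , weave-∈ P′ {s} Us
        -- Each vertex of P′ uses up one copy per class, and |P′| ≤ |P| < 2M + 1 leaves enough.
        thing = woven {s = t₀ ∸ length P′} (sym (m+[n∸m]≡n (≤-trans P′≤P (m≤n⇒m≤1+n (<⇒≤ P<2M))))) Us lU edges uPU
        W : List V
        W = proj₁ thing
        tpW : TP (AllE (toList Cc)) W
        tpW = proj₁ (proj₂ thing)
        uW : Unique W
        uW = proj₁ (proj₂ (proj₂ thing))
        lW : length W ≡ length P′ * k
        lW = proj₁ (proj₂ (proj₂ (proj₂ thing)))
        W⊆ : ∀ {x} → x ∈ W → x ∈ P′ ++ flat Us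
        W⊆ = proj₂ (proj₂ (proj₂ (proj₂ thing)))
        long : suc (length P) ≤ length W
        long = ≤-trans (arith (length P) (length P′) half 2≤P)
                 (≤-trans (*-monoʳ-≤ (length P′) (s≤s (s≤s 1≤κ₁))) (≤-reflexive (sym lW)))
          where
          arith : ∀ q r → q ≤ 2 * r → 2 ≤ q → suc q ≤ r * 3
          arith q zero    h 2≤q = contradiction (≤-trans 2≤q h) λ ()
          arith q (suc r) h 2≤q = ≤-trans (s≤s h) (≤-trans (m≤m+n _ r) (≤-reflexive (eq r)))
            where
            eq : ∀ r → suc (2 * suc r) + r ≡ suc r * 3
            eq = solve-∀
        head∈ : ∀ {m} (C : Vec V (suc m)) → Vec.head C ∈ toList C
        head∈ (_ ∷ _) = here ≡refl
        newx : ∀ {y} → y ∈ P′ ++ flat Us → y ∈ P ⊎ y ∉ Bv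
        newx y∈ with ∈-++⁻ P′ y∈
        ... | inj₁ p = inj₁ (P′⊆P p)
        ... | inj₂ p = let us , s , q = selection-through sel₀ p in inj₂ (All.lookup (proj₂ (proj₁ (proj₁ (final (head∈ Cc) s)))) q)

      new-path : ∀ {blocks rest D u M} → 1 ≤ κ₁ → 1 ≤ n → 2 ≤ M →
        allFin n ↭ concat blocks ++ rest → 2 * g * length rest ≤ n →
        (∀ {P} → P ∈ blocks → M ≤ length P × length P < 2 * M) →
        length Bv + u ≤ n → length Bc + u ≤ n → n ≤ D * u → 2 * D * κ ≤ n →
        2 * growC D M * (2 * M + k * suc (2 * M)) ≤ n →
        Σ (List V) λ P → P ∈ blocks × NewPath Bv Bc P M
      new-path {blocks} {rest} {D} {u} {M} 1≤κ₁ 1≤n 2≤M perm few sizes leV leC big₁ big₂ big₃ =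
        step (rich-block {D = D} 1≤n perm few leV leC big₁ big₂)
        where
        step : (Σ (List V) λ P → P ∈ blocks × Unique P × NM (pushC k (2 * D + 2 * g)) k (λ τ → Unused τ × Rich P τ)) →
               Σ (List V) λ P → P ∈ blocks × NewPath Bv Bc P M
        step (P , P∈ , uP , r) = P , P∈ , step₂ (NM-decide EV? P r)
          where
          step₂ : (Σ (List V) λ P′ → NM (2 ^ length P * pushC k (2 * D + 2 * g)) k (Attached P P′)) → NewPath Bv Bc P M
          step₂ (P′ , r′) = weave-block {M} {P} {P′} 1≤κ₁ (≤-trans 2≤M (proj₁ (sizes P∈))) (proj₂ (sizes P∈)) uP (NM-exists 1≤n r′)
            (NM-exists 1≤n (NM-fresh P (≤-trans (*-monoʳ-≤ (2 * growC D M) (+-monoˡ-≤ (k * suc (2 * M)) (<⇒≤ (proj₂ (sizes P∈))))) big₃)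
              (NMC-flat k (NM-blowup (suc (2 * M)) k (NM-weaken (*-monoˡ-≤ (pushC k (2 * D + 2 * g)) (^-monoʳ-≤ 2 (<⇒≤ (proj₂ (sizes P∈))))) r′)))))

  -- Almost covering the vertices by rainbow paths.

  concat-map-++ : ∀ (f : A → List B) xs ys → concat (map f (xs ++ ys)) ≡ concat (map f xs) ++ concat (map f ys)
  concat-map-++ f xs ys = ≡trans (cong concat (map-++ f xs ys)) (sym (concat-++ (map f xs) (map f ys)))

  module PathCover {n κ₁ g : ℕ} (𝓗 : System n κ₁ g) where
    open Covering 𝓗 public

    VC : Set
    VC = List V × List V

    vsOf csOf : List VC → List V
    vsOf ps = concat (map proj₁ ps)
    csOf ps = concat (map proj₂ ps)

    -- The lower bound keeps the number of connections small; the upper bound keeps the constants of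
    -- the blow-up independent of n.
    record RainbowPath (M : ℕ) (p : VC) : Set where
      constructor rainbow
      field
        rp  : RP (proj₁ p) (proj₂ p)
        len : length (proj₁ p) ≡ length (proj₂ p) + κ
        lo  : M ≤ length (proj₁ p)
        hi  : length (proj₁ p) < 2 * M

    record Cover (M : ℕ) (BV BC : List V) : Set where
      constructor covering
      field
        ps : List VC
        all-paths : All (RainbowPath M) ps
        unique-v  : Unique (BV ++ vsOf ps)
        unique-c  : Unique (BC ++ csOf ps)

      covered : ℕ
      covered = length (vsOf ps)
    open Cover public

    csOf≤vsOf : ∀ {M ps} → All (RainbowPath M) ps → length (csOf ps) ≤ length (vsOf ps)
    csOf≤vsOf [] = z≤n
    csOf≤vsOf {ps = (xs , cs) ∷ ps} (r ∷ rs) = begin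
      length (cs ++ csOf ps)           ≡⟨ length-++ cs ⟩
      length cs + length (csOf ps)     ≤⟨ +-mono-≤ (≤-trans (m≤m+n _ κ) (≤-reflexive (sym (RainbowPath.len r)))) (csOf≤vsOf rs) ⟩
      length xs + length (vsOf ps)     ≡⟨ sym (length-++ xs) ⟩
      length (xs ++ vsOf ps)           ∎
      where open ≤-Reasoning

    -- The new path is cut in two when it has become too long.
    cut-new-path : ∀ {M Bv Bc P} → κ ≤ M → M ≤ length P → length P < 2 * M → (N : NewPath Bv Bc P M) →
      Σ (List VC) λ ns → All (RainbowPath M) ns × vsOf ns ≡ NewPath.xs N × Unique (csOf ns) × (∀ {c} → c ∈ csOf ns → c ∈ NewPath.cs N)
    cut-new-path {M} {Bv} {Bc} {P} κ≤M M≤P P<2M N = go (suc (length P) <? 2 * M)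
      where
      open NewPath N
      goal : Set
      goal = Σ (List VC) λ ns → All (RainbowPath M) ns × vsOf ns ≡ xs × Unique (csOf ns) × (∀ {c} → c ∈ csOf ns → c ∈ cs)
      toRP : ∀ {ys ds} → TP (AllE cs) ys → (∀ {c} → c ∈ ds → c ∈ cs) → length ys ≡ length ds + κ → RP ys ds
      toRP {ys} {ds} tp h eq = TP⇒RP ys ds tp (All.tabulate (λ c∈ w → w (h c∈))) (≤-reflexive (sym eq))
      go : Dec (suc (length P) < 2 * M) → goal
      go (yes lt) = (xs , ds) ∷ []
        , rainbow (toRP tight (take-∈ a cs) len) len (≤-trans M≤P (≤-trans (n≤1+n _) (≤-reflexive (sym length-xs)))) (≤-trans (s≤s (≤-reflexive length-xs)) lt) ∷ []
        , ++-identityʳ xs , subst Unique (sym (++-identityʳ ds)) (Uniqueₚ.take⁺ a unique-cs)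
        , λ c∈ → take-∈ a cs (subst (_ ∈_) (++-identityʳ ds) c∈)
        where
        a = suc (length P) ∸ κ
        ds = take a cs
        κ≤ : κ ≤ suc (length P)
        κ≤ = ≤-trans κ≤M (≤-trans M≤P (n≤1+n _))
        ld : length ds ≡ a
        ld = ≡trans (length-take a cs) (m≤n⇒m⊓n≡m (≤-trans (m∸n≤m (suc (length P)) κ) (≤-trans (<⇒≤ lt) (≤-trans (n≤1+n _) (≤-reflexive (sym length-cs))))))
        len : length xs ≡ length ds + κ
        len = ≡trans length-xs (≡trans (sym (m∸n+n≡m κ≤)) (cong (_+ κ) (sym ld)))
      go (no ¬lt) = (ys₁ , ds₁) ∷ (ys₂ , ds₂) ∷ []
        , rainbow (toRP (TP-take M xs tight) (take-∈ a cs) (≡trans ly₁ M≡₁)) (≡trans ly₁ M≡₁) (≤-reflexive (sym ly₁)) (≤-trans (s≤s (≤-reflexive ly₁)) M<2M)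
          ∷ rainbow (toRP (TP-drop M xs tight) (λ c∈ → drop-∈ a cs (take-∈ a (drop a cs) c∈)) (≡trans ly₂ M≡₂)) (≡trans ly₂ M≡₂) (≤-reflexive (sym ly₂)) (≤-trans (s≤s (≤-reflexive ly₂)) M<2M) ∷ []
        , ≡trans (cong (ys₁ ++_) (++-identityʳ ys₂)) (take++drop≡id M xs)
        , subst Unique (cong (ds₁ ++_) (sym (++-identityʳ ds₂))) (Unique-++ (Uniqueₚ.take⁺ a unique-cs) (Uniqueₚ.take⁺ a (Uniqueₚ.drop⁺ a unique-cs))
            (λ p q → Unique-disjoint ds₁ (subst Unique (sym (take++drop≡id a cs)) unique-cs) p (take-∈ a (drop a cs) q)))
        , λ c∈ → back (subst (_ ∈_) (cong (ds₁ ++_) (++-identityʳ ds₂)) c∈)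
        where
        q≡ : suc (length P) ≡ 2 * M
        q≡ = ≤-antisym P<2M (≮⇒≥ ¬lt)
        a = M ∸ κ
        ys₁ = take M xs
        ys₂ = drop M xs
        ds₁ = take a cs
        ds₂ = take a (drop a cs)
        1≤M : 1 ≤ M
        1≤M = ≤-trans (s≤s z≤n) κ≤M
        M<2M : M < 2 * M
        M<2M = ≤-trans (+-monoˡ-≤ M 1≤M) (≤-reflexive (cong (M +_) (sym (+-identityʳ M))))
        lxs : length xs ≡ 2 * M
        lxs = ≡trans length-xs q≡
        ly₁ : length ys₁ ≡ M
        ly₁ = ≡trans (length-take M xs) (m≤n⇒m⊓n≡m (≤-trans (<⇒≤ M<2M) (≤-reflexive (sym lxs))))
        ly₂ : length ys₂ ≡ M
        ly₂ = ≡trans (length-drop M xs) (≡trans (cong (_∸ M) (≡trans lxs (cong (M +_) (+-identityʳ M)))) (m+n∸n≡m M M))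
        a≤M : a ≤ M
        a≤M = m∸n≤m M κ
        l₁ : length ds₁ ≡ a
        l₁ = ≡trans (length-take a cs) (m≤n⇒m⊓n≡m (≤-trans a≤M (≤-trans (<⇒≤ M<2M) (≤-trans (n≤1+n _) (≤-reflexive (sym length-cs))))))
        l₂ : length ds₂ ≡ a
        l₂ = ≡trans (length-take a (drop a cs)) (m≤n⇒m⊓n≡m (≤-trans (≤-trans (≤-reflexive (sym (m+n∸m≡n a a)))
               (∸-monoˡ-≤ a (≤-trans (+-mono-≤ a≤M a≤M) (≤-trans (≤-reflexive (cong (M +_) (sym (+-identityʳ M)))) (≤-trans (n≤1+n _) (≤-reflexive (sym length-cs))))))) (≤-reflexive (sym (length-drop a cs)))))
        M≡₁ : M ≡ length ds₁ + κ
        M≡₁ = ≡trans (sym (m∸n+n≡m κ≤M)) (cong (_+ κ) (sym l₁))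
        M≡₂ : M ≡ length ds₂ + κ
        M≡₂ = ≡trans (sym (m∸n+n≡m κ≤M)) (cong (_+ κ) (sym l₂))
        back : ∀ {c} → c ∈ ds₁ ++ ds₂ → c ∈ cs
        back c∈ with ∈-++⁻ ds₁ c∈
        ... | inj₁ p = take-∈ a cs p
        ... | inj₂ p = drop-∈ a cs (take-∈ a (drop a cs) p)

    -- A common interface for both kinds of block: a path is taken out of the cover, a chunk was
    -- never in it. Either way the loss is at most |P| vertices, which the new path exceeds by one.
    record Detached (M : ℕ) (BV BC P : List V) (ps : List VC) : Set where
      field
        qs        : List VC
        all-paths′ : All (RainbowPath M) qs
        unique-v′ : Unique (BV ++ P ++ vsOf qs)
        unique-c′ : Unique (BC ++ csOf qs)
        vs⊆       : ∀ {x} → x ∈ vsOf qs → x ∈ vsOf ps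
        cs⊆       : ∀ {x} → x ∈ csOf qs → x ∈ csOf ps
        bigger    : length (vsOf ps) ≤ length P + length (vsOf qs)

    detach-path : ∀ {M BV BC} (𝓒 : Cover M BV BC) {p} → p ∈ ps 𝓒 → Detached M BV BC (proj₁ p) (ps 𝓒)
    detach-path {M} {BV} {BC} (covering ps all uv uc) {p} p∈ = record
      { qs = qs
      ; all-paths′ = All.tail (All-resp-↭ perm all)
      ; unique-v′ = Unique-↭ (Permₚ.++⁺ˡ BV pv) uv
      ; unique-c′ = Unique-++ (Unique-++ˡ BC uc) (Unique-++ʳ (proj₂ p) (Unique-↭ pc (Unique-++ʳ BC uc)))
          (λ a b → Unique-disjoint BC uc a (∈-resp-↭ (↭-sym pc) (∈-++⁺ʳ (proj₂ p) b)))
      ; vs⊆ = λ x∈ → ∈-resp-↭ (↭-sym pv) (∈-++⁺ʳ (proj₁ p) x∈)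
      ; cs⊆ = λ x∈ → ∈-resp-↭ (↭-sym pc) (∈-++⁺ʳ (proj₂ p) x∈)
      ; bigger = ≤-reflexive (≡trans (↭-length pv) (length-++ (proj₁ p)))
      }
      where
      qs = proj₁ (∈-extract p∈)
      perm : ps ↭ p ∷ qs
      perm = proj₂ (∈-extract p∈)
      pv : vsOf ps ↭ proj₁ p ++ vsOf qs
      pv = concat-map-↭ proj₁ perm
      pc : csOf ps ↭ proj₂ p ++ csOf qs
      pc = concat-map-↭ proj₂ perm

    detach-chunk : ∀ {M BV BC} (𝓒 : Cover M BV BC) {P} → Unique P → (∀ {x} → x ∈ P → x ∉ BV ++ vsOf (ps 𝓒)) → Detached M BV BC P (ps 𝓒)
    detach-chunk {M} {BV} {BC} (covering ps all uv uc) {P} uP out = record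
      { qs = ps
      ; all-paths′ = all
      ; unique-v′ = Unique-↭ (Permₚ.shifts P BV) (Unique-++ uP uv out)
      ; unique-c′ = uc
      ; vs⊆ = id
      ; cs⊆ = id
      ; bigger = m≤n+m _ (length P)
      }

    attach : ∀ {M BV BC P} (𝓒 : Cover M BV BC) → κ ≤ M → M ≤ length P → length P < 2 * M → Detached M BV BC P (ps 𝓒) →
             NewPath (BV ++ vsOf (ps 𝓒)) (BC ++ csOf (ps 𝓒)) P M → Σ (Cover M BV BC) λ 𝓒′ → covered 𝓒 < covered 𝓒′
    attach {M} {BV} {BC} {P} 𝓒 κ≤M M≤P P<2M Δ N = go (cut-new-path κ≤M M≤P P<2M N)
      where
      open NewPath N
      open Detached Δ
      go : (Σ (List VC) λ ns → All (RainbowPath M) ns × vsOf ns ≡ xs × Unique (csOf ns) × (∀ {c} → c ∈ csOf ns → c ∈ cs)) →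
           Σ (Cover M BV BC) λ 𝓒′ → covered 𝓒 < covered 𝓒′
      go (ns , good , vs≡ , ucs , cs∈) = covering (ns ++ qs) (Allₚ.++⁺ good all-paths′)
          (subst (λ z → Unique (BV ++ z)) (sym vs-eq) (Unique-++ (Unique-++ˡ BV unique-v′)
            (Unique-++ unique-xs (Unique-++ʳ P (Unique-++ʳ BV unique-v′)) xs∉qs) BV∉))
          (subst (λ z → Unique (BC ++ z)) (sym (concat-map-++ proj₂ ns qs)) (Unique-++ (Unique-++ˡ BC unique-c′)
            (Unique-++ ucs (Unique-++ʳ BC unique-c′) (λ c∈ q∈ → cs-new (cs∈ c∈) (∈-++⁺ʳ BC (cs⊆ q∈)))) BC∉))
        , (begin-strict
          length (vsOf (ps 𝓒))                ≤⟨ bigger ⟩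
          length P + length (vsOf qs)         <⟨ ≤-reflexive (cong (_+ length (vsOf qs)) (sym length-xs)) ⟩
          length xs + length (vsOf qs)        ≡⟨ sym (length-++ xs) ⟩
          length (xs ++ vsOf qs)              ≡⟨ cong length (sym vs-eq) ⟩
          length (vsOf (ns ++ qs))            ∎)
        where
        open ≤-Reasoning
        vs-eq : vsOf (ns ++ qs) ≡ xs ++ vsOf qs
        vs-eq = ≡trans (concat-map-++ proj₁ ns qs) (cong (_++ vsOf qs) vs≡)
        xs∉qs : ∀ {x} → x ∈ xs → x ∉ vsOf qs
        xs∉qs x∈ q∈ with xs-new x∈
        ... | inj₁ p = Unique-disjoint P (Unique-++ʳ BV unique-v′) p q∈
        ... | inj₂ p = p (∈-++⁺ʳ BV (vs⊆ q∈))
        BV∉ : ∀ {x} → x ∈ BV → x ∉ xs ++ vsOf qs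
        BV∉ x∈ y∈ with ∈-++⁻ xs y∈
        ... | inj₂ q = Unique-disjoint BV unique-v′ x∈ (∈-++⁺ʳ P q)
        ... | inj₁ q with xs-new q
        ...   | inj₁ p = Unique-disjoint BV unique-v′ x∈ (∈-++⁺ˡ p)
        ...   | inj₂ p = p (∈-++⁺ˡ x∈)
        BC∉ : ∀ {x} → x ∈ BC → x ∉ csOf ns ++ csOf qs
        BC∉ x∈ y∈ with ∈-++⁻ (csOf ns) y∈
        ... | inj₁ q = cs-new (cs∈ q) (∈-++⁺ˡ x∈)
        ... | inj₂ q = Unique-disjoint BC unique-c′ x∈ q

    module _ {BV BC : List V} {D u M : ℕ} (1≤κ₁ : 1 ≤ κ₁) (1≤n : 1 ≤ n) (2≤M : 2 ≤ M) (κ≤M : κ ≤ M)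
             (BC≤BV : length BC ≤ length BV) (small : 2 * g * (length BV + M) ≤ n) (big₁ : n ≤ D * u) (big₂ : 2 * D * κ ≤ n)
             (big₃ : 2 * growC D M * (2 * M + k * suc (2 * M)) ≤ n) where

      grow : (𝓒 : Cover M BV BC) → length BV + covered 𝓒 + u ≤ n → Σ (Cover M BV BC) λ 𝓒′ → covered 𝓒 < covered 𝓒′
      grow 𝓒@(covering ps all uv uc) room = go (complement uv)
        where
        Bv = BV ++ vsOf ps
        Bc = BC ++ csOf ps
        leV : length Bv + u ≤ n
        leV = ≤-trans (≤-reflexive (cong (_+ u) (length-++ BV))) room
        leC : length Bc + u ≤ n
        -- A path has no more colours than vertices, so room for vertices implies room for colours.
        leC = ≤-trans (+-monoˡ-≤ u (≤-trans (≤-reflexive (length-++ BC)) (+-mono-≤ BC≤BV (csOf≤vsOf all)))) room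
        go : (Σ (List V) λ U → allFin n ↭ Bv ++ U) → Σ (Cover M BV BC) λ 𝓒′ → covered 𝓒 < covered 𝓒′
        go (U , perm) = go₂ (chunks M (≤-trans (s≤s z≤n) 2≤M) U)
          where
          uU : Unique (Bv ++ U)
          uU = Unique-↭ perm (Uniqueₚ.allFin⁺ n)
          go₂ : (Σ (List (List V)) λ cks → Σ (List V) λ rest → U ≡ concat cks ++ rest × All (λ P → length P ≡ M) cks × length rest < M) →
                Σ (Cover M BV BC) λ 𝓒′ → covered 𝓒 < covered 𝓒′
          go₂ (cks , rest , ≡refl , lens , lt) = finish (new-path Bv Bc {D = D} 1≤κ₁ 1≤n 2≤M perm′ few sizes leV leC big₁ big₂ big₃)
            where
            blocks = map proj₁ ps ++ cks
            perm′ : allFin n ↭ concat blocks ++ (BV ++ rest)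
            perm′ = trans perm (trans (↭-reflexive (++-assoc BV (vsOf ps) _)) (trans (Permₚ.++⁺ˡ BV (↭-reflexive (≡trans (sym (++-assoc (vsOf ps) (concat cks) rest)) (cong (_++ rest) (concat-++ (map proj₁ ps) cks)))))
              (Permₚ.shifts BV (concat blocks))))
            few : 2 * g * length (BV ++ rest) ≤ n
            few = ≤-trans (*-monoʳ-≤ (2 * g) (≤-trans (≤-reflexive (length-++ BV)) (+-monoʳ-≤ (length BV) (<⇒≤ lt)))) small
            sizes : ∀ {P} → P ∈ blocks → M ≤ length P × length P < 2 * M
            sizes P∈ with ∈-++⁻ (map proj₁ ps) P∈
            ... | inj₂ q = let eq = All.lookup lens q in ≤-reflexive (sym eq) , ≤-trans (s≤s (≤-reflexive eq)) (≤-trans (+-monoˡ-≤ M (≤-trans (s≤s z≤n) 2≤M)) (≤-reflexive (cong (M +_) (sym (+-identityʳ M)))))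
            ... | inj₁ q with ∈-map⁻ proj₁ q
            ...   | p , p∈ , ≡refl = let r = All.lookup all p∈ in RainbowPath.lo r , RainbowPath.hi r
            detached : ∀ {P} → P ∈ blocks → Detached M BV BC P ps
            detached P∈ with ∈-++⁻ (map proj₁ ps) P∈
            ... | inj₂ q = detach-chunk 𝓒 (Unique-block q (Unique-++ˡ (concat cks) (Unique-++ʳ Bv uU)))
                             (λ x∈ y∈ → Unique-disjoint Bv uU y∈ (∈-++⁺ˡ (∈-concat x∈ q)))
            ... | inj₁ q with ∈-map⁻ proj₁ q
            ...   | p , p∈ , ≡refl = detach-path 𝓒 p∈
            finish : (Σ (List V) λ P → P ∈ blocks × NewPath Bv Bc P M) → Σ (Cover M BV BC) λ 𝓒′ → covered 𝓒 < covered 𝓒′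
            finish (P , P∈ , N) = attach 𝓒 κ≤M (proj₁ (sizes P∈)) (proj₂ (sizes P∈)) (detached P∈) N

      -- Growth covers at least one new vertex each time, so it must fail within n steps, and it
      -- fails only when fewer than u vertices are left.
      almost-cover : Unique BV → Unique BC → Σ (Cover M BV BC) λ 𝓒 → n < length BV + covered 𝓒 + u
      almost-cover uBV uBC = go n (covering [] [] (subst Unique (sym (++-identityʳ BV)) uBV) (subst Unique (sym (++-identityʳ BC)) uBC)) (m≤n+m n 0)
        where
        1≤u : 1 ≤ u
        1≤u = n≢0⇒n>0 (λ { ≡refl → contradiction (≤-trans 1≤n (≤-trans big₁ (≤-reflexive (*-zeroʳ D)))) λ () })
        go : ∀ f (𝓒 : Cover M BV BC) → n ≤ covered 𝓒 + f → Σ (Cover M BV BC) λ 𝓒 → n < length BV + covered 𝓒 + u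
        go f 𝓒 h with length BV + covered 𝓒 + u ≤? n
        ... | no ¬p = 𝓒 , ≰⇒> ¬p
        go zero 𝓒 h | yes p = contradiction (≤-trans (+-monoʳ-≤ (covered 𝓒) 1≤u) (≤-trans (+-monoˡ-≤ u (m≤n+m (covered 𝓒) (length BV))) (≤-trans p h))) (λ q → 1+n≰n (+-cancelˡ-≤ (covered 𝓒) _ _ q))
        go (suc f) 𝓒 h | yes p = let 𝓒′ , lt = grow 𝓒 p in
          go f 𝓒′ (≤-trans h (≤-trans (≤-reflexive (+-suc (covered 𝓒) f)) (+-monoˡ-≤ f lt)))

  Unique-⊆-length : ∀ {xs ys : List A} → Unique xs → (∀ {x} → x ∈ xs → x ∈ ys) → length xs ≤ length ys
  Unique-⊆-length {xs = xs} u h = let zs , p = Unique-⊆-↭ u h in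
    ≤-trans (m≤m+n (length xs) (length zs)) (≤-reflexive (sym (≡trans (↭-length p) (length-++ xs))))

  module _ {A : Set} where
    open CMSolver (Permₚ.++-commutativeMonoid {A = A}) using (solve; _⊜_; _⊕_)

    shuffle₁ : ∀ (l r s t w₁ w₂ w₃ : List A) →
      l ++ (w₁ ++ r ++ (w₂ ++ s ++ w₃)) ++ t ↭ ((l ++ r) ++ w₂) ++ (s ++ w₃ ++ t) ++ w₁
    shuffle₁ = solve 7 (λ l r s t w₁ w₂ w₃ →
      l ⊕ ((w₁ ⊕ (r ⊕ (w₂ ⊕ (s ⊕ w₃)))) ⊕ t) ⊜ ((l ⊕ r) ⊕ w₂) ⊕ ((s ⊕ (w₃ ⊕ t)) ⊕ w₁)) ↭-refl

    shuffle₂ : ∀ (a b c d : List A) → a ++ (b ++ c) ++ d ↭ (a ++ b) ++ (d ++ c)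
    shuffle₂ = solve 4 (λ a b c d → a ⊕ ((b ⊕ c) ⊕ d) ⊜ (a ⊕ b) ⊕ (d ⊕ c)) ↭-refl

    shuffle₃ : ∀ (a b c d e : List A) → (a ++ b) ++ (c ++ (d ++ e)) ↭ (b ++ (c ++ d)) ++ (a ++ e)
    shuffle₃ = solve 5 (λ a b c d e → (a ⊕ b) ⊕ (c ⊕ (d ⊕ e)) ⊜ (b ⊕ (c ⊕ d)) ⊕ (a ⊕ e)) ↭-refl

    shuffle₄ : ∀ (w a p b v x : List A) → w ++ a ++ (p ++ b ++ (v ++ x)) ↭ ((a ++ p ++ b) ++ v) ++ (w ++ x)
    shuffle₄ = solve 6 (λ w a p b v x → w ⊕ (a ⊕ (p ⊕ (b ⊕ (v ⊕ x)))) ⊜ ((a ⊕ (p ⊕ b)) ⊕ v) ⊕ (w ⊕ x)) ↭-refl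

    shuffle₅ : ∀ (w c v x : List A) → w ++ (c ++ (v ++ x)) ↭ (c ++ v) ++ (w ++ x)
    shuffle₅ = solve 4 (λ w c v x → w ⊕ (c ⊕ (v ⊕ x)) ⊜ (c ⊕ v) ⊕ (w ⊕ x)) ↭-refl

    shuffle₆ : ∀ (a b c : List A) → (a ++ b) ++ c ↭ (a ++ c) ++ b
    shuffle₆ = solve 3 (λ a b c → (a ⊕ b) ⊕ c ⊜ (a ⊕ c) ⊕ b) ↭-refl

  -- Chaining the absorbers into one path.

  module Assembly {n κ₁ g : ℕ} (𝓗 : System n κ₁ g) where
    open PathCover 𝓗 public

    -- A bound for the vertices, and likewise for the colours, that one absorber and one connector
    -- contribute.
    X : ℕ
    X = Nₐ + N_c

    τ-split : (τ : Vec V Nₐ) → toList τ ≡ cols τ ++ (left τ ++ right τ)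
    τ-split τ = ≡trans (halves κ τ) (cong (cols τ ++_) (halves κ (Vec.drop κ τ)))
      where
      halves : ∀ a {b} (v : Vec V (a + b)) → toList v ≡ toList (Vec.take a v) ++ toList (Vec.drop a v)
      halves a v = ≡trans (cong toList (sym (Vecₚ.take++drop≡id a v))) (Vecₚ.toList-++ (Vec.take a v) (Vec.drop a v))

    -- Whatever leftover pairs are assigned to the absorbers F, there is a path from S to T
    -- through the fixed vertices bv and colours bc and through exactly these pairs.
    AbsPath : (S T : List V) → List (Vec V Nₐ) → (bv bc : List V) → Set
    AbsPath S T F bv bc = ∀ asg → Pointwise (Serves Absorbs) F asg →
      Σ (List V) λ W → Σ (List V) λ ds → Path S T W ds ×
        (S ++ W ++ T ↭ bv ++ map proj₁ (List.catMaybes asg)) × (ds ↭ bc ++ map proj₂ (List.catMaybes asg))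

    absorber-path : ∀ {τ} → ∃ (λ q → Absorbs q τ) → AbsPath (left τ) (right τ) (τ ∷ []) (left τ ++ right τ) (cols τ)
    absorber-path {τ} (_ , p , _) (nothing ∷ [])      (_ ∷ []) = [] , cols τ , p , ↭-reflexive (sym (++-identityʳ _)) , ↭-reflexive (sym (++-identityʳ _))
    absorber-path {τ} _           (just (v , c) ∷ []) ((_ , p) ∷ []) =
      v ∷ [] , c ∷ cols τ , p , trans (Permₚ.shift v (left τ) (right τ)) (++-comm (v ∷ []) (left τ ++ right τ)) , ++-comm (c ∷ []) (cols τ)

    -- Absorbing is local: with or without its pair, τ runs from `left τ` to `right τ`, so the
    -- connector and the remaining chain are unaffected by the choice.
    AbsPath-cons : ∀ {τ F S T bv bc W ds} → ∃ (λ q → Absorbs q τ) → Path (right τ) S W ds → AbsPath S T F bv bc →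
      AbsPath (left τ) T (τ ∷ F) (((left τ ++ right τ) ++ W) ++ bv) (cols τ ++ (ds ++ bc))
    AbsPath-cons {τ} {F} {S} {T} {bv} {bc} {W} {ds} (_ , base , _) conn rest (q ∷ asg) (s ∷ ss) with rest asg ss
    ... | W′ , ds′ , p′ , pv , pc = go q s
      where
      vs′ = map proj₁ (List.catMaybes asg)
      cs′ = map proj₂ (List.catMaybes asg)
      perm-v : ∀ w → left τ ++ (w ++ right τ ++ (W ++ S ++ W′)) ++ T ↭ (((left τ ++ right τ) ++ W) ++ bv) ++ (w ++ vs′)
      perm-v w = trans (shuffle₁ (left τ) (right τ) S T w W W′)
        (trans (Permₚ.++⁺ˡ ((left τ ++ right τ) ++ W) (Permₚ.++⁺ʳ w pv)) (shuffle₂ ((left τ ++ right τ) ++ W) bv vs′ w))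
      perm-c : ∀ c → (c ++ cols τ) ++ (ds ++ ds′) ↭ (cols τ ++ (ds ++ bc)) ++ (c ++ cs′)
      perm-c c = trans (Permₚ.++⁺ˡ (c ++ cols τ) (Permₚ.++⁺ˡ ds pc)) (shuffle₃ c (cols τ) ds bc cs′)
      go : ∀ q → Serves Absorbs τ q → Σ (List V) λ W″ → Σ (List V) λ ds″ → Path (left τ) T W″ ds″ ×
        (left τ ++ W″ ++ T ↭ (((left τ ++ right τ) ++ W) ++ bv) ++ map proj₁ (List.catMaybes (q ∷ asg))) ×
        (ds″ ↭ (cols τ ++ (ds ++ bc)) ++ map proj₂ (List.catMaybes (q ∷ asg)))
      go nothing        _       = _ , _ , Path-compose base (Path-compose conn p′) , perm-v [] , perm-c []
      go (just (v , c)) (_ , p) = _ , _ , Path-compose p (Path-compose conn p′) , perm-v (v ∷ []) , perm-c (c ∷ [])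

    -- In the recursion of `link`, G holds the absorbers that will be prepended later; the chain
    -- built so far has to stay clear of them.
    record Absorbing (G : List V) (F : List (Vec V Nₐ)) : Set where
      field
        S T bv bc : List V
        absorb : AbsPath S T F bv bc
        uS  : Unique S
        lS  : length S ≡ κ
        uT  : Unique T
        lT  : length T ≡ κ
        ubv : Unique bv
        ubc : Unique bc
        bv∉ : ∀ {x} → x ∈ bv → x ∉ G
        bc∉ : ∀ {x} → x ∈ bc → x ∉ G
        len-bv : length bv ≤ length F * X
        len-bc : length bc ≤ length F * X

    link : ∀ G τ F → 1 ≤ n → FreshFam G (τ ∷ F) → All (λ τ → ∃ λ q → Absorbs q τ) (τ ∷ F) →
           2 * d_c * (length G + length (τ ∷ F) * (2 * X)) ≤ n → Absorbing G (τ ∷ F)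
    link G τ [] 1≤n (fr , _) (a@(_ , path lS lT _ _ , _) ∷ []) room = record
      { S = left τ ; T = right τ ; bv = left τ ++ right τ ; bc = cols τ
      ; absorb = absorber-path {τ} a
      ; uS = Unique-++ˡ (left τ) uLR ; lS = lS ; uT = Unique-++ʳ (left τ) uLR ; lT = lT
      ; ubv = uLR ; ubc = Unique-++ˡ (cols τ) uτ
      ; bv∉ = λ x∈ → Fresh-∉ τ fr (subst (_ ∈_) (sym (τ-split τ)) (∈-++⁺ʳ (cols τ) x∈))
      ; bc∉ = λ x∈ → Fresh-∉ τ fr (subst (_ ∈_) (sym (τ-split τ)) (∈-++⁺ˡ x∈))
      ; len-bv = ≤-trans (≤-trans (m≤n+m _ (length (cols τ))) (≤-reflexive lenτ)) (≤-trans (m≤m+n Nₐ N_c) (≤-reflexive (sym (+-identityʳ X))))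
      ; len-bc = ≤-trans (≤-trans (m≤m+n (length (cols τ)) _) (≤-reflexive lenτ)) (≤-trans (m≤m+n Nₐ N_c) (≤-reflexive (sym (+-identityʳ X))))
      }
      where
      uτ : Unique (cols τ ++ (left τ ++ right τ))
      uτ = subst Unique (τ-split τ) (Fresh-unique τ fr)
      uLR : Unique (left τ ++ right τ)
      uLR = Unique-++ʳ (cols τ) uτ
      lenτ : length (cols τ) + length (left τ ++ right τ) ≡ Nₐ
      lenτ = ≡trans (sym (length-++ (cols τ))) (≡trans (cong length (sym (τ-split τ))) (length-toList τ))
    link G τ (τ′ ∷ F) 1≤n (fr , frs) (a@(_ , path lL lR _ _ , _) ∷ as) room =
      join (link (toList τ ++ G) τ′ F 1≤n frs as (≤-trans (*-monoʳ-≤ (2 * d_c) room′) room))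
      where
      uτ : Unique (cols τ ++ (left τ ++ right τ))
      uτ = subst Unique (τ-split τ) (Fresh-unique τ fr)
      uLR : Unique (left τ ++ right τ)
      uLR = Unique-++ʳ (cols τ) uτ
      lenτ : length (cols τ) + length (left τ ++ right τ) ≡ Nₐ
      lenτ = ≡trans (sym (length-++ (cols τ))) (≡trans (cong length (sym (τ-split τ))) (length-toList τ))
      f = length (τ′ ∷ F)
      lenτG : length (toList τ ++ G) ≡ Nₐ + length G
      lenτG = ≡trans (length-++ (toList τ)) (cong (_+ length G) (length-toList τ))
      room′ : length (toList τ ++ G) + f * (2 * X) ≤ length G + suc f * (2 * X)
      room′ = begin
        length (toList τ ++ G) + f * (2 * X)       ≡⟨ cong (_+ f * (2 * X)) lenτG ⟩
        Nₐ + length G + f * (2 * X)                ≤⟨ +-monoˡ-≤ (f * (2 * X)) (+-monoˡ-≤ (length G) (≤-trans (m≤m+n Nₐ N_c) (m≤m+n X _))) ⟩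
        2 * X + length G + f * (2 * X)             ≡⟨ eq (2 * X) (length G) (f * (2 * X)) ⟩
        length G + suc f * (2 * X)                 ∎
        where
        open ≤-Reasoning
        eq : ∀ a b c → a + b + c ≡ b + (a + c)
        eq = solve-∀
      inτ-c : ∀ {x} → x ∈ cols τ → x ∈ toList τ
      inτ-c x∈ = subst (_ ∈_) (sym (τ-split τ)) (∈-++⁺ˡ x∈)
      inτ-v : ∀ {x} → x ∈ left τ ++ right τ → x ∈ toList τ
      inτ-v x∈ = subst (_ ∈_) (sym (τ-split τ)) (∈-++⁺ʳ (cols τ) x∈)
      join : Absorbing (toList τ ++ G) (τ′ ∷ F) → Absorbing G (τ ∷ τ′ ∷ F)
      join 𝓐 = use (NM-exists 1≤n (NM-fresh Z roomB (connectors-dense (right τ) S (Unique-++ʳ (left τ) uLR) lR uS lS)))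
        where
        open Absorbing 𝓐
        Z : List V
        Z = (bv ++ bc) ++ (toList τ ++ G)
        roomB : 2 * d_c * (length Z + N_c) ≤ n
        roomB = ≤-trans (*-monoʳ-≤ (2 * d_c) (begin
          length Z + N_c                                                ≡⟨ cong (_+ N_c) (≡trans (length-++ (bv ++ bc)) (cong₂ _+_ (length-++ bv) lenτG)) ⟩
          length bv + length bc + (Nₐ + length G) + N_c                 ≤⟨ +-monoˡ-≤ N_c (+-monoˡ-≤ (Nₐ + length G) (+-mono-≤ len-bv len-bc)) ⟩
          f * X + f * X + (Nₐ + length G) + N_c                         ≤⟨ m≤m+n _ X ⟩
          f * X + f * X + (Nₐ + length G) + N_c + X                     ≡⟨ eq f (length G) Nₐ N_c ⟩
          length G + suc f * (2 * X)                                    ∎)) room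
          where
          open ≤-Reasoning
          eq : ∀ f l a c → f * (a + c) + f * (a + c) + (a + l) + c + (a + c) ≡ l + suc f * (2 * (a + c))
          eq = solve-∀
        use : (∃ λ (ρ : Vec V N_c) → Connects (right τ , S) ρ × Fresh Z ρ) → Absorbing G (τ ∷ τ′ ∷ F)
        use (ρ , (W , ds , p , W⊆ , ds⊆ , uniq) , frρ) = record
          { S = left τ ; T = T ; bv = ((left τ ++ right τ) ++ W) ++ bv ; bc = cols τ ++ (ds ++ bc)
          ; absorb = AbsPath-cons {τ} {bv = bv} {bc = bc} a p absorb
          ; uS = Unique-++ˡ (left τ) uLR ; lS = lL ; uT = uT ; lT = lT
          ; ubv = Unique-++ (Unique-++ uLR uW (λ x∈ y∈ → ρ∉ (W⊆ y∈) (∈-++⁺ʳ (bv ++ bc) (∈-++⁺ˡ (inτ-v x∈))))) ubv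
                    (λ x∈ y∈ → case ∈-++⁻ (left τ ++ right τ) x∈ of λ
                      { (inj₁ q) → bv∉ y∈ (∈-++⁺ˡ (inτ-v q))
                      ; (inj₂ q) → ρ∉ (W⊆ q) (∈-++⁺ˡ (∈-++⁺ˡ y∈)) })
          ; ubc = Unique-++ (Unique-++ˡ (cols τ) uτ) (Unique-++ uds ubc (λ x∈ y∈ → ρ∉ (ds⊆ x∈) (∈-++⁺ˡ (∈-++⁺ʳ bv y∈))))
                    (λ x∈ y∈ → case ∈-++⁻ ds y∈ of λ
                      { (inj₁ q) → ρ∉ (ds⊆ q) (∈-++⁺ʳ (bv ++ bc) (∈-++⁺ˡ (inτ-c x∈)))
                      ; (inj₂ q) → bc∉ q (∈-++⁺ˡ (inτ-c x∈)) })
          ; bv∉ = λ x∈ → case ∈-++⁻ ((left τ ++ right τ) ++ W) x∈ of λ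
              { (inj₂ q) → λ y∈ → bv∉ q (∈-++⁺ʳ (toList τ) y∈)
              ; (inj₁ q) → case ∈-++⁻ (left τ ++ right τ) q of λ
                  { (inj₁ r) → Fresh-∉ τ fr (inτ-v r)
                  ; (inj₂ r) → λ y∈ → ρ∉ (W⊆ r) (∈-++⁺ʳ (bv ++ bc) (∈-++⁺ʳ (toList τ) y∈)) } }
          ; bc∉ = λ x∈ → case ∈-++⁻ (cols τ) x∈ of λ
              { (inj₁ q) → Fresh-∉ τ fr (inτ-c q)
              ; (inj₂ q) → case ∈-++⁻ ds q of λ
                  { (inj₁ r) → λ y∈ → ρ∉ (ds⊆ r) (∈-++⁺ʳ (bv ++ bc) (∈-++⁺ʳ (toList τ) y∈))
                  ; (inj₂ r) → λ y∈ → bc∉ r (∈-++⁺ʳ (toList τ) y∈) } }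
          ; len-bv = begin
              length (((left τ ++ right τ) ++ W) ++ bv)              ≡⟨ ≡trans (length-++ ((left τ ++ right τ) ++ W)) (cong (_+ length bv) (length-++ (left τ ++ right τ))) ⟩
              length (left τ ++ right τ) + length W + length bv      ≤⟨ +-mono-≤ (+-mono-≤ (≤-trans (m≤n+m _ (length (cols τ))) (≤-reflexive lenτ)) (≤-trans (Unique-⊆-length uW W⊆) (≤-reflexive (length-toList ρ)))) len-bv ⟩
              X + f * X                                              ∎
          ; len-bc = begin
              length (cols τ ++ (ds ++ bc))                          ≡⟨ ≡trans (length-++ (cols τ)) (cong (length (cols τ) +_) (length-++ ds)) ⟩
              length (cols τ) + (length ds + length bc)              ≤⟨ +-mono-≤ (≤-trans (m≤m+n (length (cols τ)) _) (≤-reflexive lenτ)) (+-mono-≤ (≤-trans (Unique-⊆-length uds ds⊆) (≤-reflexive (length-toList ρ))) len-bc) ⟩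
              Nₐ + (N_c + f * X)                                     ≡⟨ sym (+-assoc Nₐ N_c (f * X)) ⟩
              X + f * X                                              ∎
          }
          where
          open ≤-Reasoning
          ρ∉ : ∀ {x} → x ∈ toList ρ → x ∉ Z
          ρ∉ = Fresh-∉ ρ frρ
          uW : Unique W
          uW = proj₁ (uniq (Fresh-unique ρ frρ))
          uds : Unique ds
          uds = proj₂ (uniq (Fresh-unique ρ frρ))

  -- The reservoir and the closing of the cycle.

  length-cartesianProductWith : ∀ {C : Set} (f : A → B → C) xs ys → length (List.cartesianProductWith f xs ys) ≡ length xs * length ys
  length-cartesianProductWith f []       ys = ≡refl
  length-cartesianProductWith f (x ∷ xs) ys = ≡trans (length-++ (map (f x) ys)) (cong₂ _+_ (length-map (f x) ys) (length-cartesianProductWith f xs ys))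

  allVecs : ∀ n m → List (Vec (Fin n) m)
  allVecs n zero    = [] ∷ []
  allVecs n (suc m) = List.cartesianProductWith _∷_ (allFin n) (allVecs n m)

  ∈-allVecs : ∀ {n m} (v : Vec (Fin n) m) → v ∈ allVecs n m
  ∈-allVecs []      = here ≡refl
  ∈-allVecs (x ∷ v) = ∈-cartesianProductWith⁺ _∷_ (∈-allFin x) (∈-allVecs v)

  length-allVecs : ∀ n m → length (allVecs n m) ≡ n ^ m
  length-allVecs n zero    = ≡refl
  length-allVecs n (suc m) = ≡trans (length-cartesianProductWith _∷_ (allFin n) (allVecs n m)) (cong₂ _*_ (length-allFin n) (length-allVecs n m))

  FreshFam-∉ : ∀ {n m} {B : List (Fin n)} (F : List (Vec (Fin n) m)) → FreshFam B F → ∀ {x} → x ∈ flat F → x ∉ B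
  FreshFam-∉ (τ ∷ F) (fr , frs) x∈ with ∈-++⁻ (toList τ) x∈
  ... | inj₁ p = Fresh-∉ τ fr p
  ... | inj₂ p = λ x∈B → FreshFam-∉ F frs p (∈-++⁺ʳ (toList τ) x∈B)

  FreshFam-unique : ∀ {n m} {B : List (Fin n)} (F : List (Vec (Fin n) m)) → FreshFam B F → Unique (flat F)
  FreshFam-unique []      _          = []
  FreshFam-unique (τ ∷ F) (fr , frs) = Unique-++ (Fresh-unique τ fr) (FreshFam-unique F frs) (λ p q → FreshFam-∉ F frs q (∈-++⁺ˡ p))

  flat-length : (F : List (Vec A m)) → length (flat F) ≡ length F * m
  flat-length []      = ≡refl
  flat-length (τ ∷ F) = ≡trans (length-++ (toList τ)) (cong₂ _+_ (length-toList τ) (flat-length F))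

  nothing-serves : {Q : Set} {P : Q → A → Set} (F : List A) → Pointwise (Serves P) F (map (λ _ → nothing) F)
  nothing-serves []      = []
  nothing-serves (_ ∷ F) = tt ∷ nothing-serves F

  map-zip : ∀ (xs : List A) (ys : List B) → length xs ≡ length ys →
            map proj₁ (List.zip xs ys) ≡ xs × map proj₂ (List.zip xs ys) ≡ ys
  map-zip []       []       eq = ≡refl , ≡refl
  map-zip (x ∷ xs) (y ∷ ys) eq = let p , q = map-zip xs ys (suc-injective eq) in cong (x ∷_) p , cong (y ∷_) q

  module HamiltonCycle {n κ₁ g : ℕ} (𝓗 : System n κ₁ g) where
    open Assembly 𝓗 public

    Request : Set
    Request = Vec V κ × Vec V κ

    -- Requests range over all pairs of tuples, which are easy to enumerate and to count; a pair
    -- with a repeated entry is fulfilled vacuously.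
    Fulfils : Request → Vec V N_c → Set
    Fulfils (s , t) τ = Unique (toList s) → Unique (toList t) → Connects (toList s , toList t) τ

    fulfils-dense : ∀ q → NM d_c N_c (Fulfils q)
    fulfils-dense (s , t) with unique? Fin._≟_ (toList s) | unique? Fin._≟_ (toList t)
    ... | yes u | yes v = NM-map (λ τ c _ _ → c) (connectors-dense (toList s) (toList t) u (length-toList s) v (length-toList t))
    ... | no ¬u | _     = NM-weaken (≤-trans (s≤s z≤n) (d≤blowC copies (suc (k + k)) (suc g))) (NM-all (λ τ u → contradiction u ¬u))
    ... | yes _ | no ¬v = NM-weaken (≤-trans (s≤s z≤n) (d≤blowC copies (suc (k + k)) (suc g))) (NM-all (λ τ _ v → contradiction v ¬v))

    as-path : ∀ {M p} → 2 * κ ≤ M → RainbowPath M p → Unique (proj₁ p) →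
      Σ (List V) λ A → Σ (List V) λ W → Σ (List V) λ A′ → proj₁ p ≡ A ++ W ++ A′ × Path A A′ W (proj₂ p) × Unique A × Unique A′
    as-path {M} {xs , cs} 2κ≤M (rainbow rp len lo _) u = L , W , L′ , xs-eq , path lL lL′ lcs (subst (λ z → RP z cs) xs-eq rp) , uL , uL′
      where
      L = take κ xs
      r = drop κ xs
      j = length r ∸ κ
      W = take j r
      L′ = drop j r
      xs-eq : xs ≡ L ++ W ++ L′
      xs-eq = sym (≡trans (cong (L ++_) (take++drop≡id j r)) (take++drop≡id κ xs))
      2κ≤ : κ + κ ≤ length xs
      2κ≤ = ≤-trans (≤-reflexive (cong (κ +_) (sym (+-identityʳ κ)))) (≤-trans 2κ≤M lo)
      lL : length L ≡ κ
      lL = ≡trans (length-take κ xs) (m≤n⇒m⊓n≡m (≤-trans (m≤m+n κ κ) 2κ≤))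
      κ≤r : κ ≤ length r
      κ≤r = ≤-trans (≤-reflexive (sym (m+n∸n≡m κ κ))) (≤-trans (∸-monoˡ-≤ κ 2κ≤) (≤-reflexive (sym (length-drop κ xs))))
      lL′ : length L′ ≡ κ
      lL′ = ≡trans (length-drop j r) (m∸[m∸n]≡n κ≤r)
      lcs : length cs ≡ length (L ++ W)
      lcs = +-cancelʳ-≡ κ _ _ (≡trans (sym len) (≡trans (cong length (≡trans xs-eq (sym (++-assoc L W L′)))) (≡trans (length-++ (L ++ W)) (cong (length (L ++ W) +_) lL′))))
      uL : Unique L
      uL = Uniqueₚ.take⁺ κ u
      uL′ : Unique L′
      uL′ = Uniqueₚ.drop⁺ j (Uniqueₚ.drop⁺ κ u)

    -- `wv` and `wc` are the parts of the reservoir actually spent; the rest of it is left to the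
    -- absorbers.
    record Return (T S : List V) (ps : List VC) (R : List (Vec V N_c)) : Set where
      constructor return
      field
        W ds wv wc : List V
        back : Path T S W ds
        W↭   : W ↭ vsOf ps ++ wv
        ds↭  : ds ↭ csOf ps ++ wc
        wv⊆  : ∀ {x} → x ∈ wv → x ∈ flat R
        wc⊆  : ∀ {x} → x ∈ wc → x ∈ flat R
        uwv  : Unique wv
        uwc  : Unique wc

    connect : ∀ {T S R j} → Unique T → length T ≡ κ → Unique S → length S ≡ κ → (∀ q → AtLeast (Fulfils q) (suc j) R) →
      Σ (Vec V N_c) λ τ → Σ (List (Vec V N_c)) λ R′ → Connects (T , S) τ × R ↭ τ ∷ R′ × (∀ q → AtLeast (Fulfils q) j R′)
    connect {T} {S} {R} uT lT uS lS h with fromList-length T lT | fromList-length S lS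
    ... | s , ≡refl | t , ≡refl = let τ , R′ , c , perm , f = AtLeast-extract (h (s , t)) in
          τ , R′ , c uT uS , perm , λ q → f {Fulfils q} (h q)

    -- One connector is spent per path and one more to reach S. Each removal costs every other
    -- request at most one server, so 1 + |ps| servers per request suffice.
    return-path : ∀ {M T S} ps R → 2 * κ ≤ M → All (RainbowPath M) ps → Unique (vsOf ps) →
      Unique T → length T ≡ κ → Unique S → length S ≡ κ →
      (∀ q → AtLeast (Fulfils q) (suc (length ps)) R) → Unique (flat R) → Return T S ps R
    return-path [] R 2κ≤M [] _ uT lT uS lS h uR with connect uT lT uS lS h
    ... | τ , R′ , (W , ds , p , W⊆ , ds⊆ , uniq) , perm , _ =
          return W ds W ds p ↭-refl ↭-refl (λ x∈ → inR (W⊆ x∈)) (λ x∈ → inR (ds⊆ x∈)) (proj₁ (uniq uτ)) (proj₂ (uniq uτ))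
      where
      inR : ∀ {x} → x ∈ toList τ → x ∈ flat R
      inR x∈ = ∈-resp-↭ (↭-sym (flat-↭ perm)) (∈-++⁺ˡ x∈)
      uτ : Unique (toList τ)
      uτ = Unique-++ˡ (toList τ) (Unique-↭ (flat-↭ perm) uR)
    return-path {M} {T} {S} (q@(xs , cs) ∷ ps) R 2κ≤M (r ∷ rs) uv uT lT uS lS h uR with as-path 2κ≤M r (Unique-++ˡ xs uv)
    ... | A , W₀ , A′ , ≡refl , p₀@(path lA lA′ _ _) , uA , uA′ with connect uT lT uA lA h
    ... | τ , R′ , (W , ds , p , W⊆ , ds⊆ , uniq) , perm , h′
        with return-path ps R′ 2κ≤M rs (Unique-++ʳ (A ++ W₀ ++ A′) uv) uA′ lA′ uS lS h′ (Unique-++ʳ (toList τ) (Unique-↭ (flat-↭ perm) uR))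
    ... | return W′ ds′ wv wc back W↭ ds↭ wv⊆ wc⊆ uwv uwc =
          return _ _ (W ++ wv) (ds ++ wc) (Path-compose p (Path-compose p₀ back))
            (trans (Permₚ.++⁺ˡ W (Permₚ.++⁺ˡ A (Permₚ.++⁺ˡ W₀ (Permₚ.++⁺ˡ A′ W↭)))) (shuffle₄ W A W₀ A′ (vsOf ps) wv))
            (trans (Permₚ.++⁺ˡ ds (Permₚ.++⁺ˡ cs ds↭)) (shuffle₅ ds cs (csOf ps) wc))
            (join W⊆ wv⊆) (join ds⊆ wc⊆)
            (Unique-++ (proj₁ (uniq uτ)) uwv (λ a b → Unique-disjoint (toList τ) uR′ (W⊆ a) (wv⊆ b)))
            (Unique-++ (proj₂ (uniq uτ)) uwc (λ a b → Unique-disjoint (toList τ) uR′ (ds⊆ a) (wc⊆ b)))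
      where
      uR′ : Unique (toList τ ++ flat R′)
      uR′ = Unique-↭ (flat-↭ perm) uR
      uτ : Unique (toList τ)
      uτ = Unique-++ˡ (toList τ) uR′
      join : ∀ {a b : List V} → (∀ {x} → x ∈ a → x ∈ toList τ) → (∀ {x} → x ∈ b → x ∈ flat R′) → ∀ {x} → x ∈ a ++ b → x ∈ flat R
      join {a} f g x∈ with ∈-++⁻ a x∈
      ... | inj₁ p = ∈-resp-↭ (↭-sym (flat-↭ perm)) (∈-++⁺ˡ (f p))
      ... | inj₂ p = ∈-resp-↭ (↭-sym (flat-↭ perm)) (∈-++⁺ʳ (toList τ) (g p))

    -- The cyclic order is unrolled: repeating the first κ vertices at the end turns the n cyclic
    -- windows into windows of a list.
    HamCycle : Set
    HamCycle = Σ (List V) λ vs → Σ (List V) λ cs → vs ↭ allFin n × cs ↭ allFin n × RP (vs ++ take κ vs) cs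

    close-cycle : ∀ {S T W₁ d₁ W₂ d₂} → Path S T W₁ d₁ → Path T S W₂ d₂ →
                  (S ++ W₁ ++ T) ++ W₂ ↭ allFin n → d₁ ++ d₂ ↭ allFin n → HamCycle
    close-cycle {S} {T} {W₁} {d₁} {W₂} {d₂} (path lS lT ld r) (path _ _ _ r′) pv pc = vs , d₁ ++ d₂ , pv , pc ,
      subst (λ z → RP z (d₁ ++ d₂)) eq (RP-glue (S ++ W₁) (≤-reflexive (sym lT)) ld (subst (λ z → RP z d₁) (sym (++-assoc S W₁ T)) r) r′)
      where
      vs = (S ++ W₁ ++ T) ++ W₂
      S-eq : take κ vs ≡ S
      S-eq = ≡trans (cong (take κ) (++-assoc S (W₁ ++ T) W₂)) (≡trans (take-++-≤ κ S (≤-reflexive (sym lS))) (take-≥ κ S (≤-reflexive lS)))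
      eq : (S ++ W₁) ++ T ++ W₂ ++ S ≡ vs ++ take κ vs
      eq = ≡trans (++-assoc S W₁ _) (≡trans (cong (S ++_) (≡trans (sym (++-assoc W₁ T _)) (sym (++-assoc (W₁ ++ T) W₂ S))))
           (≡trans (sym (++-assoc S ((W₁ ++ T) ++ W₂) S)) (cong₂ _++_ (sym (++-assoc S (W₁ ++ T) W₂)) (sym S-eq))))

    idle : ∀ {F S T bv bc} → AbsPath S T F bv bc →
      Σ (List V) λ W → Σ (List V) λ ds → Path S T W ds × (S ++ W ++ T ↭ bv) × (ds ↭ bc)
    idle {F} {bv = bv} {bc} abs = let W , ds , p , q , r = abs (map (λ _ → nothing) F) (nothing-serves F) in
      W , ds , p , trans q (none bv proj₁) , trans r (none bc proj₂)
      where
      no-pairs : ∀ (F : List (Vec V Nₐ)) → List.catMaybes {A = V × V} (map (λ _ → nothing) F) ≡ []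
      no-pairs []      = ≡refl
      no-pairs (_ ∷ F) = no-pairs F
      none : ∀ b (f : V × V → V) → b ++ map f (List.catMaybes (map (λ _ → nothing) F)) ↭ b
      none b f = ↭-reflexive (≡trans (cong (λ z → b ++ map f z) (no-pairs F)) (++-identityʳ b))

    -- The leftover vertices and colours are equally many, and few enough to be absorbed.
    absorb-leftover : ∀ {m F S T bv bc W ds av ac} → AbsPath S T F bv bc → (∀ q → AtLeast (Absorbs q) m F) →
      Path T S W ds → W ↭ av → ds ↭ ac → Unique (bv ++ av) → Unique (bc ++ ac) → n ≤ length (bv ++ av) + m → HamCycle
    absorb-leftover {m} {F} {S} {T} {bv} {bc} {W} {ds} {av} {ac} abs cap back W↭ ds↭ uv uc few =
      go (complement uv) (complement uc) (idle abs)
      where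
      go : (Σ (List V) λ Lv → allFin n ↭ (bv ++ av) ++ Lv) → (Σ (List V) λ Lc → allFin n ↭ (bc ++ ac) ++ Lc) →
           (Σ (List V) λ W₁ → Σ (List V) λ d₁ → Path S T W₁ d₁ × (S ++ W₁ ++ T ↭ bv) × (d₁ ↭ bc)) → HamCycle
      go (Lv , pv) (Lc , pc) (W₁ , d₁ , p₁ , q₁ , r₁) =
        go₂ (assign (List.zip Lv Lc) few′ (λ {q} _ → cap q))
        where
        open ≤-Reasoning
        -- The idle absorbing path and the return path close up to a cycle, which has as many
        -- windows as vertices. Hence equally many vertices and colours remain.
        sizes : length (bv ++ av) ≡ length (bc ++ ac)
        sizes = begin-equality
          length (bv ++ av)                       ≡⟨ length-++ bv ⟩
          length bv + length av                   ≡⟨ cong₂ _+_ (sym (↭-length q₁)) (sym (↭-length W↭)) ⟩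
          length (S ++ W₁ ++ T) + length W        ≡⟨ cong (_+ length W) (≡trans (cong length (sym (++-assoc S W₁ T))) (length-++ (S ++ W₁))) ⟩
          length (S ++ W₁) + length T + length W  ≡⟨ +-assoc (length (S ++ W₁)) _ _ ⟩
          length (S ++ W₁) + (length T + length W) ≡⟨ cong₂ _+_ (sym (Path.len-ds p₁)) (≡trans (sym (length-++ T)) (sym (Path.len-ds back))) ⟩
          length d₁ + length ds                   ≡⟨ cong₂ _+_ (↭-length r₁) (↭-length ds↭) ⟩
          length bc + length ac                   ≡⟨ sym (length-++ bc) ⟩
          length (bc ++ ac)                       ∎
        total : ∀ (xs {L} : List V) → allFin n ↭ xs ++ L → length xs + length L ≡ n
        total xs p = ≡trans (sym (length-++ xs)) (≡trans (sym (↭-length p)) (length-allFin n))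
        L≡ : length Lv ≡ length Lc
        L≡ = +-cancelˡ-≡ (length (bv ++ av)) _ _ (≡trans (total (bv ++ av) pv) (≡trans (sym (total (bc ++ ac) pc)) (cong (_+ length Lc) (sym sizes))))
        few′ : length (List.zip Lv Lc) ≤ m
        few′ = ≤-trans (≤-reflexive (≡trans (sym (length-map proj₁ (List.zip Lv Lc))) (cong length (proj₁ (map-zip Lv Lc L≡)))))
          (+-cancelˡ-≤ (length (bv ++ av)) _ _ (≤-trans (≤-reflexive (total (bv ++ av) pv)) few))
        go₂ : (Σ (List (Maybe (V × V))) λ asg → Pointwise (Serves Absorbs) F asg × List.catMaybes asg ↭ List.zip Lv Lc) → HamCycle
        go₂ (asg , ss , perm) with abs asg ss
        ... | W₂ , d₂ , p₂ , q₂ , r₂ = close-cycle p₂ back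
          (trans (Permₚ.++⁺ (trans q₂ (Permₚ.++⁺ˡ bv (trans (Permₚ.map⁺ proj₁ perm) (↭-reflexive (proj₁ (map-zip Lv Lc L≡)))))) W↭)
            (trans (shuffle₆ bv Lv av) (↭-sym pv)))
          (trans (Permₚ.++⁺ (trans r₂ (Permₚ.++⁺ˡ bc (trans (Permₚ.map⁺ proj₂ perm) (↭-reflexive (proj₂ (map-zip Lv Lc L≡)))))) ds↭)
            (trans (shuffle₆ bc Lc ac) (↭-sym pc)))

    paths-count : ∀ {M ps} → All (RainbowPath M) ps → M * length ps ≤ length (vsOf ps)
    paths-count {M} [] = ≤-reflexive (*-zeroʳ M)
    paths-count {M} {(xs , cs) ∷ ps} (r ∷ rs) = ≤-trans (≤-reflexive (*-suc M (length ps)))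
      (≤-trans (+-mono-≤ (RainbowPath.lo r) (paths-count rs)) (≤-reflexive (sym (length-++ xs))))

    module _ {mₐ Tₐ m_c T_c u D M : ℕ} (1≤κ₁ : 1 ≤ κ₁) (1≤n : 1 ≤ n) (κ≤n : 2 * (1 + κ₁) ≤ n)
             (2≤M : 2 ≤ M) (2κ≤M : 2 * κ ≤ M) (1≤mₐ : 1 ≤ mₐ)
             (req-a : n * n ≤ 2 ^ mₐ) (T-a : famT (2 + g) Nₐ mₐ ≤ Tₐ) (room-a : 2 * (2 + g) * (Tₐ * Nₐ) ≤ n) (room-l : 2 * d_c * (Tₐ * (2 * X)) ≤ n)
             (req-c : n ^ κ * n ^ κ ≤ 2 ^ m_c) (T-c : famT d_c N_c m_c ≤ T_c) (room-c : 2 * d_c * ((Tₐ * X + Tₐ * X) + T_c * N_c) ≤ n)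
             (room-b : 2 * g * (Tₐ * X + T_c * N_c + M) ≤ n) (leftover : T_c * N_c + u ≤ mₐ)
             (big₁ : n ≤ D * u) (big₂ : 2 * D * κ ≤ n) (big₃ : 2 * growC D M * (2 * M + k * suc (2 * M)) ≤ n) (few-paths : n < M * m_c) where

      private
        absorbers : ServingFamily (List.cartesianProduct (allFin n) (allFin n)) Absorbs mₐ (famT (2 + g) Nₐ mₐ) []
        absorbers = family {d = 2 + g} _ mₐ 1≤n (s≤s z≤n) (absorbers-dense κ≤n)
          (≤-trans (≤-reflexive (≡trans (length-cartesianProductWith _,_ (allFin n) (allFin n)) (cong₂ _*_ (length-allFin n) (length-allFin n)))) req-a) []
          (≤-trans (*-monoʳ-≤ (2 * (2 + g)) (*-monoˡ-≤ Nₐ T-a)) room-a)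

        complete-cycle : ∀ {τ F} → length (τ ∷ F) ≤ Tₐ → (∀ q → AtLeast (Absorbs q) mₐ (τ ∷ F)) → Absorbing [] (τ ∷ F) → HamCycle
        complete-cycle {τ} {F} lenF cap 𝓐 = reservoir (family _ m_c 1≤n (≤-trans (s≤s z≤n) (d≤blowC copies (suc (k + k)) (suc g))) fulfils-dense
            (≤-trans (≤-reflexive (≡trans (length-cartesianProductWith _,_ (allVecs n κ) (allVecs n κ)) (cong₂ _*_ (length-allVecs n κ) (length-allVecs n κ)))) req-c)
            (bv ++ bc) (≤-trans (*-monoʳ-≤ (2 * d_c) (+-mono-≤ (≤-trans (≤-reflexive (length-++ bv)) (+-mono-≤ lbv lbc)) (*-monoˡ-≤ N_c T-c))) room-c))
          where
          open Absorbing 𝓐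
          lbv : length bv ≤ Tₐ * X
          lbv = ≤-trans len-bv (*-monoˡ-≤ X lenF)
          lbc : length bc ≤ Tₐ * X
          lbc = ≤-trans len-bc (*-monoˡ-≤ X lenF)
          bc≤bv : length bc ≤ length bv
          bc≤bv = let W₁ , d₁ , p₁ , q₁ , r₁ = idle {τ ∷ F} absorb in begin
              length bc                          ≡⟨ sym (↭-length r₁) ⟩
              length d₁                          ≡⟨ Path.len-ds p₁ ⟩
              length (S ++ W₁)                   ≤⟨ m≤m+n _ (length T) ⟩
              length (S ++ W₁) + length T        ≡⟨ ≡trans (sym (length-++ (S ++ W₁))) (cong length (++-assoc S W₁ T)) ⟩
              length (S ++ W₁ ++ T)              ≡⟨ ↭-length q₁ ⟩
              length bv                          ∎
            where open ≤-Reasoning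
          reservoir : ServingFamily (List.cartesianProduct (allVecs n κ) (allVecs n κ)) Fulfils m_c (famT d_c N_c m_c) (bv ++ bc) → HamCycle
          reservoir (R , lenR , frR , _ , servR) = finish
              (almost-cover {BV} {BC} {D} {u} {M} 1≤κ₁ 1≤n 2≤M (≤-trans (m≤m+n κ _) 2κ≤M) BC≤BV small big₁ big₂ big₃ uBV uBC)
            where
            Z BV BC : List V
            Z = flat R
            BV = bv ++ Z
            BC = bc ++ Z
            uZ : Unique Z
            uZ = FreshFam-unique R frR
            Z∉ : ∀ {x} → x ∈ Z → x ∉ bv ++ bc
            Z∉ = FreshFam-∉ R frR
            uBV : Unique BV
            uBV = Unique-++ ubv uZ (λ a b → Z∉ b (∈-++⁺ˡ a))
            uBC : Unique BC
            uBC = Unique-++ ubc uZ (λ a b → Z∉ b (∈-++⁺ʳ bv a))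
            lenZ : length Z ≤ T_c * N_c
            lenZ = ≤-trans (≤-reflexive (flat-length R)) (*-monoˡ-≤ N_c (≤-trans lenR T-c))
            BC≤BV : length BC ≤ length BV
            BC≤BV = ≤-trans (≤-reflexive (length-++ bc)) (≤-trans (+-monoˡ-≤ (length Z) bc≤bv) (≤-reflexive (sym (length-++ bv))))
            small : 2 * g * (length BV + M) ≤ n
            small = ≤-trans (*-monoʳ-≤ (2 * g) (+-monoˡ-≤ M (≤-trans (≤-reflexive (length-++ bv)) (+-mono-≤ lbv lenZ)))) room-b
            finish : (Σ (Cover M BV BC) λ 𝓒 → n < length BV + covered 𝓒 + u) → HamCycle
            finish (covering ps all uv uc , most) = close (return-path ps R 2κ≤M all (Unique-++ʳ BV uv) uT lT uS lS enough uZ)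
              where
              -- The paths are disjoint and have at least M vertices each, so M |ps| ≤ n < M m_c.
              few : suc (length ps) ≤ m_c
              few = *-cancelˡ-< M (length ps) m_c (≤-trans (s≤s (≤-trans (paths-count all)
                (≤-trans (Unique-⊆-length (Unique-++ʳ BV uv) (λ {x} _ → ∈-allFin x)) (≤-reflexive (length-allFin n))))) few-paths)
              enough : ∀ q → AtLeast (Fulfils q) (suc (length ps)) R
              enough q@(s , t) = AtLeast-≤ few (servR (∈-cartesianProduct⁺ (∈-allVecs s) (∈-allVecs t)))
              close : Return T S ps R → HamCycle
              close (return W ds wv wc back W↭ ds↭ wv⊆ wc⊆ uwv uwc) =
                absorb-leftover {m = mₐ} absorb cap back W↭ ds↭ (combine bv uv uwv wv⊆) (combine bc uc uwc wc⊆) remaining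
                where
                combine : ∀ b {w x} → Unique ((b ++ Z) ++ w) → Unique x → (∀ {y} → y ∈ x → y ∈ Z) → Unique (b ++ w ++ x)
                combine b {w} {x} u ux x⊆ = Unique-++ (Unique-++ˡ b (Unique-++ˡ (b ++ Z) u))
                  (Unique-++ (Unique-++ʳ (b ++ Z) u) ux (λ p q → Unique-disjoint (b ++ Z) u (∈-++⁺ʳ b (x⊆ q)) p))
                  (λ p q → case ∈-++⁻ w q of λ
                    { (inj₁ r) → Unique-disjoint (b ++ Z) u (∈-++⁺ˡ p) r
                    ; (inj₂ r) → Unique-disjoint b (Unique-++ˡ (b ++ Z) u) p (x⊆ r) })
                -- What is left consists of fewer than u uncovered vertices and of unspent
                -- reservoir; `leftover` makes the absorbing capacity large enough for both.
                remaining : n ≤ length (bv ++ vsOf ps ++ wv) + mₐ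
                remaining = begin
                  n                                                            ≤⟨ <⇒≤ most ⟩
                  length (bv ++ Z) + length (vsOf ps) + u                      ≡⟨ cong (λ z → z + length (vsOf ps) + u) (length-++ bv) ⟩
                  length bv + length Z + length (vsOf ps) + u                  ≡⟨ eq (length bv) (length Z) (length (vsOf ps)) u ⟩
                  length bv + length (vsOf ps) + (length Z + u)                ≤⟨ +-mono-≤ (+-monoʳ-≤ (length bv) (m≤m+n _ (length wv))) (≤-trans (+-monoˡ-≤ u lenZ) leftover) ⟩
                  length bv + (length (vsOf ps) + length wv) + mₐ              ≡⟨ cong (_+ mₐ) (sym (≡trans (length-++ bv) (cong (length bv +_) (length-++ (vsOf ps))))) ⟩
                  length (bv ++ vsOf ps ++ wv) + mₐ                            ∎
                  where
                  open ≤-Reasoning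
                  eq : ∀ a b c d → a + b + c + d ≡ a + c + (b + d)
                  eq = solve-∀

      ham-cycle : HamCycle
      ham-cycle = start absorbers
        where
        some : V
        some = Fin.fromℕ< 1≤n
        start : ServingFamily (List.cartesianProduct (allFin n) (allFin n)) Absorbs mₐ (famT (2 + g) Nₐ mₐ) [] → HamCycle
        start ([] , _ , _ , _ , serv) = contradiction (serv (∈-cartesianProduct⁺ (∈-allFin some) (∈-allFin some))) (empty 1≤mₐ)
          where
          empty : ∀ {P : Vec V Nₐ → Set} {m} → 1 ≤ m → ¬ AtLeast P m []
          empty (s≤s _) ()
        start (τ ∷ F , len , fr , all , serv) = complete-cycle lenF (λ q → serv (∈-cartesianProduct⁺ (∈-allFin (proj₁ q)) (∈-allFin (proj₂ q))))
          (link [] τ F 1≤n fr all (≤-trans (*-monoʳ-≤ (2 * d_c) (*-monoˡ-≤ (2 * X) lenF)) room-l))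
          where
          lenF : length (τ ∷ F) ≤ Tₐ
          lenF = ≤-trans len T-a

  -- Exponential bounds and the choice of constants.

  suc≤2^ : ∀ c → suc c ≤ 2 ^ c
  suc≤2^ zero    = ≤-refl
  suc≤2^ (suc c) = ≤-trans (s≤s (suc≤2^ c)) (≤-trans (+-monoˡ-≤ (2 ^ c) (m^n>0 2 c)) (≤-reflexive (cong (2 ^ c +_) (sym (+-identityʳ _)))))

  linear≤2^ : ∀ c i → c * suc (c * 3 + i) ≤ 2 ^ (c * 3 + i)
  linear≤2^ c zero = begin
    c * suc (c * 3 + 0)                  ≤⟨ m≤m+n _ _ ⟩
    c * suc (c * 3 + 0) + (c * c * c + 2 * c + 1)  ≡⟨ cube c ⟩
    suc c * (suc c * (suc c * 1))        ≤⟨ ^-monoˡ-≤ 3 (suc≤2^ c) ⟩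
    (2 ^ c) ^ 3                          ≡⟨ ^-*-assoc 2 c 3 ⟩
    2 ^ (c * 3)                          ≡⟨ cong (2 ^_) (sym (+-identityʳ (c * 3))) ⟩
    2 ^ (c * 3 + 0)                      ∎
    where
    open ≤-Reasoning
    cube : ∀ c → c * suc (c * 3 + 0) + (c * c * c + 2 * c + 1) ≡ suc c * (suc c * (suc c * 1))
    cube = solve-∀
  linear≤2^ c (suc i) = begin
    c * suc (c * 3 + suc i)              ≡⟨ cong (λ z → c * suc z) (+-suc (c * 3) i) ⟩
    c * suc (suc (c * 3 + i))            ≡⟨ *-suc c (suc (c * 3 + i)) ⟩
    c + c * suc (c * 3 + i)              ≤⟨ +-mono-≤ (≤-trans (m≤m*n c (suc (c * 3 + i))) (linear≤2^ c i)) (linear≤2^ c i) ⟩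
    2 ^ (c * 3 + i) + 2 ^ (c * 3 + i)    ≡⟨ cong (2 ^ (c * 3 + i) +_) (sym (+-identityʳ _)) ⟩
    2 ^ suc (c * 3 + i)                  ≡⟨ cong (2 ^_) (sym (+-suc (c * 3) i)) ⟩
    2 ^ (c * 3 + suc i)                  ∎
    where open ≤-Reasoning

  -- Bounds the numbers of requests, n² and n^(2κ), which are polynomial in m as n < 2Lm. Taking
  -- P-th roots with P = p + 1 and j = m / P reduces it to the linear bound c (j + 1) ≤ 2^j, valid
  -- for j ≥ 3c.
  poly≤2^ : ∀ p Q → Σ ℕ λ m₀ → ∀ m → m₀ ≤ m → (Q * m) ^ suc p ≤ 2 ^ m
  poly≤2^ p Q = c * 3 * P , bound
    where
    open ≤-Reasoning
    P = suc p
    c = Q * P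
    bound : ∀ m → c * 3 * P ≤ m → (Q * m) ^ P ≤ 2 ^ m
    bound m h = begin
      (Q * m) ^ P                   ≤⟨ ^-monoˡ-≤ P (*-monoʳ-≤ Q m≤) ⟩
      (Q * (P * suc j)) ^ P         ≡⟨ cong (_^ P) (sym (*-assoc Q P (suc j))) ⟩
      (c * suc j) ^ P               ≤⟨ ^-monoˡ-≤ P j-big ⟩
      (2 ^ j) ^ P                   ≡⟨ ^-*-assoc 2 j P ⟩
      2 ^ (j * P)                   ≤⟨ ^-monoʳ-≤ 2 (m/n*n≤m m P) ⟩
      2 ^ m                         ∎
      where
      j = m / P
      3c≤j : c * 3 ≤ j
      3c≤j = ≤-trans (≤-reflexive (sym (m*n/n≡m (c * 3) P))) (/-monoˡ-≤ P h)
      m≤ : m ≤ P * suc j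
      m≤ = ≤-trans (≤-reflexive (m≡m%n+[m/n]*n m P)) (≤-trans (+-monoˡ-≤ (j * P) (<⇒≤ (m%n<n m P))) (≤-reflexive (*-comm (suc j) P)))
      j-big : c * suc j ≤ 2 ^ j
      j-big = subst (λ z → c * suc z ≤ 2 ^ z) (m+[n∸m]≡n 3c≤j) (linear≤2^ c (j ∸ c * 3))

  open HamiltonCycle using (HamCycle; ham-cycle)

  record Parameters (n κ g Nₐ N_c d_c Kₐ K_c : ℕ) (G : ℕ → ℕ → ℕ) : Set where
    field
      mₐ m_c D M : ℕ
      2κ≤n   : 2 * κ ≤ n
      2≤M    : 2 ≤ M
      2κ≤M   : 2 * κ ≤ M
      1≤m    : 1 ≤ m_c
      1≤mₐ   : 1 ≤ mₐ
      req-a  : n * n ≤ 2 ^ mₐ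
      room-a : 2 * (2 + g) * (Kₐ * mₐ * Nₐ) ≤ n
      room-l : 2 * d_c * (Kₐ * mₐ * (2 * (Nₐ + N_c))) ≤ n
      req-c  : n ^ κ * n ^ κ ≤ 2 ^ m_c
      room-c : 2 * d_c * ((Kₐ * mₐ * (Nₐ + N_c) + Kₐ * mₐ * (Nₐ + N_c)) + K_c * m_c * N_c) ≤ n
      room-b : 2 * g * (Kₐ * mₐ * (Nₐ + N_c) + K_c * m_c * N_c + M) ≤ n
      left   : K_c * m_c * N_c + m_c ≤ mₐ
      big₁   : n ≤ D * m_c
      big₂   : 2 * D * κ ≤ n
      big₃   : 2 * G D M * (2 * M + suc κ * suc (2 * M)) ≤ n
      few    : n < M * m_c

  -- Everything linear is a multiple of m_c = n / L. The absorbing capacity is b m_c, where b = K_c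
  -- N_c + 1 just covers the reservoir and m_c uncovered vertices. L dominates the coefficients of
  -- m_c in the four room conditions, and M ≥ 2L gives fewer than m_c paths because n < 2L m_c. What
  -- remains are lower bounds on n.
  parameters-for : ∀ {κ₁ g Nₐ N_c d_c Kₐ K_c G} b L M {m₁ m₂} .{{_ : NonZero L}} → let κ = suc κ₁ ; X = Nₐ + N_c in
    b ≡ suc (K_c * N_c) →
    2 * (2 + g) * (Kₐ * b * Nₐ) ≤ L → 2 * d_c * (Kₐ * b * (2 * X)) ≤ L →
    2 * d_c * ((Kₐ * b * X + Kₐ * b * X) + K_c * N_c) ≤ L → 2 * g * (Kₐ * b * X + K_c * N_c + 1) ≤ L →
    2 * L ≤ M → 2 ≤ M → 2 * κ ≤ M →
    (∀ m_c → m₁ ≤ m_c → (2 * L * m_c) ^ (κ + κ) ≤ 2 ^ m_c) → (∀ m_c → m₂ ≤ m_c → (2 * L * m_c) ^ 2 ≤ 2 ^ m_c) →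
    ∀ n → suc (m₁ + m₂ + M) * L ≤ n → 2 * κ ≤ n → 2 * (2 * L) * κ ≤ n → 2 * G (2 * L) M * (2 * M + suc κ * suc (2 * M)) ≤ n →
    Parameters n κ g Nₐ N_c d_c Kₐ K_c G
  parameters-for {κ₁} {g} {Nₐ} {N_c} {d_c} {Kₐ} {K_c} {G} b L M {m₁} {m₂} b-eq h₁ h₂ h₃ h₄ 2L≤M 2≤M 2κ≤M pe₁ pe₂ n head≤ 2κ≤n big₂ big₃ = record
    { mₐ = b * m_c ; m_c = m_c ; D = 2 * L ; M = M
    ; 2κ≤n = 2κ≤n ; 2≤M = 2≤M ; 2κ≤M = 2κ≤M ; 1≤m = 1≤m ; 1≤mₐ = ≤-trans 1≤m m≤bm
    ; req-a = ≤-trans n²≤ (^-monoʳ-≤ 2 m≤bm)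
    ; room-a = within h₁ (eq₁ (2 + g) Kₐ b m_c Nₐ)
    ; room-l = within h₂ (eq₁ d_c Kₐ b m_c (2 * X))
    ; req-c = nκ≤
    ; room-c = within h₃ (eq₃ d_c Kₐ b m_c X K_c N_c)
    ; room-b = ≤-trans (*-monoʳ-≤ (2 * g) (+-monoʳ-≤ (Kₐ * (b * m_c) * X + K_c * m_c * N_c) M≤m)) (within h₄ (eq₄ g Kₐ b m_c X K_c N_c))
    ; left = ≤-reflexive (≡trans (eq₅ K_c N_c m_c) (cong (_* m_c) (sym b-eq)))
    ; big₁ = <⇒≤ n<Dm ; big₂ = big₂ ; big₃ = big₃
    ; few = ≤-trans n<Dm (*-monoˡ-≤ m_c 2L≤M)
    }
    where
    open ≤-Reasoning
    κ = suc κ₁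
    X = Nₐ + N_c
    m_c = n / L
    m₀≤m : suc (m₁ + m₂ + M) ≤ m_c
    m₀≤m = ≤-trans (≤-reflexive (sym (m*n/n≡m (suc (m₁ + m₂ + M)) L))) (/-monoˡ-≤ L head≤)
    1≤m : 1 ≤ m_c
    1≤m = ≤-trans (s≤s z≤n) m₀≤m
    M≤m : M ≤ m_c
    M≤m = ≤-trans (≤-trans (m≤n+m M (m₁ + m₂)) (n≤1+n _)) m₀≤m
    m≤bm : m_c ≤ b * m_c
    m≤bm = ≤-trans (m≤m+n m_c _) (≤-reflexive (cong (_* m_c) (sym b-eq)))
    Lm≤n : L * m_c ≤ n
    Lm≤n = ≤-trans (≤-reflexive (*-comm L m_c)) (m/n*n≤m n L)
    n<Dm : n < 2 * L * m_c
    n<Dm = begin-strict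
      n                    ≡⟨ m≡m%n+[m/n]*n n L ⟩
      n % L + m_c * L        <⟨ +-monoˡ-< (m_c * L) (m%n<n n L) ⟩
      L + m_c * L            ≤⟨ +-monoˡ-≤ (m_c * L) (≤-trans (≤-reflexive (sym (*-identityˡ L))) (*-monoˡ-≤ L 1≤m)) ⟩
      m_c * L + m_c * L        ≡⟨ dbl m_c L ⟩
      2 * L * m_c            ∎
      where
      dbl : ∀ a b → a * b + a * b ≡ 2 * b * a
      dbl = solve-∀
    n²≤ : n * n ≤ 2 ^ m_c
    n²≤ = begin
      n * n                ≡⟨ cong (n *_) (sym (*-identityʳ n)) ⟩
      n ^ 2                ≤⟨ ^-monoˡ-≤ 2 (<⇒≤ n<Dm) ⟩
      (2 * L * m_c) ^ 2      ≤⟨ pe₂ m_c (≤-trans (≤-trans (m≤n+m m₂ m₁) (≤-trans (m≤m+n (m₁ + m₂) M) (n≤1+n _))) m₀≤m) ⟩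
      2 ^ m_c                ∎
    nκ≤ : n ^ κ * n ^ κ ≤ 2 ^ m_c
    nκ≤ = begin
      n ^ κ * n ^ κ            ≡⟨ sym (^-distribˡ-+-* n κ κ) ⟩
      n ^ (κ + κ)              ≤⟨ ^-monoˡ-≤ (κ + κ) (<⇒≤ n<Dm) ⟩
      (2 * L * m_c) ^ (κ + κ)    ≤⟨ pe₁ m_c (≤-trans (≤-trans (m≤m+n m₁ m₂) (≤-trans (m≤m+n (m₁ + m₂) M) (n≤1+n _))) m₀≤m) ⟩
      2 ^ m_c                    ∎
    within : ∀ {c z} → c ≤ L → z ≡ c * m_c → z ≤ n
    within le ≡refl = ≤-trans (*-monoˡ-≤ m_c le) Lm≤n
    eq₁ : ∀ d K b m_c N → 2 * d * (K * (b * m_c) * N) ≡ 2 * d * (K * b * N) * m_c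
    eq₁ = solve-∀
    eq₃ : ∀ d K b m_c X K′ N → 2 * d * ((K * (b * m_c) * X + K * (b * m_c) * X) + K′ * m_c * N) ≡ 2 * d * ((K * b * X + K * b * X) + K′ * N) * m_c
    eq₃ = solve-∀
    eq₄ : ∀ g K b m_c X K′ N → 2 * g * (K * (b * m_c) * X + K′ * m_c * N + m_c) ≡ 2 * g * (K * b * X + K′ * N + 1) * m_c
    eq₄ = solve-∀
    eq₅ : ∀ K N m_c → K * m_c * N + m_c ≡ suc (K * N) * m_c
    eq₅ = solve-∀

  parameters : ∀ κ₁ g Nₐ N_c d_c Kₐ K_c G → Σ ℕ λ n₀ → ∀ n → n₀ ≤ n → Parameters n (suc κ₁) g Nₐ N_c d_c Kₐ K_c G
  parameters κ₁ g Nₐ N_c d_c Kₐ K_c G = go b c₁ c₂ c₃ c₄ ≡refl ≤-refl ≤-refl ≤-refl ≤-refl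
    where
    κ X b c₁ c₂ c₃ c₄ : ℕ
    κ = suc κ₁
    X = Nₐ + N_c
    b = suc (K_c * N_c)
    c₁ = 2 * (2 + g) * (Kₐ * b * Nₐ)
    c₂ = 2 * d_c * (Kₐ * b * (2 * X))
    c₃ = 2 * d_c * ((Kₐ * b * X + Kₐ * b * X) + K_c * N_c)
    c₄ = 2 * g * (Kₐ * b * X + K_c * N_c + 1)
    go : ∀ b c₁ c₂ c₃ c₄ → b ≡ suc (K_c * N_c) →
      2 * (2 + g) * (Kₐ * b * Nₐ) ≤ c₁ → 2 * d_c * (Kₐ * b * (2 * X)) ≤ c₂ →
      2 * d_c * ((Kₐ * b * X + Kₐ * b * X) + K_c * N_c) ≤ c₃ → 2 * g * (Kₐ * b * X + K_c * N_c + 1) ≤ c₄ →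
      Σ ℕ λ n₀ → ∀ n → n₀ ≤ n → Parameters n κ g Nₐ N_c d_c Kₐ K_c G
    go b c₁ c₂ c₃ c₄ b-eq h₁ h₂ h₃ h₄ = head + (t₁ + (t₂ + t₃)) , λ n le → parameters-for b L M {m₁} {m₂} b-eq
        (≤-trans h₁ (≤-trans (m≤m+n c₁ _) (n≤1+n _)))
        (≤-trans h₂ (≤-trans (m≤m+n c₂ _) (≤-trans (m≤n+m _ c₁) (n≤1+n _))))
        (≤-trans h₃ (≤-trans (m≤m+n c₃ _) (≤-trans (m≤n+m _ c₂) (≤-trans (m≤n+m _ c₁) (n≤1+n _)))))
        (≤-trans h₄ (≤-trans (m≤n+m c₄ c₃) (≤-trans (m≤n+m _ c₂) (≤-trans (m≤n+m _ c₁) (n≤1+n _)))))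
        (m≤m+n (2 * L) _) (≤-trans (m≤n+m 2 (2 * κ)) (m≤n+m _ (2 * L))) (≤-trans (m≤m+n (2 * κ) 2) (m≤n+m _ (2 * L)))
        (proj₂ (poly≤2^ (κ₁ + κ) (2 * L))) (proj₂ (poly≤2^ 1 (2 * L))) n
        (≤-trans (m≤m+n head _) le)
        (≤-trans (m≤m+n t₁ _) (≤-trans (m≤n+m _ head) le))
        (≤-trans (m≤m+n t₂ _) (≤-trans (m≤n+m _ t₁) (≤-trans (m≤n+m _ head) le)))
        (≤-trans (m≤n+m t₃ t₂) (≤-trans (m≤n+m _ t₁) (≤-trans (m≤n+m _ head) le)))
      where
      L M m₁ m₂ head t₁ t₂ t₃ : ℕ
      L = suc (c₁ + (c₂ + (c₃ + c₄)))
      M = 2 * L + (2 * κ + 2)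
      m₁ = proj₁ (poly≤2^ (κ₁ + κ) (2 * L))
      m₂ = proj₁ (poly≤2^ 1 (2 * L))
      head = suc (m₁ + m₂ + M) * L
      t₁ = 2 * κ
      t₂ = 2 * (2 * L) * κ
      t₃ = 2 * G (2 * L) M * (2 * M + suc κ * suc (2 * M))

  abstract
    large-systems : ∀ κ₁ g → 1 ≤ κ₁ → Σ ℕ λ n₀ → ∀ n → n₀ ≤ n → (𝓗 : System n κ₁ g) → HamCycle 𝓗
    large-systems κ₁ g 1≤κ₁ = proj₁ P , λ n le 𝓗 → cycle 𝓗 (proj₂ P n le)
      where
      P : Σ ℕ λ n₀ → ∀ n → n₀ ≤ n →
        Parameters n (suc κ₁) g (absLen κ₁) (connLen κ₁) (connDens κ₁ g) (famK (2 + g) (absLen κ₁)) (famK (connDens κ₁ g) (connLen κ₁)) (growDens κ₁ g)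
      P = parameters κ₁ g (absLen κ₁) (connLen κ₁) (connDens κ₁ g) (famK (2 + g) (absLen κ₁)) (famK (connDens κ₁ g) (connLen κ₁)) (growDens κ₁ g)
      cycle : ∀ {n} (𝓗 : System n κ₁ g) →
        Parameters n (suc κ₁) g (absLen κ₁) (connLen κ₁) (connDens κ₁ g) (famK (2 + g) (absLen κ₁)) (famK (connDens κ₁ g) (connLen κ₁)) (growDens κ₁ g) → HamCycle 𝓗
      cycle 𝓗 p = ham-cycle 𝓗 {D = D} {M = M} 1≤κ₁ (≤-trans (s≤s z≤n) 2κ≤n) 2κ≤n 2≤M 2κ≤M 1≤mₐ
          req-a (famT≤ (2 + g) (absLen κ₁) mₐ 1≤mₐ) room-a room-l req-c (famT≤ (connDens κ₁ g) (connLen κ₁) m_c 1≤m) room-c room-b left big₁ big₂ big₃ few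
        where open Parameters p

  -- Vertex lists as subsets

  toSubset : List (Fin n) → Subset n
  toSubset xs = ⋃ (map ⁅_⁆ xs)

  ∈-toSubset⁺ : ∀ {x : Fin n} {xs} → x ∈ xs → x Sub.∈ toSubset xs
  ∈-toSubset⁺ {xs = y ∷ xs} (here ≡refl) = Subₚ.x∈p∪q⁺ (inj₁ (Subₚ.x∈⁅x⁆ y))
  ∈-toSubset⁺ {xs = y ∷ xs} (there x∈)   = Subₚ.x∈p∪q⁺ (inj₂ (∈-toSubset⁺ x∈))

  ∈-toSubset⁻ : ∀ {x : Fin n} xs → x Sub.∈ toSubset xs → x ∈ xs
  ∈-toSubset⁻ []       x∈ = contradiction x∈ Subₚ.∉⊥
  ∈-toSubset⁻ (y ∷ xs) x∈ with Subₚ.x∈p∪q⁻ ⁅ y ⁆ (toSubset xs) x∈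
  ... | inj₁ p = here (Subₚ.x∈⁅y⁆⇒x≡y y p)
  ... | inj₂ p = there (∈-toSubset⁻ xs p)

  toSubset-↭ : {xs ys : List (Fin n)} → xs ↭ ys → toSubset xs ≡ toSubset ys
  toSubset-↭ {xs = xs} {ys} p = Subₚ.⊆-antisym
    (λ x∈ → ∈-toSubset⁺ (∈-resp-↭ p (∈-toSubset⁻ xs x∈))) (λ x∈ → ∈-toSubset⁺ (∈-resp-↭ (↭-sym p) (∈-toSubset⁻ ys x∈)))

  ∣⁅x⁆∪p∣ : ∀ (x : Fin n) p → x Sub.∉ p → ∣ ⁅ x ⁆ ∪ p ∣ ≡ suc ∣ p ∣
  ∣⁅x⁆∪p∣ zero    (inside  ∷ p) x∉ = contradiction here x∉
  ∣⁅x⁆∪p∣ zero    (outside ∷ p) x∉ = cong (suc ∘ ∣_∣) (Subₚ.∪-identityˡ p)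
  ∣⁅x⁆∪p∣ (suc x) (inside  ∷ p) x∉ = cong suc (∣⁅x⁆∪p∣ x p (x∉ ∘ there))
  ∣⁅x⁆∪p∣ (suc x) (outside ∷ p) x∉ = ∣⁅x⁆∪p∣ x p (x∉ ∘ there)

  ⁅x⁆∪p : ∀ (x : Fin n) p → x Sub.∈ p → ⁅ x ⁆ ∪ p ≡ p
  ⁅x⁆∪p x p x∈ = Subₚ.⊆-antisym (λ y∈ → case Subₚ.x∈p∪q⁻ ⁅ x ⁆ p y∈ of λ
    { (inj₁ q) → subst (Sub._∈ p) (sym (Subₚ.x∈⁅y⁆⇒x≡y x q)) x∈ ; (inj₂ q) → q }) (λ y∈ → Subₚ.x∈p∪q⁺ (inj₂ y∈))

  ∣toSubset∣ : {xs : List (Fin n)} → Unique xs → ∣ toSubset xs ∣ ≡ length xs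
  ∣toSubset∣ {n} {[]}     []  = Subₚ.∣⊥∣≡0 n
  ∣toSubset∣ {xs = x ∷ xs} u = ≡trans (∣⁅x⁆∪p∣ x (toSubset xs) (λ x∈ → Uniqueₚ.Unique[x∷xs]⇒x∉xs u (∈-toSubset⁻ xs x∈)))
                                        (cong suc (∣toSubset∣ (Unique-tail u)))

  ∣toSubset∣≤ : (xs : List (Fin n)) → ∣ toSubset xs ∣ ≤ length xs
  ∣toSubset∣≤ {n} [] = ≤-reflexive (Subₚ.∣⊥∣≡0 n)
  ∣toSubset∣≤ (x ∷ xs) with x Subₚ.∈? toSubset xs
  ... | yes x∈ = ≤-trans (≤-reflexive (cong ∣_∣ (⁅x⁆∪p x _ x∈))) (m≤n⇒m≤1+n (∣toSubset∣≤ xs))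
  ... | no x∉  = ≤-trans (≤-reflexive (∣⁅x⁆∪p∣ x _ x∉)) (s≤s (∣toSubset∣≤ xs))

  ∣toSubset∣⇒Unique : (xs : List (Fin n)) → ∣ toSubset xs ∣ ≡ length xs → Unique xs
  ∣toSubset∣⇒Unique []       eq = []
  ∣toSubset∣⇒Unique (x ∷ xs) eq with x Subₚ.∈? toSubset xs
  ... | yes x∈ = contradiction (≤-trans (≤-reflexive (sym eq)) (≤-trans (≤-reflexive (cong ∣_∣ (⁅x⁆∪p x _ x∈))) (∣toSubset∣≤ xs))) 1+n≰n
  ... | no x∉  = ∉⇒Unique (x∉ ∘ ∈-toSubset⁺) (∣toSubset∣⇒Unique xs (suc-injective (≡trans (sym (∣⁅x⁆∪p∣ x _ x∉)) eq)))

  ⊆∧∣∣≡⇒≡ : ∀ (p q : Subset n) → p Sub.⊆ q → ∣ p ∣ ≡ ∣ q ∣ → p ≡ q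
  ⊆∧∣∣≡⇒≡ []            []            h eq = ≡refl
  ⊆∧∣∣≡⇒≡ (inside  ∷ p) (inside  ∷ q) h eq = cong (inside ∷_) (⊆∧∣∣≡⇒≡ p q (Subₚ.drop-∷-⊆ h) (suc-injective eq))
  ⊆∧∣∣≡⇒≡ (inside  ∷ p) (outside ∷ q) h eq = contradiction (h here) λ ()
  ⊆∧∣∣≡⇒≡ (outside ∷ p) (inside  ∷ q) h eq = contradiction (≤-trans (≤-reflexive (sym eq)) (Subₚ.p⊆q⇒∣p∣≤∣q∣ (Subₚ.drop-∷-⊆ h))) 1+n≰n
  ⊆∧∣∣≡⇒≡ (outside ∷ p) (outside ∷ q) h eq = cong (outside ∷_) (⊆∧∣∣≡⇒≡ p q (Subₚ.drop-∷-⊆ h) eq)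

  one-more : ∀ (p q : Subset n) → p Sub.⊆ q → ∣ q ∣ ≡ suc ∣ p ∣ → ∃ λ x → q ≡ ⁅ x ⁆ ∪ p
  one-more []            []            h ()
  one-more (inside  ∷ p) (inside  ∷ q) h eq = let x , e = one-more p q (Subₚ.drop-∷-⊆ h) (suc-injective eq) in suc x , cong (inside ∷_) e
  one-more (inside  ∷ p) (outside ∷ q) h eq = contradiction (h here) λ ()
  one-more (outside ∷ p) (inside  ∷ q) h eq = zero , cong (inside ∷_) (≡trans (sym (⊆∧∣∣≡⇒≡ p q (Subₚ.drop-∷-⊆ h) (sym (suc-injective eq)))) (sym (Subₚ.∪-identityˡ p)))
  one-more (outside ∷ p) (outside ∷ q) h eq = let x , e = one-more p q (Subₚ.drop-∷-⊆ h) eq in suc x , cong (outside ∷_) e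

  allSubsets-unique : ∀ n → Unique (allSubsets n)
  allSubsets-unique zero    = [] ∷ []
  allSubsets-unique (suc n) = Unique-++ (Uniqueₚ.map⁺ tail-eq (allSubsets-unique n)) (Uniqueₚ.map⁺ tail-eq (allSubsets-unique n)) disjoint
    where
    tail-eq : ∀ {b} {p q : Subset n} → b ∷ p ≡ b ∷ q → p ≡ q
    tail-eq ≡refl = ≡refl
    disjoint : ∀ {p} → p ∈ map (true ∷_) (allSubsets n) → p ∉ map (false ∷_) (allSubsets n)
    disjoint a b with ∈-map⁻ (true ∷_) a | ∈-map⁻ (false ∷_) b
    ... | _ , _ , ≡refl | _ , _ , ()

  -- The density hypothesis in natural numbers

  codegree-ℕ : ∀ γ → ℚ.0ℚ ℚ.< γ → ∀ n d → (ℚ.½ ℚ.+ γ) ℚ.* (ℤ.+ n ℚ./ 1) ℚ.≤ (ℤ.+ d ℚ./ 1) →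
               (ℚ.↧ₙ γ + 2) * n ≤ 2 * ℚ.↧ₙ γ * d
  codegree-ℕ (ℚ.mkℚ (ℤ.+ zero)   q-1 cop) (ℚ.*<* (ℤ.+<+ ())) n d h
  codegree-ℕ (ℚ.mkℚ (ℤ.-[1+ _ ]) q-1 cop) (ℚ.*<* ()) n d h
  codegree-ℕ γ@(ℚ.mkℚ (ℤ.+ suc p) q-1 cop) _ n d h = go (ℚᵘₚ.≤-respˡ-≃ lhs (ℚᵘₚ.≤-respʳ-≃ (ℚₚ.toℚᵘ-fromℚᵘ (ℚᵘ.mkℚᵘ (ℤ.+ d) 0)) (ℚₚ.toℚᵘ-mono-≤ h)))
    where
    q = suc q-1
    lhs : ℚ.toℚᵘ ((ℚ.½ ℚ.+ γ) ℚ.* (ℤ.+ n ℚ./ 1)) ℚᵘ.≃ (ℚ.toℚᵘ ℚ.½ ℚᵘ.+ ℚ.toℚᵘ γ) ℚᵘ.* ℚᵘ.mkℚᵘ (ℤ.+ n) 0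
    lhs = ℚᵘₚ.≃-trans (ℚₚ.toℚᵘ-homo-* (ℚ.½ ℚ.+ γ) (ℤ.+ n ℚ./ 1)) (ℚᵘₚ.*-cong (ℚₚ.toℚᵘ-homo-+ ℚ.½ γ) (ℚₚ.toℚᵘ-fromℚᵘ (ℚᵘ.mkℚᵘ (ℤ.+ n) 0)))
    go : (ℚ.toℚᵘ ℚ.½ ℚᵘ.+ ℚ.toℚᵘ γ) ℚᵘ.* ℚᵘ.mkℚᵘ (ℤ.+ n) 0 ℚᵘ.≤ ℚᵘ.mkℚᵘ (ℤ.+ d) 0 → (q + 2) * n ≤ 2 * q * d
    go (ℚᵘ.*≤* le) = begin
      -- γ = (p + 1)/q is at least 1/q, so the denominator of γ can serve as g; the surplus 2pn is
      -- dropped here.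
      (q + 2) * n                            ≤⟨ m≤m+n _ (2 * p * n) ⟩
      (q + 2) * n + 2 * p * n                ≡⟨ r₁ q p n ⟩
      (1 * q + suc p * 2) * n * 1            ≤⟨ ℤₚ.drop‿+≤+ (≡.subst₂ ℤ._≤_ e₁ e₂ le) ⟩
      d * (2 * q * 1)                        ≡⟨ r₂ q d ⟩
      2 * q * d                              ∎
      where
      open ≤-Reasoning
      r₁ : ∀ q p n → (q + 2) * n + 2 * p * n ≡ (1 * q + suc p * 2) * n * 1
      r₁ = solve-∀
      r₂ : ∀ q d → d * (2 * q * 1) ≡ 2 * q * d
      r₂ = solve-∀
      e₁ : (ℤ.+ 1 ℤ.* ℤ.+ q ℤ.+ ℤ.+ suc p ℤ.* ℤ.+ 2) ℤ.* ℤ.+ n ℤ.* ℤ.+ 1 ≡ ℤ.+ ((1 * q + suc p * 2) * n * 1)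
      e₁ = ≡trans (cong (λ z → z ℤ.* ℤ.+ n ℤ.* ℤ.+ 1) (cong₂ ℤ._+_ (sym (ℤₚ.pos-* 1 q)) (sym (ℤₚ.pos-* (suc p) 2))))
           (≡trans (cong (ℤ._* ℤ.+ 1) (sym (ℤₚ.pos-* (1 * q + suc p * 2) n))) (sym (ℤₚ.pos-* ((1 * q + suc p * 2) * n) 1)))
      e₂ : ℤ.+ d ℤ.* ℤ.+ (2 * q * 1) ≡ ℤ.+ (d * (2 * q * 1))
      e₂ = sym (ℤₚ.pos-* d (2 * q * 1))

  -- Families of k-graphs as systems.

  module _ {κ₁ g n : ℕ} (H : Fin n → KGraph (suc (suc κ₁)) n)
           (dense : ∀ c (S : Subset n) → ∣ S ∣ ≡ suc κ₁ → (g + 2) * n ≤ 2 * g * deg (H c) S) where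

    private
      k : ℕ
      k = suc (suc κ₁)

      Edge : Fin n → List (Fin n) → Set
      Edge c xs = length xs ≡ k × toSubset xs ∈E H c

      Edge? : ∀ c xs → Dec (Edge c xs)
      Edge? c xs = (length xs ℕ.≟ k) ×-dec (edge (H c) (toSubset xs) ≟ᵇ true)

      -- Every edge containing S is S together with one further vertex, so the duplicate-free list
      -- of these edges is contained in the image of the list of neighbours.
      deg≤ : ∀ c S → length S ≡ suc κ₁ → Unique S → deg (H c) (toSubset S) ≤ # (λ x → does (Edge? c (x ∷ S)))
      deg≤ c S lS uS = ≤-trans (Unique-⊆-length (Uniqueₚ.filter⁺ sup? (allSubsets-unique n)) incl)
          (≤-reflexive (≡trans (length-map (λ x → toSubset (x ∷ S)) xs) (length-filter-∑ (λ x → Edge? c (x ∷ S)) (allFin n))))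
        where
        sup? : ∀ T → Dec (toSubset S Sub.⊆ T × edge (H c) T ≡ true)
        sup? T = (toSubset S Subₚ.⊆? T) ×-dec (edge (H c) T ≟ᵇ true)
        xs = filter (λ x → Edge? c (x ∷ S)) (allFin n)
        incl : ∀ {T} → T ∈ filter sup? (allSubsets n) → T ∈ map (λ x → toSubset (x ∷ S)) xs
        incl {T} T∈ with ∈-filter⁻ sup? {xs = allSubsets n} T∈
        ... | _ , S⊆T , e with one-more (toSubset S) T S⊆T (≡trans (uniform (H c) T e) (cong suc (sym (≡trans (∣toSubset∣ uS) lS))))
        ... | x , ≡refl = ∈-map⁺ (λ x → toSubset (x ∷ S)) (∈-filter⁺ (λ x → Edge? c (x ∷ S)) (∈-allFin x) (cong suc lS , e))

    system : System n κ₁ g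
    system = record
      { E        = Edge
      ; E?       = Edge?
      ; E-length = proj₁
      ; E-unique = λ {c} {xs} (l , e) → ∣toSubset∣⇒Unique xs (≡trans (uniform (H c) (toSubset xs) e) (sym l))
      ; E-perm   = λ {c} p (l , e) → ≡trans (sym (↭-length p)) l , subst (_∈E H c) (toSubset-↭ p) e
      ; codegree = λ c S uS lS → ≤-trans (dense c (toSubset S) (≡trans (∣toSubset∣ uS) lS)) (*-monoʳ-≤ (2 * g) (deg≤ c S lS uS))
      }

  -- Cyclic windows

  nth : List A → ℕ → Maybe A
  nth []       i       = nothing
  nth (x ∷ xs) zero    = just x
  nth (x ∷ xs) (suc i) = nth xs i

  nth-lookup : ∀ (xs : List A) i → nth xs (Fin.toℕ i) ≡ just (List.lookup xs i)
  nth-lookup (x ∷ xs) zero    = ≡refl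
  nth-lookup (x ∷ xs) (suc i) = nth-lookup xs i

  nth-++ˡ : ∀ (xs {ys} : List A) {i} → i < length xs → nth (xs ++ ys) i ≡ nth xs i
  nth-++ˡ (x ∷ xs) {i = zero}  lt       = ≡refl
  nth-++ˡ (x ∷ xs) {i = suc i} (s≤s lt) = nth-++ˡ xs lt

  nth-++ʳ : ∀ (xs {ys} : List A) i → nth (xs ++ ys) (length xs + i) ≡ nth ys i
  nth-++ʳ []       i = ≡refl
  nth-++ʳ (x ∷ xs) i = nth-++ʳ xs i

  nth-take : ∀ (xs : List A) {i j} → i < j → nth (take j xs) i ≡ nth xs i
  nth-take []       {j = suc j}             lt       = ≡refl
  nth-take (x ∷ xs) {i = zero}  {j = suc j} lt       = ≡refl
  nth-take (x ∷ xs) {i = suc i} {j = suc j} (s≤s lt) = nth-take xs lt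

  drop-nth : ∀ (xs : List A) {i x} → nth xs i ≡ just x → drop i xs ≡ x ∷ drop (suc i) xs
  drop-nth (x ∷ xs) {zero}  ≡refl = ≡refl
  drop-nth (x ∷ xs) {suc i} eq    = drop-nth xs eq

  window-tabulate : ∀ k i (xs : List A) (h : Fin k → A) → (∀ t → nth xs (i + Fin.toℕ t) ≡ just (h t)) →
                    take k (drop i xs) ≡ List.tabulate h
  window-tabulate zero    i xs h eq = ≡refl
  window-tabulate (suc k) i xs h eq = ≡trans (cong (take (suc k)) (drop-nth xs (≡trans (cong (nth xs) (sym (+-identityʳ i))) (eq zero))))
    (cong (h zero ∷_) (window-tabulate k (suc i) xs (h ∘ suc) (λ t → ≡trans (cong (nth xs) (sym (+-suc i (Fin.toℕ t)))) (eq (suc t)))))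

  toSubset-tightEdge : ∀ {n} k (σ : Permutation′ n) j → toSubset (List.tabulate {n = k} (λ t → σ ⟨$⟩ʳ shift j (Fin.toℕ t))) ≡ tightEdge k σ j
  toSubset-tightEdge k σ j = cong ⋃ (≡trans (map-tabulate (λ t → σ ⟨$⟩ʳ shift j (Fin.toℕ t)) ⁅_⁆) (sym (map-tabulate (λ t → t) (λ (t : Fin k) → ⁅ σ ⟨$⟩ʳ shift j (Fin.toℕ t) ⁆))))

  toℕ-shift : ∀ {m} (j : Fin (suc m)) t → Fin.toℕ (shift j t) ≡ (Fin.toℕ j + t) % suc m
  toℕ-shift {m} j t = Finₚ.toℕ-fromℕ< (m%n<n (Fin.toℕ j + t) (suc m))

  %-wrap : ∀ N .{{_ : NonZero N}} j s → j < N → s < N → (j + s) % N ≡ j + s ⊎ (j + s) % N + N ≡ j + s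
  %-wrap N j s j<N s<N with j + s <? N
  ... | yes lt = inj₁ (m<n⇒m%n≡m lt)
  ... | no ¬lt = inj₂ (≡trans (cong (_+ N) rem) (m∸n+n≡m (≮⇒≥ ¬lt)))
    where
    r = j + s ∸ N
    r<N : r < N
    r<N = +-cancelʳ-< N r N (≤-trans (s≤s (≤-reflexive (m∸n+n≡m (≮⇒≥ ¬lt)))) (+-mono-< j<N s<N))
    rem : (j + s) % N ≡ r
    rem = ≡trans (cong (_% N) (sym (m∸n+n≡m (≮⇒≥ ¬lt)))) (≡trans ([m+n]%n≡m%n r N) (m<n⇒m%n≡m r<N))

  -- Going s steps from j to i and t steps back to j makes s + t a multiple of N; being less than N
  -- it is zero.
  wrap-unique : ∀ N .{{_ : NonZero N}} i j s t → i < N → j < N → s + t < N → i ≡ (j + s) % N → j ≡ (i + t) % N → i ≡ j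
  wrap-unique N i j s t i<N j<N st<N ei ej with %-wrap N j s j<N (≤-trans (s≤s (m≤m+n s t)) st<N) | %-wrap N i t i<N (≤-trans (s≤s (m≤n+m t s)) st<N)
  ... | inj₁ a | inj₁ b = ≡trans i≡ (≡trans (cong (j +_) s≡0) (+-identityʳ j))
    where
    i≡ : i ≡ j + s
    i≡ = ≡trans ei a
    s≡0 : s ≡ 0
    s≡0 = m+n≡0⇒m≡0 s (+-cancelˡ-≡ j (s + t) 0 (≡trans (sym (+-assoc j s t)) (≡trans (cong (_+ t) (sym i≡)) (≡trans (sym b) (≡trans (sym ej) (sym (+-identityʳ j)))))))
  ... | inj₁ a | inj₂ b = contradiction st<N (≤⇒≯ (≤-reflexive (+-cancelˡ-≡ j N (s + t) (≡trans (cong (_+ N) ej) (≡trans b (≡trans (cong (_+ t) (≡trans ei a)) (+-assoc j s t)))))))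
  ... | inj₂ a | inj₁ b = contradiction st<N (≤⇒≯ (≤-reflexive (+-cancelˡ-≡ i N (s + t) (≡trans (cong (_+ N) ei) (≡trans a (≡trans (cong (_+ s) (≡trans ej b)) (≡trans (+-assoc i t s) (cong (i +_) (+-comm t s)))))))))
  ... | inj₂ a | inj₂ b = contradiction st<N (≤⇒≯ (≤-trans (m≤m+n N N) (≤-reflexive (+-cancelˡ-≡ (i + j) (N + N) (s + t)
        (≡trans (r₁ i j N) (≡trans (cong₂ _+_ (≡trans (cong (_+ N) ei) a) (≡trans (cong (_+ N) ej) b)) (r₂ i j s t)))))))
    where
    r₁ : ∀ i j N → i + j + (N + N) ≡ (i + N) + (j + N)
    r₁ = solve-∀
    r₂ : ∀ i j s t → (j + s) + (i + t) ≡ i + j + (s + t)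
    r₂ = solve-∀

  lookup-injective : ∀ {xs : List A} → Unique xs → ∀ i j → List.lookup xs i ≡ List.lookup xs j → i ≡ j
  lookup-injective (a ∷ u) zero    zero    eq = ≡refl
  lookup-injective (a ∷ u) zero    (suc j) eq = contradiction eq (All.lookup a (∈-lookup j))
  lookup-injective (a ∷ u) (suc i) zero    eq = contradiction (sym eq) (All.lookup a (∈-lookup i))
  lookup-injective (a ∷ u) (suc i) (suc j) eq = cong suc (lookup-injective u i j eq)

  module _ {n : ℕ} (vs : List (Fin n)) (perm : vs ↭ allFin n) where

    private
      len : n ≡ length vs
      len = ≡trans (sym (length-allFin n)) (sym (↭-length perm))

      uvs : Unique vs
      uvs = Unique-↭ (↭-sym perm) (Uniqueₚ.allFin⁺ n)

    entry : Fin n → Fin n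
    entry i = List.lookup vs (Fin.cast len i)

    entry-injective : ∀ i j → entry i ≡ entry j → i ≡ j
    entry-injective i j eq = Finₚ.toℕ-injective (≡trans (sym (Finₚ.toℕ-cast len i)) (≡trans (cong Fin.toℕ (lookup-injective uvs _ _ eq)) (Finₚ.toℕ-cast len j)))

    entry-nth : ∀ i → nth vs (Fin.toℕ i) ≡ just (entry i)
    entry-nth i = ≡trans (cong (nth vs) (sym (Finₚ.toℕ-cast len i))) (nth-lookup vs (Fin.cast len i))

    private
      position : Fin n → Fin n
      position x = Fin.cast (sym len) (Any.index (∈-resp-↭ (↭-sym perm) (∈-allFin x)))

      entry-position : ∀ x → entry (position x) ≡ x
      entry-position x = ≡trans (cong (List.lookup vs) (Finₚ.toℕ-injective (≡trans (Finₚ.toℕ-cast len _) (Finₚ.toℕ-cast (sym len) _))))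
        (sym (Anyₚ.lookup-index (∈-resp-↭ (↭-sym perm) (∈-allFin x))))

    ordering : Permutation′ n
    ordering = permutation entry position entry-position (λ i → entry-injective _ _ (entry-position (entry i)))

  module _ {κ₁ g n : ℕ} (𝓗 : System n κ₁ g) where
    open HamiltonCycle 𝓗

    RP-lookup : ∀ {vs cs} → RP vs cs → ∀ i → E (List.lookup cs i) (take k (drop (Fin.toℕ i) vs))
    RP-lookup {vs}          {c ∷ cs} (e , r) zero    = e
    RP-lookup {[]}          {c ∷ cs} (e , r) (suc i) = contradiction (E-length e) λ ()
    RP-lookup {v ∷ vs}      {c ∷ cs} (e , r) (suc i) = RP-lookup r i

    module _ (1≤n : 1 ≤ n) (2k≤n : 2 * k ≤ n) {vs cs : List V} (pv : vs ↭ allFin n) (pc : cs ↭ allFin n) (rp : RP (vs ++ take κ vs) cs) where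

      private
        at : Fin n → Fin k → V
        at j t = entry vs pv (shift j (Fin.toℕ t))

        len-vs : length vs ≡ n
        len-vs = ≡trans (↭-length pv) (length-allFin n)

        κ<n : κ < n
        κ<n = ≤-trans (m≤m+n k _) 2k≤n

        nth-cyclic : ∀ j t → nth (vs ++ take κ vs) (Fin.toℕ j + Fin.toℕ t) ≡ just (at j t)
        nth-cyclic = go n 1≤n ≡refl vs pv len-vs κ<n
          where
          -- Stated for a variable N so that n can be matched with a successor, where `shift`
          -- computes.
          go : ∀ N → 1 ≤ N → N ≡ n → (vs : List V) (pv : vs ↭ allFin n) → length vs ≡ n → κ < n → (j : Fin n) (t : Fin k) →
               nth (vs ++ take κ vs) (Fin.toℕ j + Fin.toℕ t) ≡ just (entry vs pv (shift j (Fin.toℕ t)))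
          go (suc N) _ ≡refl vs pv l κ<n j t = ≡trans step (≡trans (cong (nth vs) (sym (toℕ-shift j (Fin.toℕ t)))) (entry-nth vs pv (shift j (Fin.toℕ t))))
            where
            i = Fin.toℕ j + Fin.toℕ t
            t<k : Fin.toℕ t < k
            t<k = Finₚ.toℕ<n t
            step : nth (vs ++ take κ vs) i ≡ nth vs (i % suc N)
            step with i <? suc N
            ... | yes lt = ≡trans (nth-++ˡ vs (≤-trans lt (≤-reflexive (sym l)))) (cong (nth vs) (sym (m<n⇒m%n≡m lt)))
            ... | no ¬lt = ≡trans (cong (nth (vs ++ take κ vs)) i≡) (≡trans (nth-++ʳ vs r) (≡trans (nth-take vs r<κ) (cong (nth vs) r≡)))
              where
              r = i ∸ suc N
              i≡ : i ≡ length vs + r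
              i≡ = ≡trans (sym (m+[n∸m]≡n (≮⇒≥ ¬lt))) (cong (_+ r) (sym l))
              r<κ : r < κ
              r<κ = +-cancelˡ-< (suc N) r κ (≤-trans (s≤s (≤-reflexive (m+[n∸m]≡n (≮⇒≥ ¬lt)))) (+-mono-≤ (Finₚ.toℕ<n j) (ℕ.s≤s⁻¹ t<k)))
              r≡ : r ≡ i % suc N
              r≡ = sym (≡trans (cong (_% suc N) (sym (m∸n+n≡m (≮⇒≥ ¬lt)))) (≡trans ([m+n]%n≡m%n r (suc N)) (m<n⇒m%n≡m (<-trans r<κ κ<n))))

      tight-windows : ∀ j → E (entry cs pc j) (List.tabulate (at j))
      tight-windows j = subst (E (entry cs pc j)) (≡trans (cong (λ z → take k (drop z (vs ++ take κ vs))) (Finₚ.toℕ-cast len-cs j)) (window-tabulate k (Fin.toℕ j) _ (at j) (nth-cyclic j)))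
        (RP-lookup rp (Fin.cast len-cs j))
        where
        len-cs : n ≡ length cs
        len-cs = ≡trans (sym (length-allFin n)) (sym (↭-length pc))

      -- Equal edges put the start of each window into the other one, at offsets whose sum is below
      -- 2k ≤ n, so the starts agree. Colours assigned to positions are therefore well defined on
      -- edges.
      windows-distinct : ∀ i j → tightEdge k (ordering vs pv) i ≡ tightEdge k (ordering vs pv) j → i ≡ j
      windows-distinct i j eq = go n 1≤n ≡refl vs pv 2k≤n i j eq
        where
        go : ∀ N → 1 ≤ N → N ≡ n → (vs : List V) (pv : vs ↭ allFin n) → 2 * k ≤ n → ∀ i j →
             tightEdge k (ordering vs pv) i ≡ tightEdge k (ordering vs pv) j → i ≡ j
        go (suc N) _ ≡refl vs pv 2k≤n i j eq = Finₚ.toℕ-injective (wrap-unique (suc N) (Fin.toℕ i) (Fin.toℕ j) s s′ (Finₚ.toℕ<n i) (Finₚ.toℕ<n j) st<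
            (proj₂ (proj₂ (found i j eq))) (proj₂ (proj₂ (found j i (sym eq)))))
          where
          found : ∀ i j → tightEdge k (ordering vs pv) i ≡ tightEdge k (ordering vs pv) j →
                  Σ ℕ λ s → s < k × Fin.toℕ i ≡ (Fin.toℕ j + s) % suc N
          found i j eq with ∈-tabulate⁻ {f = λ (t : Fin k) → entry vs pv (shift j (Fin.toℕ t))}
              (∈-toSubset⁻ _ (subst (entry vs pv i Sub.∈_) (≡trans eq (sym (toSubset-tightEdge k (ordering vs pv) j)))
                (subst (entry vs pv i Sub.∈_) (toSubset-tightEdge k (ordering vs pv) i)
                  (∈-toSubset⁺ (subst (_∈ List.tabulate (λ (t : Fin k) → entry vs pv (shift i (Fin.toℕ t)))) (cong (entry vs pv) shift-0) (here ≡refl))))))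
            where
            shift-0 : shift i 0 ≡ i
            shift-0 = Finₚ.toℕ-injective (≡trans (toℕ-shift i 0) (≡trans (cong (_% suc N) (+-identityʳ (Fin.toℕ i))) (m<n⇒m%n≡m (Finₚ.toℕ<n i))))
          ... | s , e = Fin.toℕ s , Finₚ.toℕ<n s , ≡trans (cong Fin.toℕ (entry-injective vs pv i _ e)) (toℕ-shift j (Fin.toℕ s))
          s = proj₁ (found i j eq)
          s′ = proj₁ (found j i (sym eq))
          st< : s + s′ < suc N
          st< = ≤-trans (+-mono-<-≤ (proj₁ (proj₂ (found i j eq))) (<⇒≤ (proj₁ (proj₂ (found j i (sym eq)))))) (≤-trans (≤-reflexive (cong (k +_) (sym (+-identityʳ k)))) 2k≤n)

  rainbow-cycle : ∀ {κ₁ g n} (H : Fin n → KGraph (suc (suc κ₁)) n)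
    (dense : ∀ c (S : Subset n) → ∣ S ∣ ≡ suc κ₁ → (g + 2) * n ≤ 2 * g * deg (H c) S) →
    1 ≤ n → 2 * suc (suc κ₁) ≤ n → HamiltonCycle.HamCycle (system {g = g} H dense) → RainbowTightHamCycle H
  rainbow-cycle {κ₁} {g} {n} H dense 1≤n 2k≤n (vs , cs , pv , pc , rp) = ordering vs pv , entry cs pc
    , (λ i j eq → cong (entry cs pc) (windows-distinct 𝓗 1≤n 2k≤n pv pc rp i j eq))
    , (λ i j eq → cong (tightEdge (suc (suc κ₁)) (ordering vs pv)) (entry-injective cs pc i j eq))
    , λ j → subst (_∈E H (entry cs pc j)) (toSubset-tightEdge (suc (suc κ₁)) (ordering vs pv) j) (proj₂ (tight-windows 𝓗 1≤n 2k≤n pv pc rp j))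
    where
    𝓗 = system {g = g} H dense

  main : (k : ℕ) → 3 ≤ k → (γ : ℚ.ℚ) → ℚ.0ℚ ℚ.< γ → Σ ℕ λ n₀ → (n : ℕ) → n₀ ≤ n → (H : Fin n → KGraph k n) →
         (∀ i → MinCodegreeAtLeast (H i) ((ℚ.½ ℚ.+ γ) ℚ.* (ℤ.+ n ℚ./ 1))) → RainbowTightHamCycle H
  -- The summand 2k ensures that distinct positions of the cycle carry distinct edges.
  main (suc (suc κ₁)) (s≤s (s≤s 1≤κ₁)) γ γ>0 = n₀ + 2 * k , λ n le H codeg →
      let dense = λ c S eq → codegree-ℕ γ γ>0 n (deg (H c) S) (codeg c S eq)
          2k≤n  = ≤-trans (m≤n+m (2 * k) n₀) le
      in rainbow-cycle {g = g} H dense (≤-trans (s≤s z≤n) 2k≤n) 2k≤n (proj₂ (large-systems κ₁ g 1≤κ₁) n (≤-trans (m≤m+n n₀ _) le) (system H dense))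
    where
    k = suc (suc κ₁)
    g = ℚ.↧ₙ γ
    n₀ = proj₁ (large-systems κ₁ g 1≤κ₁)

open import Defs
open import Data.Nat using (ℕ; _≤_)
open import Data.Fin using (Fin)
open import Data.Rational using (ℚ; ½; 0ℚ; _<_; _+_; _*_; _/_)
open import Data.Integer using (+_)
open import Data.Product using (Σ)

theorem1p2 : (k : ℕ) → 3 ≤ k → (γ : ℚ) → 0ℚ < γ →
    Σ ℕ λ n₀ → (n : ℕ) → n₀ ≤ n →
    (H : Fin n → KGraph k n) →
    (∀ i → MinCodegreeAtLeast (H i) ((½ + γ) * (+ n / 1))) →
    RainbowTightHamCycle H
theorem1p2 = RainbowCycles.main
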